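{- Let $V=GF(3)^4$ and let $\mathcal{D}$ be a $2$-$(3^{4},3^{2},3)$ design with point set $V$ admitting a flag-transitive automorphism group $G=TG_{0}$, where $T$ is the translation group of $V$ and $G_0\le GL_4(3)$ is contained in a subgroup of $GL_4(3)$ of the form $(R\circ SL_{2}(5)):Z_{2}$ with $R\cong D_{8}\circ Q_{8}$ (i.e. the normalizer in $GL_4(3)$ of such a subgroup $R$). Then $\mathcal{D}$ is isomorphic to the design $\mathcal{D}_3$ described in the context.
   Context: A $2$-$(v,k,\lambda)$ design has $v$ points and $k$-subsets (blocks), every two points in exactly $\lambda$ blocks; flag-transitive = transitive on incident point-block pairs. Matrices act on row vectors on the right. Let $\alpha\in GL_4(3)$ have rows $(0,0,0,-1)$, $(-1,0,1,1)$, $(-1,-1,0,-1)$, $(1,0,0,0)$, and $\beta$ have rows $(1,1,0,0)$, $(0,1,0,0)$, $(0,0,1,1)$, $(0,0,0,1)$; then $H_0=\langle\alpha,\beta\rangle\cong SL_2(5)$. Let $B_0=\langle(1,0,0,0),(0,0,0,1)\rangle_{GF(3)}$. $\mathcal{D}_3$ is the design with point set $V$ and blocks $\{vA+c: v\in B_0\}$, $A\in H_0$, $c\in V$. $D_8\circ Q_8$ denotes the central product (extraspecial group of order $32$ of minus type). -}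

module Defs where

open import Data.Nat using (ℕ; zero; suc)
open import Data.Bool using (Bool; true; false; _∧_; not; _xor_; if_then_else_)
open import Data.List using (List; []; _∷_; _++_; map; concatMap)
open import Data.Vec using (Vec; []; _∷_; zipWith; replicate)
import Data.Vec as Vec
open import Data.Fin using (Fin)
open import Data.List using (allFin)
open import Data.Product using (Σ; ∃; _×_; _,_)
open import Data.Sum using (_⊎_)
open import Relation.Binary.PropositionalEquality using (_≡_; _≢_)
open import Relation.Nullary using (¬_)
open import Function.Bundles using (_↔_; Inverse)

data F3 : Set where
  𝟘 𝟙 𝟚 : F3

_+₃_ : F3 → F3 → F3
𝟘 +₃ y = y
𝟙 +₃ 𝟘 = 𝟙
𝟙 +₃ 𝟙 = 𝟚
𝟙 +₃ 𝟚 = 𝟘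
𝟚 +₃ 𝟘 = 𝟚
𝟚 +₃ 𝟙 = 𝟘
𝟚 +₃ 𝟚 = 𝟙

_*₃_ : F3 → F3 → F3
𝟘 *₃ y = 𝟘
𝟙 *₃ y = y
𝟚 *₃ 𝟘 = 𝟘
𝟚 *₃ 𝟙 = 𝟚
𝟚 *₃ 𝟚 = 𝟙

-₃_ : F3 → F3
-₃ 𝟘 = 𝟘
-₃ 𝟙 = 𝟚
-₃ 𝟚 = 𝟙

allF3 : List F3
allF3 = 𝟘 ∷ 𝟙 ∷ 𝟚 ∷ []

-- Vectors and matrices over GF(3); matrices act on row vectors on the right

V : Set
V = Vec F3 4

Mat : Set
Mat = Vec (Vec F3 4) 4   -- list of rows

_⊕_ : ∀ {n} → Vec F3 n → Vec F3 n → Vec F3 n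
_⊕_ = zipWith _+₃_

scale : ∀ {n} → F3 → Vec F3 n → Vec F3 n
scale a = Vec.map (a *₃_)

vecMat : ∀ {n m} → Vec F3 n → Vec (Vec F3 m) n → Vec F3 m
vecMat [] [] = replicate _ 𝟘
vecMat (a ∷ v) (r ∷ A) = scale a r ⊕ vecMat v A

_⊗_ : Mat → Mat → Mat
A ⊗ B = Vec.map (λ row → vecMat row B) A

I₄ : Mat
I₄ = (𝟙 ∷ 𝟘 ∷ 𝟘 ∷ 𝟘 ∷ [])
   ∷ (𝟘 ∷ 𝟙 ∷ 𝟘 ∷ 𝟘 ∷ [])
   ∷ (𝟘 ∷ 𝟘 ∷ 𝟙 ∷ 𝟘 ∷ [])
   ∷ (𝟘 ∷ 𝟘 ∷ 𝟘 ∷ 𝟙 ∷ [])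
   ∷ []

aff : Mat → V → V → V
aff A c x = vecMat x A ⊕ c

allVec : (n : ℕ) → List (Vec F3 n)
allVec zero = [] ∷ []
allVec (suc n) = concatMap (λ a → map (a ∷_) (allVec n)) allF3

-- (kept opaque only so that the typechecker does not unfold the 81-element
-- list while checking types; use `unfolding allV` to compute with it)
opaque
  allV : List V
  allV = allVec 4

count : ∀ {A : Set} → (A → Bool) → List A → ℕ
count p [] = 0
count p (x ∷ xs) = if p x then suc (count p xs) else count p xs

-- 2-(v,k,λ) designs with point set V = GF(3)^4 (so v = 81).
-- Blocks form a *set* of k-subsets of V, enumerated as Fin nblocks;
-- block i is given by its characteristic function inc i.

record Design (k lam : ℕ) : Set where
  field
    nblocks : ℕ
    inc     : Fin nblocks → V → Bool
    simple  : ∀ i j → (∀ x → inc i x ≡ inc j x) → i ≡ j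
    size    : ∀ i → count (inc i) allV ≡ k
    balance : ∀ x y → x ≢ y →
              count (λ i → inc i x ∧ inc i y) (allFin nblocks) ≡ lam

open Design public

IsSubgroupGL : (Mat → Set) → Set
IsSubgroupGL G₀ =
    (∀ A → G₀ A → Σ Mat λ B → (A ⊗ B ≡ I₄) × (B ⊗ A ≡ I₄))
  × G₀ I₄
  × (∀ A B → G₀ A → G₀ B → G₀ (A ⊗ B))
  × (∀ A B → G₀ A → A ⊗ B ≡ I₄ → G₀ B)

-- The group G = T G₀ = { x ↦ x A + c : A ∈ G₀, c ∈ V } acts on D as
-- a group of automorphisms, flag-transitively.

IsAutGroup : ∀ {k lam} → Design k lam → (Mat → Set) → Set
IsAutGroup D G₀ =
  ∀ A c → G₀ A → ∀ i → Σ (Fin (nblocks D)) λ j →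
    ∀ x → inc D j (aff A c x) ≡ inc D i x

FlagTransitive : ∀ {k lam} → Design k lam → (Mat → Set) → Set
FlagTransitive D G₀ =
  ∀ i j x y → inc D i x ≡ true → inc D j y ≡ true →
  Σ Mat λ A → Σ V λ c → G₀ A × (aff A c x ≡ y)
    × (∀ z → inc D j (aff A c z) ≡ inc D i z)

data Z4 : Set where
  r0 r1 r2 r3 : Z4

_+₄_ : Z4 → Z4 → Z4
r0 +₄ b = b
r1 +₄ r0 = r1
r1 +₄ r1 = r2
r1 +₄ r2 = r3
r1 +₄ r3 = r0
r2 +₄ r0 = r2
r2 +₄ r1 = r3
r2 +₄ r2 = r0
r2 +₄ r3 = r1
r3 +₄ r0 = r3
r3 +₄ r1 = r0
r3 +₄ r2 = r1
r3 +₄ r3 = r2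

-₄_ : Z4 → Z4
-₄ r0 = r0
-₄ r1 = r3
-₄ r2 = r2
-₄ r3 = r1

-- D₈ (dihedral of order 8): (a , s) stands for r^a f^s, with f r f = r⁻¹
D8 : Set
D8 = Z4 × Bool

_·D_ : D8 → D8 → D8
(a , s) ·D (b , t) = (a +₄ (if s then -₄ b else b)) , (s xor t)

eD zD : D8
eD = r0 , false
zD = r2 , false

-- Q₈ = {±1, ±i, ±j, ±k}: (s , u) stands for (-1)^s u
data U : Set where
  u1 ui uj uk : U

mulU : U → U → Bool × U   -- sign (true = minus) and unit
mulU u1 y  = false , y
mulU ui u1 = false , ui
mulU ui ui = true  , u1
mulU ui uj = false , uk
mulU ui uk = true  , uj
mulU uj u1 = false , uj
mulU uj ui = true  , uk
mulU uj uj = true  , u1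
mulU uj uk = false , ui
mulU uk u1 = false , uk
mulU uk ui = false , uj
mulU uk uj = true  , ui
mulU uk uk = true  , u1

Q8 : Set
Q8 = Bool × U

_·Q_ : Q8 → Q8 → Q8
(s , u) ·Q (t , w) with mulU u w
... | (e , v) = ((s xor t) xor e) , v

eQ zQ : Q8
eQ = false , u1
zQ = true , u1

-- R ≤ GL₄(3) with R ≅ D₈ ∘ Q₈ = (D₈ × Q₈)/⟨(z,z)⟩ is presented as the image
-- of a homomorphism φ : D₈ × Q₈ → GL₄(3) whose kernel is exactly
-- {(1,1), (z,z)}.
IsCentralProductRep : (D8 × Q8 → Mat) → Set
IsCentralProductRep φ =
    (∀ d q d' q' → φ ((d ·D d') , (q ·Q q')) ≡ φ (d , q) ⊗ φ (d' , q'))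
  × (∀ d q → φ (d , q) ≡ I₄ → (d ≡ eD × q ≡ eQ) ⊎ (d ≡ zD × q ≡ zQ))
  × (φ (zD , zQ) ≡ I₄)
  × (φ (eD , eQ) ≡ I₄)

InImage : (D8 × Q8 → Mat) → Mat → Set
InImage φ B = Σ (D8 × Q8) λ p → φ p ≡ B

InNormalizerOfD8Q8 : (Mat → Set) → Set
InNormalizerOfD8Q8 G₀ =
  Σ (D8 × Q8 → Mat) λ φ → IsCentralProductRep φ ×
    (∀ A A' → G₀ A → A ⊗ A' ≡ I₄ → ∀ B →
       (InImage φ B → InImage φ ((A' ⊗ B) ⊗ A))
     × (InImage φ ((A' ⊗ B) ⊗ A) → InImage φ B))

α β : Mat
α = (𝟘 ∷ 𝟘 ∷ 𝟘 ∷ 𝟚 ∷ [])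
  ∷ (𝟚 ∷ 𝟘 ∷ 𝟙 ∷ 𝟙 ∷ [])
  ∷ (𝟚 ∷ 𝟚 ∷ 𝟘 ∷ 𝟚 ∷ [])
  ∷ (𝟙 ∷ 𝟘 ∷ 𝟘 ∷ 𝟘 ∷ [])
  ∷ []
β = (𝟙 ∷ 𝟙 ∷ 𝟘 ∷ 𝟘 ∷ [])
  ∷ (𝟘 ∷ 𝟙 ∷ 𝟘 ∷ 𝟘 ∷ [])
  ∷ (𝟘 ∷ 𝟘 ∷ 𝟙 ∷ 𝟙 ∷ [])
  ∷ (𝟘 ∷ 𝟘 ∷ 𝟘 ∷ 𝟙 ∷ [])
  ∷ []

data InH₀ : Mat → Set where
  genα : InH₀ α
  genβ : InH₀ β
  one  : InH₀ I₄
  mul  : ∀ {A B} → InH₀ A → InH₀ B → InH₀ (A ⊗ B)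
  inv  : ∀ {A B} → InH₀ A → A ⊗ B ≡ I₄ → InH₀ B

InB₀ : V → Set
InB₀ v = Σ F3 λ a → Σ F3 λ b → v ≡ (a ∷ 𝟘 ∷ 𝟘 ∷ b ∷ [])

IsD₃Block : (V → Bool) → Set
IsD₃Block S = Σ Mat λ A → Σ V λ c → InH₀ A ×
  (∀ x → (S x ≡ true → Σ V λ v → InB₀ v × (x ≡ aff A c v))
       × (Σ V (λ v → InB₀ v × (x ≡ aff A c v)) → S x ≡ true))

IsoToD₃ : ∀ {k lam} → Design k lam → Set
IsoToD₃ D = Σ (V ↔ V) λ σ →
    (∀ i → IsD₃Block (λ y → inc D i (Inverse.from σ y)))
  × (∀ S → IsD₃Block S → Σ (Fin (nblocks D)) λ i →
       ∀ y → S y ≡ inc D i (Inverse.from σ y))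

{-# OPTIONS --safe #-}

-- A flag-transitive D has 30 blocks through 0, permuted transitively by a group Ĝ of linear
-- automorphisms. Double counting flags shows that a Ĝ-invariant set of non-zero vectors has
-- 10 c elements, c being the number of its points on a block through 0; so Ĝ is transitive on
-- the five pairs ±f of non-central involutions of R, since each pair spans 16 non-zero
-- eigenvectors. As 30 divides |Ĝ|, Cauchy's theorem gives an element of order 3. The
-- elements of order 3 of N(R) act on the five pairs as 3-cycles, and all of them are listed
-- by computation; transitivity yields two in Ĝ whose 3-cycles overlap in one point, and every such
-- couple is conjugate in N(R) to generators β, γ of H₀ = ⟨α, β⟩. So Ĝ contains H₀ up to conjugacy.
--
-- All blocks have translation stabilisers of the same size s. Counting blocks by T-orbits
-- gives 81 ∣ 270 s, and counting the blocks fixed by each translation, with H₀ having two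
-- orbits of length 40 on the non-zero vectors, gives 40 ∣ 270 (s - 1). As s ≤ 9, this leaves s = 9,
-- and the blocks through 0 are lines, three on each point of PG(3, 3). Of the nine H₀-orbits on lines
-- the eigenspaces of the involutions are excluded, and only two orbits of length 30 remain;
-- they are swapped by the centraliser of H₀, and one of them gives 𝒟₃.

module Submission where

open import Defs
open import Algebra.Properties.CommutativeSemigroup using (interchange)
open import Data.Bool using (Bool; true; false; _∧_; not)
import Data.Bool.Properties as Bool
open import Data.Empty using (⊥; ⊥-elim)
open import Data.Fin using (Fin; zero; suc; toℕ; #_)
import Data.Fin.Properties as Fin
open import Data.List
  using (List; []; _∷_; _++_; map; concatMap; allFin; tabulate; length; lookup; cartesianProductWith)
open import Data.List.Membership.Propositional using (_∈_; find; lose)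
open import Data.List.Membership.Propositional.Properties using (∈-map⁻; ∈-cartesianProductWith⁻)
open import Data.List.Properties using (length-tabulate)
open import Data.List.Relation.Unary.All using (All)
import Data.List.Relation.Unary.All as All
open import Data.List.Relation.Unary.Any using (Any; here; there)
import Data.List.Relation.Unary.Any as Any
import Data.List.Relation.Unary.Any.Properties as Anyₚ
open import Data.Nat using (ℕ; zero; suc; _+_; _*_; _≤_; _<_; z≤n; s≤s; _≤?_; _<ᵇ_; _≡ᵇ_)
open import Data.Nat.Divisibility using (_∣_; divides; _∣?_; ∣m+n∣m⇒∣n; ∣m⇒∣m*n; m∣m*n)
import Data.Nat.Properties as ℕ
open import Data.Product using (Σ; ∃; _×_; _,_; proj₁; proj₂)
open import Data.Sum using (_⊎_; inj₁; inj₂; [_,_]′)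
open import Data.Unit using (tt)
open import Data.Vec using (Vec; []; _∷_; replicate)
import Data.Vec as Vec
import Data.Vec.Properties as Vecₚ
open import Function using (_∘_; case_of_; mk↔ₛ′)
open import Relation.Binary.Definitions using (DecidableEquality)
open import Relation.Binary.PropositionalEquality hiding (J)
open import Relation.Nullary using (Dec; yes; no; ¬_; does; ¬?; contradiction)
open import Relation.Nullary.Decidable
  using (_×-dec_; _→-dec_; _⊎-dec_; dec-true; dec-false; map′; toWitness; toWitnessFalse; True)
open import Relation.Unary using (Decidable)

open ≡-Reasoning

-- Two obstacles come before the counting. `R` is the image of an arbitrary `φ`, and `G₀` is an
-- arbitrary predicate without a decision procedure, so it has no order to compute with. A basis
-- adapted to `φ` conjugates `R` to the explicit matrices `R₀`, and `G₀` gives way to Ĝ, the group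
-- of all linear automorphisms of the design that normalise `R₀`. It contains the conjugate of `G₀`,
-- so it inherits transitivity, and membership in it is decidable because there are finitely many
-- matrices.
--
-- The 3¹⁶ matrices are too many to evaluate anything over; sums over them are only manipulated
-- symbolically. Each computed fact is therefore cut down to a short list. An element of order 3
-- fixes a non-zero vector, and N(R) is transitive on these, so 32 · 32 candidates fixing `v₁` are
-- enough. One member of a pair of 3-cycles can be taken to be `β`. Lines are tabulated only through
-- `v₁` and `v₂`, which represent the two point orbits of H₀.

pattern ⟨_,_,_,_⟩ a b c d = a Vec.∷ b Vec.∷ c Vec.∷ d Vec.∷ Vec.[]

-- Linear algebra over GF(3)

_≟F_ : DecidableEquality F3
𝟘 ≟F 𝟘 = yes refl
𝟘 ≟F 𝟙 = no λ ()
𝟘 ≟F 𝟚 = no λ ()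
𝟙 ≟F 𝟘 = no λ ()
𝟙 ≟F 𝟙 = yes refl
𝟙 ≟F 𝟚 = no λ ()
𝟚 ≟F 𝟘 = no λ ()
𝟚 ≟F 𝟙 = no λ ()
𝟚 ≟F 𝟚 = yes refl

_≟V_ : DecidableEquality V
_≟V_ = Vecₚ.≡-dec _≟F_

_≟M_ : DecidableEquality Mat
_≟M_ = Vecₚ.≡-dec _≟V_

+₃-assoc : ∀ x y z → (x +₃ y) +₃ z ≡ x +₃ (y +₃ z)
+₃-assoc 𝟘 y z = refl
+₃-assoc 𝟙 𝟘 z = refl
+₃-assoc 𝟙 𝟙 𝟘 = refl
+₃-assoc 𝟙 𝟙 𝟙 = refl
+₃-assoc 𝟙 𝟙 𝟚 = refl
+₃-assoc 𝟙 𝟚 𝟘 = refl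
+₃-assoc 𝟙 𝟚 𝟙 = refl
+₃-assoc 𝟙 𝟚 𝟚 = refl
+₃-assoc 𝟚 𝟘 z = refl
+₃-assoc 𝟚 𝟙 𝟘 = refl
+₃-assoc 𝟚 𝟙 𝟙 = refl
+₃-assoc 𝟚 𝟙 𝟚 = refl
+₃-assoc 𝟚 𝟚 𝟘 = refl
+₃-assoc 𝟚 𝟚 𝟙 = refl
+₃-assoc 𝟚 𝟚 𝟚 = refl

+₃-comm : ∀ x y → x +₃ y ≡ y +₃ x
+₃-comm 𝟘 𝟘 = refl
+₃-comm 𝟘 𝟙 = refl
+₃-comm 𝟘 𝟚 = refl
+₃-comm 𝟙 𝟘 = refl
+₃-comm 𝟙 𝟙 = refl
+₃-comm 𝟙 𝟚 = refl
+₃-comm 𝟚 𝟘 = refl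
+₃-comm 𝟚 𝟙 = refl
+₃-comm 𝟚 𝟚 = refl

*₃-distribˡ : ∀ x y z → x *₃ (y +₃ z) ≡ (x *₃ y) +₃ (x *₃ z)
*₃-distribˡ 𝟘 y z = refl
*₃-distribˡ 𝟙 y z = refl
*₃-distribˡ 𝟚 𝟘 z = refl
*₃-distribˡ 𝟚 𝟙 𝟘 = refl
*₃-distribˡ 𝟚 𝟙 𝟙 = refl
*₃-distribˡ 𝟚 𝟙 𝟚 = refl
*₃-distribˡ 𝟚 𝟚 𝟘 = refl
*₃-distribˡ 𝟚 𝟚 𝟙 = refl
*₃-distribˡ 𝟚 𝟚 𝟚 = refl

*₃-comm : ∀ x y → x *₃ y ≡ y *₃ x
*₃-comm 𝟘 𝟘 = refl
*₃-comm 𝟘 𝟙 = refl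
*₃-comm 𝟘 𝟚 = refl
*₃-comm 𝟙 𝟘 = refl
*₃-comm 𝟙 𝟙 = refl
*₃-comm 𝟙 𝟚 = refl
*₃-comm 𝟚 𝟘 = refl
*₃-comm 𝟚 𝟙 = refl
*₃-comm 𝟚 𝟚 = refl

*₃-distribʳ : ∀ x y z → (y +₃ z) *₃ x ≡ (y *₃ x) +₃ (z *₃ x)
*₃-distribʳ x y z = trans (*₃-comm (y +₃ z) x)
  (trans (*₃-distribˡ x y z) (cong₂ _+₃_ (*₃-comm x y) (*₃-comm x z)))

*₃-assoc : ∀ x y z → (x *₃ y) *₃ z ≡ x *₃ (y *₃ z)
*₃-assoc 𝟘 y z = refl
*₃-assoc 𝟙 y z = refl
*₃-assoc 𝟚 𝟘 z = refl
*₃-assoc 𝟚 𝟙 z = refl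
*₃-assoc 𝟚 𝟚 𝟘 = refl
*₃-assoc 𝟚 𝟚 𝟙 = refl
*₃-assoc 𝟚 𝟚 𝟚 = refl

private variable
  d d′ d″ : ℕ

⊕-assoc : (u v w : Vec F3 d) → (u ⊕ v) ⊕ w ≡ u ⊕ (v ⊕ w)
⊕-assoc = Vecₚ.zipWith-assoc +₃-assoc

⊕-comm : (u v : Vec F3 d) → u ⊕ v ≡ v ⊕ u
⊕-comm = Vecₚ.zipWith-comm +₃-comm

𝟎 : Vec F3 d
𝟎 = replicate _ 𝟘

⊕-identityˡ : (v : Vec F3 d) → 𝟎 ⊕ v ≡ v
⊕-identityˡ = Vecₚ.zipWith-identityˡ λ _ → refl

⊕-identityʳ : (v : Vec F3 d) → v ⊕ 𝟎 ≡ v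
⊕-identityʳ v = trans (⊕-comm v 𝟎) (⊕-identityˡ v)

⊕-interchange : (a b c d : Vec F3 d) → (a ⊕ b) ⊕ (c ⊕ d) ≡ (a ⊕ c) ⊕ (b ⊕ d)
⊕-interchange a b c d = begin
  (a ⊕ b) ⊕ (c ⊕ d) ≡⟨ ⊕-assoc a b (c ⊕ d) ⟩
  a ⊕ (b ⊕ (c ⊕ d)) ≡⟨ cong (a ⊕_) (⊕-assoc b c d) ⟨
  a ⊕ ((b ⊕ c) ⊕ d) ≡⟨ cong (λ t → a ⊕ (t ⊕ d)) (⊕-comm b c) ⟩
  a ⊕ ((c ⊕ b) ⊕ d) ≡⟨ cong (a ⊕_) (⊕-assoc c b d) ⟩
  a ⊕ (c ⊕ (b ⊕ d)) ≡⟨ ⊕-assoc a c (b ⊕ d) ⟨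
  (a ⊕ c) ⊕ (b ⊕ d) ∎

scale-⊕ : ∀ a (u v : Vec F3 d) → scale a (u ⊕ v) ≡ scale a u ⊕ scale a v
scale-⊕ a [] [] = refl
scale-⊕ a (x ∷ u) (y ∷ v) = cong₂ _∷_ (*₃-distribˡ a x y) (scale-⊕ a u v)

scale-+₃ : ∀ a b (v : Vec F3 d) → scale (a +₃ b) v ≡ scale a v ⊕ scale b v
scale-+₃ a b [] = refl
scale-+₃ a b (x ∷ v) = cong₂ _∷_ (*₃-distribʳ x a b) (scale-+₃ a b v)

scale-*₃ : ∀ a b (v : Vec F3 d) → scale (a *₃ b) v ≡ scale a (scale b v)
scale-*₃ a b [] = refl
scale-*₃ a b (x ∷ v) = cong₂ _∷_ (*₃-assoc a b x) (scale-*₃ a b v)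

scale-𝟎 : ∀ a → scale a (𝟎 {d}) ≡ 𝟎
scale-𝟎 {zero} a = refl
scale-𝟎 {suc d} a = cong₂ _∷_ (*₃-comm a 𝟘) (scale-𝟎 a)

scale-𝟘 : (v : Vec F3 d) → scale 𝟘 v ≡ 𝟎
scale-𝟘 [] = refl
scale-𝟘 (_ ∷ v) = cong (𝟘 ∷_) (scale-𝟘 v)

scale-𝟙 : (v : Vec F3 d) → scale 𝟙 v ≡ v
scale-𝟙 = Vecₚ.map-id

neg : Vec F3 d → Vec F3 d
neg = scale 𝟚

⊕-inverseʳ : (v : Vec F3 d) → v ⊕ neg v ≡ 𝟎
⊕-inverseʳ v = begin
  v ⊕ neg v ≡⟨ cong (_⊕ neg v) (scale-𝟙 v) ⟨
  scale 𝟙 v ⊕ neg v ≡⟨ scale-+₃ 𝟙 𝟚 v ⟨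
  scale 𝟘 v ≡⟨ scale-𝟘 v ⟩
  𝟎 ∎

neg-involutive : (v : Vec F3 d) → neg (neg v) ≡ v
neg-involutive v = trans (sym (scale-*₃ 𝟚 𝟚 v)) (scale-𝟙 v)

⊕-neg-cancel : (u v : Vec F3 d) → (u ⊕ v) ⊕ neg v ≡ u
⊕-neg-cancel u v = trans (⊕-assoc u v (neg v)) (trans (cong (u ⊕_) (⊕-inverseʳ v)) (⊕-identityʳ u))

neg-⊕-cancel : (u v : Vec F3 d) → (u ⊕ neg v) ⊕ v ≡ u
neg-⊕-cancel u v = trans (⊕-assoc u (neg v) v)
  (trans (cong (u ⊕_) (trans (⊕-comm (neg v) v) (⊕-inverseʳ v))) (⊕-identityʳ u))

vecMat-⊕ : (u v : Vec F3 d) (A : Vec (Vec F3 d′) d) →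
  vecMat (u ⊕ v) A ≡ vecMat u A ⊕ vecMat v A
vecMat-⊕ [] [] [] = sym (⊕-identityˡ _)
vecMat-⊕ (x ∷ u) (y ∷ v) (r ∷ A) = trans
  (cong₂ _⊕_ (scale-+₃ x y r) (vecMat-⊕ u v A))
  (⊕-interchange (scale x r) (scale y r) (vecMat u A) (vecMat v A))

vecMat-scale : ∀ a (v : Vec F3 d) (A : Vec (Vec F3 d′) d) →
  vecMat (scale a v) A ≡ scale a (vecMat v A)
vecMat-scale a [] [] = sym (scale-𝟎 a)
vecMat-scale a (x ∷ v) (r ∷ A) = trans
  (cong₂ _⊕_ (scale-*₃ a x r) (vecMat-scale a v A))
  (sym (scale-⊕ a (scale x r) (vecMat v A)))

vecMat-𝟎 : (A : Vec (Vec F3 d′) d) → vecMat 𝟎 A ≡ 𝟎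
vecMat-𝟎 [] = refl
vecMat-𝟎 (r ∷ A) = trans (cong₂ _⊕_ (scale-𝟘 r) (vecMat-𝟎 A)) (⊕-identityˡ 𝟎)

vecMat-assoc : (v : Vec F3 d) (A : Vec (Vec F3 d′) d) (B : Vec (Vec F3 d″) d′) →
  vecMat v (Vec.map (λ row → vecMat row B) A) ≡ vecMat (vecMat v A) B
vecMat-assoc [] [] B = sym (vecMat-𝟎 B)
vecMat-assoc (x ∷ v) (r ∷ A) B = trans
  (cong₂ _⊕_ (sym (vecMat-scale x r B)) (vecMat-assoc v A B))
  (sym (vecMat-⊕ (scale x r) (vecMat v A) B))

infixl 25 _·_

_·_ : V → Mat → V
_·_ = vecMat

·-⊗ : ∀ v A B → v · (A ⊗ B) ≡ v · A · B
·-⊗ = vecMat-assoc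

⊗-assoc : ∀ A B C → (A ⊗ B) ⊗ C ≡ A ⊗ (B ⊗ C)
⊗-assoc A B C = trans (sym (Vecₚ.map-∘ (λ r → vecMat r C) (λ r → vecMat r B) A))
  (Vecₚ.map-cong (λ r → sym (·-⊗ r B C)) A)

⊗-identityˡ : ∀ A → I₄ ⊗ A ≡ A
⊗-identityˡ ⟨ p , q , r , s ⟩ = cong₂ _∷_ e₀ (cong₂ _∷_ e₁ (cong₂ _∷_ e₂ (cong₂ _∷_ e₃ refl)))
  where
  z : (v w : V) → scale 𝟘 v ⊕ w ≡ w
  z v w = trans (cong (_⊕ w) (scale-𝟘 v)) (⊕-identityˡ w)
  o : (v w : V) → w ≡ 𝟎 → scale 𝟙 v ⊕ w ≡ v
  o v w refl = trans (⊕-identityʳ _) (scale-𝟙 v)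
  z₃ = z s 𝟎
  z₂₃ = trans (z r _) z₃
  e₀ = o p _ (trans (z q _) z₂₃)
  e₁ = trans (z p _) (o q _ z₂₃)
  e₂ = trans (z p _) (trans (z q _) (o r _ z₃))
  e₃ = trans (z p _) (trans (z q _) (trans (z r _) (o s 𝟎 refl)))

·-I : ∀ v → v · I₄ ≡ v
·-I ⟨ a , b , c , d ⟩ =
  cong₂ _∷_ (f a b c d) (cong₂ _∷_ (g a b c d) (cong₂ _∷_ (h a b c d) (cong₂ _∷_ (k′ a b c d) refl)))
  where
  *𝟘 : ∀ x → x *₃ 𝟘 ≡ 𝟘
  *𝟘 x = *₃-comm x 𝟘
  *𝟙 : ∀ x → x *₃ 𝟙 ≡ x
  *𝟙 x = *₃-comm x 𝟙
  +𝟘 : ∀ x → x +₃ 𝟘 ≡ x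
  +𝟘 x = +₃-comm x 𝟘
  f : ∀ a b c d → (a *₃ 𝟙) +₃ ((b *₃ 𝟘) +₃ ((c *₃ 𝟘) +₃ ((d *₃ 𝟘) +₃ 𝟘))) ≡ a
  f a b c d rewrite *𝟙 a | *𝟘 b | *𝟘 c | *𝟘 d = +𝟘 a
  g : ∀ a b c d → (a *₃ 𝟘) +₃ ((b *₃ 𝟙) +₃ ((c *₃ 𝟘) +₃ ((d *₃ 𝟘) +₃ 𝟘))) ≡ b
  g a b c d rewrite *𝟘 a | *𝟙 b | *𝟘 c | *𝟘 d = +𝟘 b
  h : ∀ a b c d → (a *₃ 𝟘) +₃ ((b *₃ 𝟘) +₃ ((c *₃ 𝟙) +₃ ((d *₃ 𝟘) +₃ 𝟘))) ≡ c
  h a b c d rewrite *𝟘 a | *𝟘 b | *𝟙 c | *𝟘 d = +𝟘 c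
  k′ : ∀ a b c d → (a *₃ 𝟘) +₃ ((b *₃ 𝟘) +₃ ((c *₃ 𝟘) +₃ ((d *₃ 𝟙) +₃ 𝟘))) ≡ d
  k′ a b c d rewrite *𝟘 a | *𝟘 b | *𝟘 c | *𝟙 d = +𝟘 d

⊗-identityʳ : ∀ A → A ⊗ I₄ ≡ A
⊗-identityʳ A = trans (Vecₚ.map-cong ·-I A) (Vecₚ.map-id A)

Mat-ext : ∀ {A B} → (∀ v → v · A ≡ v · B) → A ≡ B
Mat-ext {A} {B} h = trans (sym (⊗-identityˡ A)) (trans (Vecₚ.map-cong h I₄) (⊗-identityˡ B))

Inverses : Mat → Mat → Set
Inverses A A' = (A ⊗ A' ≡ I₄) × (A' ⊗ A ≡ I₄)

Inverses-sym : ∀ {A A'} → Inverses A A' → Inverses A' A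
Inverses-sym (p , q) = q , p

cancelʳ : ∀ {A A'} → A ⊗ A' ≡ I₄ → ∀ v → v · A · A' ≡ v
cancelʳ {A} {A'} e v = trans (sym (·-⊗ v A A')) (trans (cong (v ·_) e) (·-I v))

⊗-cancelʳ : ∀ {A A'} → A ⊗ A' ≡ I₄ → ∀ B → (B ⊗ A) ⊗ A' ≡ B
⊗-cancelʳ {A} {A'} e B = trans (⊗-assoc B A A') (trans (cong (B ⊗_) e) (⊗-identityʳ B))

⊗-cancelˡ : ∀ {A A'} → A ⊗ A' ≡ I₄ → ∀ B → A ⊗ (A' ⊗ B) ≡ B
⊗-cancelˡ {A} {A'} e B = trans (sym (⊗-assoc A A' B)) (trans (cong (_⊗ B) e) (⊗-identityˡ B))

⊗-inverse : ∀ {A A' B B'} → A ⊗ A' ≡ I₄ → B ⊗ B' ≡ I₄ → (A ⊗ B) ⊗ (B' ⊗ A') ≡ I₄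
⊗-inverse {A} {A'} {B} {B'} e f =
  trans (⊗-assoc A B (B' ⊗ A')) (trans (cong (A ⊗_) (⊗-cancelˡ f A')) e)

Inverses-⊗ : ∀ {A A' B B'} → Inverses A A' → Inverses B B' → Inverses (A ⊗ B) (B' ⊗ A')
Inverses-⊗ (p , p') (q , q') = ⊗-inverse p q , ⊗-inverse q' p'

private variable
  𝔸 𝔹 : Set

-- Finite sums

∑ : List 𝔸 → (𝔸 → ℕ) → ℕ
∑ [] f = 0
∑ (x ∷ xs) f = f x + ∑ xs f

⟦_⟧ : Bool → ℕ
⟦ true ⟧ = 1
⟦ false ⟧ = 0

⟦∧⟧ : ∀ a b → ⟦ a ∧ b ⟧ ≡ ⟦ a ⟧ * ⟦ b ⟧
⟦∧⟧ true b = sym (ℕ.*-identityˡ ⟦ b ⟧)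
⟦∧⟧ false b = refl

count≡∑ : (p : 𝔸 → Bool) (xs : List 𝔸) → count p xs ≡ ∑ xs (λ x → ⟦ p x ⟧)
count≡∑ p [] = refl
count≡∑ p (x ∷ xs) with p x
... | true  = cong suc (count≡∑ p xs)
... | false = count≡∑ p xs

∑-cong : ∀ {f g : 𝔸 → ℕ} (xs : List 𝔸) → (∀ x → f x ≡ g x) → ∑ xs f ≡ ∑ xs g
∑-cong [] h = refl
∑-cong (x ∷ xs) h = cong₂ _+_ (h x) (∑-cong xs h)

∑-+ : ∀ (xs : List 𝔸) f g → ∑ xs (λ x → f x + g x) ≡ ∑ xs f + ∑ xs g
∑-+ [] f g = refl
∑-+ (x ∷ xs) f g = trans (cong (f x + g x +_) (∑-+ xs f g)) (interchange ℕ.+-commutativeSemigroup (f x) (g x) (∑ xs f) (∑ xs g))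

∑-*ˡ : ∀ c (xs : List 𝔸) f → ∑ xs (λ x → c * f x) ≡ c * ∑ xs f
∑-*ˡ c [] f = sym (ℕ.*-zeroʳ c)
∑-*ˡ c (x ∷ xs) f = trans (cong (c * f x +_) (∑-*ˡ c xs f)) (sym (ℕ.*-distribˡ-+ c (f x) (∑ xs f)))

∑-*ʳ : ∀ c (xs : List 𝔸) f → ∑ xs (λ x → f x * c) ≡ ∑ xs f * c
∑-*ʳ c xs f = trans (∑-cong xs λ x → ℕ.*-comm (f x) c) (trans (∑-*ˡ c xs f) (ℕ.*-comm c (∑ xs f)))

∑-const : ∀ c (xs : List 𝔸) → ∑ xs (λ _ → c) ≡ length xs * c
∑-const c [] = refl
∑-const c (x ∷ xs) = cong (c +_) (∑-const c xs)

∑-0 : (xs : List 𝔸) → ∑ xs (λ _ → 0) ≡ 0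
∑-0 xs = trans (∑-const 0 xs) (ℕ.*-zeroʳ (length xs))

∑-swap : ∀ (xs : List 𝔸) (ys : List 𝔹) (f : 𝔸 → 𝔹 → ℕ) →
  ∑ xs (λ x → ∑ ys (f x)) ≡ ∑ ys (λ y → ∑ xs (λ x → f x y))
∑-swap [] ys f = sym (∑-0 ys)
∑-swap (x ∷ xs) ys f = trans (cong (∑ ys (f x) +_) (∑-swap xs ys f))
  (sym (∑-+ ys (f x) (λ y → ∑ xs (λ x → f x y))))

∑-map : ∀ (g : 𝔸 → 𝔹) xs (f : 𝔹 → ℕ) → ∑ (map g xs) f ≡ ∑ xs (f ∘ g)
∑-map g [] f = refl
∑-map g (x ∷ xs) f = cong (f (g x) +_) (∑-map g xs f)

∑-++ : ∀ (xs ys : List 𝔸) f → ∑ (xs ++ ys) f ≡ ∑ xs f + ∑ ys f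
∑-++ [] ys f = refl
∑-++ (x ∷ xs) ys f = trans (cong (f x +_) (∑-++ xs ys f)) (sym (ℕ.+-assoc (f x) (∑ xs f) (∑ ys f)))

∑-concatMap : ∀ (g : 𝔸 → List 𝔹) xs f → ∑ (concatMap g xs) f ≡ ∑ xs (λ x → ∑ (g x) f)
∑-concatMap g [] f = refl
∑-concatMap g (x ∷ xs) f = trans (∑-++ (g x) (concatMap g xs) f) (cong (∑ (g x) f +_) (∑-concatMap g xs f))

∑-mono : ∀ {f g : 𝔸 → ℕ} (xs : List 𝔸) → (∀ x → f x ≤ g x) → ∑ xs f ≤ ∑ xs g
∑-mono [] h = z≤n
∑-mono (x ∷ xs) h = ℕ.+-mono-≤ (h x) (∑-mono xs h)

-- Equal totals leave no slack in any term. Applied to characteristic functions, this turns an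
-- inclusion between finite sets of equal size into an equality.
∑-≡⇒≗ : ∀ {f g : 𝔸 → ℕ} (xs : List 𝔸) → (∀ x → f x ≤ g x) → ∑ xs f ≡ ∑ xs g →
  ∀ {x} → x ∈ xs → f x ≡ g x
∑-≡⇒≗ {f = f} {g} (x ∷ xs) h e = λ where
    (here refl) → fx≡gx
    (there p)   → ∑-≡⇒≗ xs h
      (ℕ.+-cancelˡ-≡ (f x) _ _ (trans e (cong (_+ ∑ xs g) (sym fx≡gx)))) p
  where
  fx≡gx : f x ≡ g x
  fx≡gx = ℕ.≤-antisym (h x) (ℕ.+-cancelʳ-≤ (∑ xs f) (g x) (f x)
    (ℕ.≤-trans (ℕ.+-monoʳ-≤ (g x) (∑-mono xs h)) (ℕ.≤-reflexive (sym e))))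

∑-positive : ∀ (xs : List 𝔸) f → ∑ xs f ≢ 0 → ∃ λ x → f x ≢ 0
∑-positive [] f h = ⊥-elim (h refl)
∑-positive (x ∷ xs) f h with f x in e
... | zero  = ∑-positive xs f h
... | suc n = x , λ e′ → case trans (sym e) e′ of λ ()
  where open import Function using (case_of_)

-- Enumerated finite types

does-cong : ∀ {P Q : Set} (p : Dec P) (q : Dec Q) → (P → Q) → (Q → P) → does p ≡ does q
does-cong (yes p) q f g = sym (dec-true q (f p))
does-cong (no ¬p) q f g = sym (dec-false q (¬p ∘ g))

does⁻ : ∀ {P : Set} (p : Dec P) → does p ≡ true → P
does⁻ (yes p) _ = p

-- `once` says that the list enumerates the type without omission or repetition.
record Finite (A : Set) : Set where
  field
    elems : List A
    _≟_   : DecidableEquality A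
    once  : ∀ a → ∑ elems (λ x → ⟦ does (x ≟ a) ⟧) ≡ 1

  complete : ∀ a → a ∈ elems
  complete a = go elems (λ e → case trans (sym e) (once a) of λ ())
    where
    go : ∀ xs → ∑ xs (λ x → ⟦ does (x ≟ a) ⟧) ≢ 0 → a ∈ xs
    go [] h = ⊥-elim (h refl)
    go (x ∷ xs) h with x ≟ a
    ... | yes refl = here refl
    ... | no _ = there (go xs h)

  any? : ∀ {P : A → Set} → Decidable P → Dec (∃ P)
  any? P? = map′ Any.satisfied (λ (a , p) → Any.map (λ { refl → p }) (complete a)) (Any.any? P? elems)

  all? : ∀ {P : A → Set} → Decidable P → Dec (∀ a → P a)
  all? P? = map′ (λ h a → All.lookup h (complete a)) (λ h → All.tabulate λ {a} _ → h a) (All.all? P? elems)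

  -- Position in the enumeration: an arbitrary linear order, which serves to single out one rotation
  -- of a triple.
  key : A → ℕ
  key a = toℕ (Any.index (complete a))

  key-injective : ∀ {a b} → key a ≡ key b → a ≡ b
  key-injective {a} {b} e = trans (Anyₚ.lookup-index (complete a))
    (trans (cong (lookup elems) (Fin.toℕ-injective e)) (sym (Anyₚ.lookup-index (complete b))))

  ∑-δ : ∀ a (h : A → ℕ) → ∑ elems (λ x → ⟦ does (x ≟ a) ⟧ * h x) ≡ h a
  ∑-δ a h = begin
    ∑ elems (λ x → ⟦ does (x ≟ a) ⟧ * h x) ≡⟨ ∑-cong elems step ⟩
    ∑ elems (λ x → ⟦ does (x ≟ a) ⟧ * h a) ≡⟨ ∑-*ʳ (h a) elems _ ⟩
    ∑ elems (λ x → ⟦ does (x ≟ a) ⟧) * h a ≡⟨ cong (_* h a) (once a) ⟩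
    1 * h a ≡⟨ ℕ.*-identityˡ (h a) ⟩
    h a ∎
    where
    step : ∀ x → ⟦ does (x ≟ a) ⟧ * h x ≡ ⟦ does (x ≟ a) ⟧ * h a
    step x with x ≟ a
    ... | yes refl = refl
    ... | no _ = refl

  ∑-pos : ∀ f a → f a ≢ 0 → ∑ elems f ≢ 0
  ∑-pos f a h e = h (sym (∑-≡⇒≗ elems (λ _ → z≤n) (trans (∑-0 elems) (sym e)) (complete a)))

  ∑-all : ∀ {f g : A → ℕ} → (∀ x → f x ≤ g x) → ∑ elems f ≡ ∑ elems g → ∀ x → f x ≡ g x
  ∑-all h e x = ∑-≡⇒≗ elems h e (complete x)

  -- Writing `h (f x)` as a sum against a delta function turns the change of variables into an
  -- exchange of two summations, so no permutation of lists is involved.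
  ∑-bij : ∀ (f g : A → A) → (∀ x → f (g x) ≡ x) → (∀ x → g (f x) ≡ x) →
    ∀ h → ∑ elems (h ∘ f) ≡ ∑ elems h
  ∑-bij f g fg gf h = begin
    ∑ elems (λ x → h (f x))
      ≡⟨ ∑-cong elems (λ x → ∑-δ (f x) h) ⟨
    ∑ elems (λ x → ∑ elems λ y → ⟦ does (y ≟ f x) ⟧ * h y)
      ≡⟨ ∑-swap elems elems _ ⟩
    ∑ elems (λ y → ∑ elems λ x → ⟦ does (y ≟ f x) ⟧ * h y)
      ≡⟨ ∑-cong elems (λ y → ∑-cong elems λ x → cong (λ b → ⟦ b ⟧ * h y)
           (does-cong (y ≟ f x) (x ≟ g y)
             (λ e → trans (sym (gf x)) (cong g (sym e)))
             (λ e → trans (sym (fg y)) (cong f (sym e))))) ⟩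
    ∑ elems (λ y → ∑ elems λ x → ⟦ does (x ≟ g y) ⟧ * h y)
      ≡⟨ ∑-cong elems (λ y → ∑-δ (g y) (λ _ → h y)) ⟩
    ∑ elems h ∎

module _ {A : Set} (F : Finite A) where
  open Finite F

  vectors : ∀ n → List (Vec A n)
  vectors zero = [] ∷ []
  vectors (suc n) = concatMap (λ a → map (a ∷_) (vectors n)) elems

  vectors-once : ∀ {n} (v : Vec A n) → ∑ (vectors n) (λ x → ⟦ does (Vecₚ.≡-dec _≟_ x v) ⟧) ≡ 1
  vectors-once [] = refl
  vectors-once {suc n} (a ∷ v) = begin
    ∑ (vectors (suc n)) (λ x → ⟦ does (Vecₚ.≡-dec _≟_ x (a ∷ v)) ⟧)
      ≡⟨ ∑-concatMap _ elems _ ⟩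
    ∑ elems (λ b → ∑ (map (b ∷_) (vectors n)) (λ x → ⟦ does (Vecₚ.≡-dec _≟_ x (a ∷ v)) ⟧))
      ≡⟨ ∑-cong elems (λ b → ∑-map (b ∷_) (vectors n) _) ⟩
    ∑ elems (λ b → ∑ (vectors n) (λ x → ⟦ does (b ≟ a) ∧ does (Vecₚ.≡-dec _≟_ x v) ⟧))
      ≡⟨ ∑-cong elems (λ b → trans (∑-cong (vectors n) λ x → ⟦∧⟧ (does (b ≟ a)) _)
           (trans (∑-*ˡ ⟦ does (b ≟ a) ⟧ (vectors n) _) (cong (⟦ does (b ≟ a) ⟧ *_) (vectors-once v)))) ⟩
    ∑ elems (λ b → ⟦ does (b ≟ a) ⟧ * 1)
      ≡⟨ ∑-δ a (λ _ → 1) ⟩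
    1 ∎

  Vec-finite : ∀ n → Finite (Vec A n)
  Vec-finite n = record { elems = vectors n ; _≟_ = Vecₚ.≡-dec _≟_ ; once = vectors-once }

F3-finite : Finite F3
F3-finite = record { elems = allF3 ; _≟_ = _≟F_ ; once = λ { 𝟘 → refl ; 𝟙 → refl ; 𝟚 → refl } }

allVec≡vectors : ∀ n → allVec n ≡ vectors F3-finite n
allVec≡vectors zero = refl
allVec≡vectors (suc n) = cong (λ vs → concatMap (λ a → map (a ∷_) vs) allF3) (allVec≡vectors n)

opaque
  unfolding allV

  allV≡vectors : allV ≡ vectors F3-finite 4
  allV≡vectors = allVec≡vectors 4

V-finite : Finite V
V-finite = record
  { elems = allV
  ; _≟_ = _≟V_
  ; once = λ a → trans (cong (λ vs → ∑ vs (λ x → ⟦ does (x ≟V a) ⟧)) allV≡vectors) (vectors-once F3-finite a)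
  }

-- Only its existence matters: the 3¹⁶ matrices must never be listed by the type checker.
opaque
  Mat-finite : Finite Mat
  Mat-finite = Vec-finite V-finite 4

∑-tabulate : ∀ {n} (g : Fin n → 𝔸) f → ∑ (tabulate g) f ≡ ∑ (allFin n) (f ∘ g)
∑-tabulate {n = zero} g f = refl
∑-tabulate {n = suc n} g f = cong (f (g zero) +_)
  (trans (∑-tabulate (g ∘ suc) f) (sym (∑-tabulate suc (f ∘ g))))

Fin-once : ∀ {n} (a : Fin n) → ∑ (allFin n) (λ x → ⟦ does (x Fin.≟ a) ⟧) ≡ 1
Fin-once {suc n} zero = cong suc (trans (∑-tabulate {n = n} Fin.suc _) (∑-0 (allFin n)))
Fin-once {suc n} (suc a) = trans (∑-tabulate {n = n} Fin.suc _) (Fin-once a)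

Fin-finite : ∀ n → Finite (Fin n)
Fin-finite n = record { elems = allFin n ; _≟_ = Fin._≟_ ; once = Fin-once }

-- Cyclic rotation of triples

⟦allEqual⟧ ⟦firstMin⟧ : ℕ → ℕ → ℕ → ℕ
⟦allEqual⟧ a b c = ⟦ (b ≡ᵇ a) ∧ (c ≡ᵇ a) ⟧
-- The first entry of a cyclic triple is the start of its run of minimal entries.
⟦firstMin⟧ a b c = ⟦ (a <ᵇ c) ∧ not (b <ᵇ a) ⟧

-- The minimal entries of a non-constant cyclic triple form a single run, which has exactly one
-- start. Lowering all three entries together reduces to the case of a zero entry.
unique-rotation : ∀ a b c →
  1 ≡ ⟦allEqual⟧ a b c + (⟦firstMin⟧ a b c + (⟦firstMin⟧ b c a + ⟦firstMin⟧ c a b))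
unique-rotation zero zero zero = refl
unique-rotation zero zero (suc c) = refl
unique-rotation zero (suc b) zero = refl
unique-rotation zero (suc b) (suc c) = sym (cong (λ t → 1 + ⟦ t ⟧) (Bool.∧-zeroʳ (c <ᵇ b)))
unique-rotation (suc a) zero zero = refl
unique-rotation (suc a) zero (suc c) = sym (cong (λ t → ⟦ t ⟧ + 1) (Bool.∧-zeroʳ (a <ᵇ c)))
unique-rotation (suc a) (suc b) zero = sym (trans
  (cong (λ t → ⟦ t ⟧ + (⟦ (b <ᵇ a) ∧ false ⟧ + 1)) (Bool.∧-zeroʳ (b ≡ᵇ a)))
  (cong (λ t → ⟦ t ⟧ + 1) (Bool.∧-zeroʳ (b <ᵇ a))))
unique-rotation (suc a) (suc b) (suc c) = unique-rotation a b c

module Rotation {A : Set} (F : Finite A) where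
  open Finite F

  ≡ᵇ-key : ∀ x y → (key x ≡ᵇ key y) ≡ does (x ≟ y)
  ≡ᵇ-key x y with x ≟ y
  ... | yes refl = dec-true (key x ℕ.≟ key x) refl
  ... | no x≢y = dec-false (key x ℕ.≟ key y) (x≢y ∘ key-injective)

  ∑³ : (A → A → A → ℕ) → ℕ
  ∑³ f = ∑ elems λ A → ∑ elems λ B → ∑ elems λ C → f A B C

  ∑³-cong : ∀ {f g} → (∀ A B C → f A B C ≡ g A B C) → ∑³ f ≡ ∑³ g
  ∑³-cong h = ∑-cong elems λ A → ∑-cong elems λ B → ∑-cong elems λ C → h A B C

  ∑³-+ : ∀ f g → ∑³ (λ A B C → f A B C + g A B C) ≡ ∑³ f + ∑³ g
  ∑³-+ f g = trans (∑-cong elems λ A → trans (∑-cong elems λ B → ∑-+ elems _ _) (∑-+ elems _ _))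
    (∑-+ elems _ _)

  ∑³-rotate : ∀ f → ∑³ (λ A B C → f B C A) ≡ ∑³ f
  ∑³-rotate f = trans (∑-swap elems elems _) (∑-cong elems λ B → ∑-swap elems elems _)

  -- Multiplying by the partition of unity of `unique-rotation` splits the sum into the diagonal and
  -- three parts, which rotating the summation variables shows to be equal. This takes the place of
  -- counting orbits of a cyclic group of order 3.
  ∑³-rotation : ∀ T → (∀ x y z → T x y z ≡ T y z x) →
    ∃ λ m → ∑³ T ≡ 3 * m + ∑ elems (λ x → T x x x)
  ∑³-rotation T rotate = m , (begin
    ∑³ T
      ≡⟨ ∑³-cong (λ x y z → trans (sym (ℕ.*-identityʳ (T x y z))) (trans
           (cong (T x y z *_) (unique-rotation (key x) (key y) (key z)))
           (distrib (T x y z) (⟦allEqual⟧ (key x) (key y) (key z)) (first x y z) (first y z x) (first z x y)))) ⟩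
    ∑³ (λ x y z → t₀ x y z + (t₁ x y z + (t₂ x y z + t₃ x y z)))
      ≡⟨ ∑³-+ t₀ (λ x y z → t₁ x y z + (t₂ x y z + t₃ x y z)) ⟩
    ∑³ t₀ + ∑³ (λ x y z → t₁ x y z + (t₂ x y z + t₃ x y z))
      ≡⟨ cong₂ _+_ diagonal (trans (∑³-+ t₁ (λ x y z → t₂ x y z + t₃ x y z))
           (cong (m +_) (trans (∑³-+ t₂ t₃) (cong₂ _+_ second third)))) ⟩
    ∑ elems (λ x → T x x x) + (m + (m + m))
      ≡⟨ cong (λ t → ∑ elems (λ x → T x x x) + (m + (m + t))) (ℕ.+-identityʳ m) ⟨
    ∑ elems (λ x → T x x x) + 3 * m
      ≡⟨ ℕ.+-comm _ (3 * m) ⟩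
    3 * m + ∑ elems (λ x → T x x x) ∎)
    where
    first t₀ t₁ t₂ t₃ : A → A → A → ℕ
    first x y z = ⟦firstMin⟧ (key x) (key y) (key z)
    t₀ x y z = T x y z * ⟦allEqual⟧ (key x) (key y) (key z)
    t₁ x y z = T x y z * first x y z
    t₂ x y z = T x y z * first y z x
    t₃ x y z = T x y z * first z x y
    m : ℕ
    m = ∑³ t₁
    distrib : ∀ t a b c d → t * (a + (b + (c + d))) ≡ t * a + (t * b + (t * c + t * d))
    distrib t a b c d = trans (ℕ.*-distribˡ-+ t a _) (cong (t * a +_)
      (trans (ℕ.*-distribˡ-+ t b _) (cong (t * b +_) (ℕ.*-distribˡ-+ t c d))))
    second : ∑³ t₂ ≡ m
    second = trans (∑³-cong λ x y z → cong (_* first y z x) (rotate x y z)) (∑³-rotate t₁)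
    third : ∑³ t₃ ≡ m
    third = trans (∑³-cong λ x y z → cong (_* first z x y) (trans (rotate x y z) (rotate y z x)))
      (trans (∑³-rotate (λ x y z → t₁ y z x)) (∑³-rotate t₁))
    diagonal : ∑³ t₀ ≡ ∑ elems (λ x → T x x x)
    diagonal = ∑-cong elems λ x → begin
      ∑ elems (λ y → ∑ elems λ z → T x y z * ⟦ (key y ≡ᵇ key x) ∧ (key z ≡ᵇ key x) ⟧)
        ≡⟨ ∑-cong elems (λ y → ∑-cong elems λ z → trans (ℕ.*-comm (T x y z) _)
             (trans (cong (_* T x y z) (trans (cong₂ (λ p q → ⟦ p ∧ q ⟧) (≡ᵇ-key y x) (≡ᵇ-key z x)) (⟦∧⟧ (does (y ≟ x)) _)))
                    (ℕ.*-assoc ⟦ does (y ≟ x) ⟧ _ _))) ⟩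
      ∑ elems (λ y → ∑ elems λ z → ⟦ does (y ≟ x) ⟧ * (⟦ does (z ≟ x) ⟧ * T x y z))
        ≡⟨ ∑-cong elems (λ y → trans (∑-*ˡ ⟦ does (y ≟ x) ⟧ elems _)
             (cong (⟦ does (y ≟ x) ⟧ *_) (∑-δ x (T x y)))) ⟩
      ∑ elems (λ y → ⟦ does (y ≟ x) ⟧ * T x y x)
        ≡⟨ ∑-δ x (λ y → T x y x) ⟩
      T x x x ∎

-- The normaliser of R

-- Images of generators r, f of D₈ and i, j of Q₈ in a copy of R that is normalised by α and β.
f₀ r₀ i₀ j₀ k₀ S₀ S₀⁻¹ : Mat
f₀ = ⟨ ⟨ 𝟙 , 𝟘 , 𝟘 , 𝟚 ⟩ , ⟨ 𝟘 , 𝟙 , 𝟘 , 𝟘 ⟩ , ⟨ 𝟘 , 𝟙 , 𝟚 , 𝟘 ⟩ , ⟨ 𝟘 , 𝟘 , 𝟘 , 𝟚 ⟩ ⟩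
r₀ = ⟨ ⟨ 𝟘 , 𝟚 , 𝟙 , 𝟘 ⟩ , ⟨ 𝟘 , 𝟘 , 𝟘 , 𝟙 ⟩ , ⟨ 𝟚 , 𝟘 , 𝟘 , 𝟙 ⟩ , ⟨ 𝟘 , 𝟚 , 𝟘 , 𝟘 ⟩ ⟩
i₀ = ⟨ ⟨ 𝟘 , 𝟙 , 𝟚 , 𝟘 ⟩ , ⟨ 𝟙 , 𝟘 , 𝟘 , 𝟙 ⟩ , ⟨ 𝟚 , 𝟘 , 𝟘 , 𝟙 ⟩ , ⟨ 𝟘 , 𝟙 , 𝟙 , 𝟘 ⟩ ⟩
j₀ = ⟨ ⟨ 𝟚 , 𝟘 , 𝟚 , 𝟙 ⟩ , ⟨ 𝟙 , 𝟙 , 𝟘 , 𝟙 ⟩ , ⟨ 𝟚 , 𝟙 , 𝟚 , 𝟘 ⟩ , ⟨ 𝟘 , 𝟙 , 𝟙 , 𝟙 ⟩ ⟩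
S₀ = ⟨ ⟨ 𝟘 , 𝟙 , 𝟘 , 𝟘 ⟩ , ⟨ 𝟙 , 𝟘 , 𝟘 , 𝟙 ⟩ , ⟨ 𝟘 , 𝟘 , 𝟘 , 𝟙 ⟩ , ⟨ 𝟘 , 𝟙 , 𝟙 , 𝟘 ⟩ ⟩
S₀⁻¹ = ⟨ ⟨ 𝟘 , 𝟙 , 𝟚 , 𝟘 ⟩ , ⟨ 𝟙 , 𝟘 , 𝟘 , 𝟘 ⟩ , ⟨ 𝟚 , 𝟘 , 𝟘 , 𝟙 ⟩ , ⟨ 𝟘 , 𝟘 , 𝟙 , 𝟘 ⟩ ⟩
k₀ = i₀ ⊗ j₀

-- Both vectors are fixed by `β`, and `v₁ · r₀` is `v₂`, so `r₀` joins the two orbits of ⟨α, β⟩ on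
-- non-zero vectors.
v₁ v₂ : V
v₁ = ⟨ 𝟘 , 𝟙 , 𝟘 , 𝟘 ⟩
v₂ = ⟨ 𝟘 , 𝟘 , 𝟘 , 𝟙 ⟩

negM : Mat → Mat
negM = Vec.map neg

negM-involutive : ∀ A → negM (negM A) ≡ A
negM-involutive A = trans (sym (Vecₚ.map-∘ neg neg A)) (trans (Vecₚ.map-cong neg-involutive A) (Vecₚ.map-id A))

negM-⊗ : ∀ A B → negM A ⊗ B ≡ negM (A ⊗ B)
negM-⊗ A B = trans (sym (Vecₚ.map-∘ (_· B) neg A))
  (trans (Vecₚ.map-cong (λ v → vecMat-scale 𝟚 v B) A) (Vecₚ.map-∘ neg (_· B) A))

·-negM : ∀ {m n} (v : Vec F3 n) (A : Vec (Vec F3 m) n) → vecMat v (Vec.map neg A) ≡ neg (vecMat v A)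
·-negM [] [] = sym (scale-𝟎 𝟚)
·-negM (x ∷ v) (r ∷ A) = trans
  (cong₂ _⊕_ (trans (sym (scale-*₃ x 𝟚 r)) (trans (cong (λ c → scale c r) (*₃-comm x 𝟚)) (scale-*₃ 𝟚 x r)))
    (·-negM v A))
  (sym (scale-⊕ 𝟚 (scale x r) (vecMat v A)))

⊗-negM : ∀ A B → A ⊗ negM B ≡ negM (A ⊗ B)
⊗-negM A B = trans (Vecₚ.map-cong (λ v → ·-negM v B) A) (Vecₚ.map-∘ neg (_· B) A)

r₀^ : Z4 → Mat
r₀^ r0 = I₄
r₀^ r1 = r₀
r₀^ r2 = r₀ ⊗ r₀
r₀^ r3 = r₀ ⊗ (r₀ ⊗ r₀)

φD : D8 → Mat
φD (a , false) = r₀^ a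
φD (a , true)  = r₀^ a ⊗ f₀

φU : U → Mat
φU u1 = I₄
φU ui = i₀
φU uj = j₀
φU uk = k₀

φQ : Q8 → Mat
φQ (false , u) = φU u
φQ (true  , u) = negM (φU u)

φ₀ : D8 × Q8 → Mat
φ₀ (d , q) = φD d ⊗ φQ q

-- As `r₀ ⊗ r₀` is -1, which also lies in the quaternion factor, the rotations 1 and `r₀` suffice
-- and each of the 32 elements is listed once.
R₀ : List Mat
R₀ = cartesianProductWith _⊗_
  (map φD (cartesianProductWith _,_ (r0 ∷ r1 ∷ []) (false ∷ true ∷ [])))
  (map φQ (cartesianProductWith _,_ (false ∷ true ∷ []) (u1 ∷ ui ∷ uj ∷ uk ∷ [])))

row? : ∀ R W z → Dec (Any (λ Y → W ≡ z ⊗ Y) R)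
row? R W z = Any.any? (λ Y → W ≟M (z ⊗ Y)) R

-- The deciders take the lists as arguments so that evaluation shares them.
normalises? : ∀ R L z → Dec (All (λ X → Any (λ Y → X ⊗ z ≡ z ⊗ Y) R) L)
normalises? R L z = All.all? (λ X → row? R (X ⊗ z) z) L

-- The form X A = A Y, instead of A⁻¹ X A = Y, can be tested on a matrix whose inverse is not at
-- hand.
Normalises : Mat → Set
Normalises A = All (λ X → Any (λ Y → X ⊗ A ≡ A ⊗ Y) R₀) R₀

-- Opaque, as Agda would otherwise expand the 32 matrices of R₀ in every type mentioning them.
opaque
  Norm : Mat → Set
  Norm = Normalises

  InR₀ : Mat → Set
  InR₀ X = X ∈ R₀

  norm? : ∀ A → Dec (Norm A)
  norm? A = normalises? R₀ R₀ A

  InR₀⁺ : ∀ {X} → X ∈ R₀ → InR₀ X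
  InR₀⁺ X∈ = X∈

  InR₀⁻ : ∀ {X} → InR₀ X → X ∈ R₀
  InR₀⁻ X∈ = X∈

  Norm⁺ : ∀ {A} → (∀ {X} → InR₀ X → ∃ λ Y → InR₀ Y × X ⊗ A ≡ A ⊗ Y) → Norm A
  Norm⁺ h = All.tabulate λ X∈ → let (_ , Y∈ , e) = h X∈ in lose Y∈ e

  Norm⁻ : ∀ {A} → Norm A → ∀ {X} → InR₀ X → ∃ λ Y → InR₀ Y × X ⊗ A ≡ A ⊗ Y
  Norm⁻ N X∈ = find (All.lookup N X∈)

opaque
  unfolding Norm

  norm-α : Norm α
  norm-α = toWitness {a? = normalises? R₀ R₀ α} tt

  norm-β : Norm β
  norm-β = toWitness {a? = normalises? R₀ R₀ β} tt

  norm-f₀ : Norm f₀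
  norm-f₀ = toWitness {a? = normalises? R₀ R₀ f₀} tt

  norm-r₀ : Norm r₀
  norm-r₀ = toWitness {a? = normalises? R₀ R₀ r₀} tt

  norm-i₀ : Norm i₀
  norm-i₀ = toWitness {a? = normalises? R₀ R₀ i₀} tt

  norm-j₀ : Norm j₀
  norm-j₀ = toWitness {a? = normalises? R₀ R₀ j₀} tt

Norm-negM : ∀ {A} → Norm A → Norm (negM A)
Norm-negM {A} N = Norm⁺ λ {X} X∈ → let (Y , Y∈ , e) = Norm⁻ N X∈ in
  Y , Y∈ , trans (⊗-negM X A) (trans (cong negM e) (sym (negM-⊗ A Y)))

Norm-⊗ : ∀ {A B} → Norm A → Norm B → Norm (A ⊗ B)
Norm-⊗ {A} {B} NA NB = Norm⁺ step
  where
  step : ∀ {X} → InR₀ X → ∃ λ Z → InR₀ Z × X ⊗ (A ⊗ B) ≡ (A ⊗ B) ⊗ Z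
  step {X} X∈ with Norm⁻ NA X∈
  ... | Y , Y∈ , e with Norm⁻ NB Y∈
  ... | Z , Z∈ , f = Z , Z∈ , (begin
    X ⊗ (A ⊗ B) ≡⟨ ⊗-assoc X A B ⟨
    (X ⊗ A) ⊗ B ≡⟨ cong (_⊗ B) e ⟩
    (A ⊗ Y) ⊗ B ≡⟨ ⊗-assoc A Y B ⟩
    A ⊗ (Y ⊗ B) ≡⟨ cong (A ⊗_) f ⟩
    A ⊗ (B ⊗ Z) ≡⟨ ⊗-assoc A B Z ⟨
    (A ⊗ B) ⊗ Z ∎)

Norm-I : Norm I₄
Norm-I = Norm⁺ λ {X} X∈ → X , X∈ , trans (⊗-identityʳ X) (sym (⊗-identityˡ X))

record NElt : Set where
  field
    mat mat⁻¹ : Mat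
    inverses  : Inverses mat mat⁻¹
    norm      : Norm mat
    norm⁻¹    : Norm mat⁻¹

open NElt public

infixl 7 _⊙_

_⊙_ : NElt → NElt → NElt
x ⊙ y = record
  { mat = mat x ⊗ mat y
  ; mat⁻¹ = mat⁻¹ y ⊗ mat⁻¹ x
  ; inverses = Inverses-⊗ (inverses x) (inverses y)
  ; norm = Norm-⊗ (norm x) (norm y)
  ; norm⁻¹ = Norm-⊗ (norm⁻¹ y) (norm⁻¹ x)
  }

_⁻¹ : NElt → NElt
x ⁻¹ = record
  { mat = mat⁻¹ x ; mat⁻¹ = mat x ; inverses = Inverses-sym (inverses x)
  ; norm = norm⁻¹ x ; norm⁻¹ = norm x }

Nα Nβ Nf Nr Ni Nj N1 : NElt
N1 = record { mat = I₄ ; mat⁻¹ = I₄ ; inverses = refl , refl ; norm = Norm-I ; norm⁻¹ = Norm-I }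
Nα = record { mat = α ; mat⁻¹ = negM α ; inverses = refl , refl ; norm = norm-α ; norm⁻¹ = Norm-negM norm-α }
Nβ = record { mat = β ; mat⁻¹ = β ⊗ β ; inverses = refl , refl ; norm = norm-β ; norm⁻¹ = Norm-⊗ norm-β norm-β }
Nf = record { mat = f₀ ; mat⁻¹ = f₀ ; inverses = refl , refl ; norm = norm-f₀ ; norm⁻¹ = norm-f₀ }
Nr = record { mat = r₀ ; mat⁻¹ = negM r₀ ; inverses = refl , refl ; norm = norm-r₀ ; norm⁻¹ = Norm-negM norm-r₀ }
Ni = record { mat = i₀ ; mat⁻¹ = negM i₀ ; inverses = refl , refl ; norm = norm-i₀ ; norm⁻¹ = Norm-negM norm-i₀ }
Nj = record { mat = j₀ ; mat⁻¹ = negM j₀ ; inverses = refl , refl ; norm = norm-j₀ ; norm⁻¹ = Norm-negM norm-j₀ }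

β^ : F3 → NElt
β^ 𝟘 = N1
β^ 𝟙 = Nβ
β^ 𝟚 = Nβ ⁻¹

-- Every word begins with `α`, since a leading power of `β` would change neither the images of `v₁`
-- and `v₂` nor the conjugates of `β`.
word : List F3 → NElt
word [] = N1
word (c ∷ w) = (Nα ⊙ β^ c) ⊙ word w

-- v₁ · w and v₂ · w, for w in this list, exhaust the two 40-element orbits of ⟨α, β⟩ on non-zero vectors.
words : List (List F3)
words =
  [] ∷ (𝟘 ∷ []) ∷ (𝟙 ∷ []) ∷ (𝟚 ∷ []) ∷ (𝟘 ∷ 𝟘 ∷ []) ∷ (𝟙 ∷ 𝟘 ∷ []) ∷ (𝟙 ∷ 𝟙 ∷ []) ∷ (𝟙 ∷ 𝟚 ∷ []) ∷
  (𝟚 ∷ 𝟘 ∷ []) ∷ (𝟚 ∷ 𝟙 ∷ []) ∷ (𝟚 ∷ 𝟚 ∷ []) ∷ (𝟘 ∷ 𝟘 ∷ 𝟘 ∷ []) ∷ (𝟘 ∷ 𝟘 ∷ 𝟙 ∷ []) ∷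
  (𝟘 ∷ 𝟘 ∷ 𝟚 ∷ []) ∷ (𝟙 ∷ 𝟚 ∷ 𝟘 ∷ []) ∷ (𝟙 ∷ 𝟚 ∷ 𝟙 ∷ []) ∷ (𝟙 ∷ 𝟚 ∷ 𝟚 ∷ []) ∷ (𝟚 ∷ 𝟙 ∷ 𝟘 ∷ []) ∷
  (𝟚 ∷ 𝟙 ∷ 𝟙 ∷ []) ∷ (𝟚 ∷ 𝟙 ∷ 𝟚 ∷ []) ∷ (𝟚 ∷ 𝟚 ∷ 𝟘 ∷ []) ∷ (𝟚 ∷ 𝟚 ∷ 𝟙 ∷ []) ∷ (𝟚 ∷ 𝟚 ∷ 𝟚 ∷ []) ∷
  (𝟘 ∷ 𝟘 ∷ 𝟚 ∷ 𝟘 ∷ []) ∷ (𝟘 ∷ 𝟘 ∷ 𝟚 ∷ 𝟙 ∷ []) ∷ (𝟘 ∷ 𝟘 ∷ 𝟚 ∷ 𝟚 ∷ []) ∷ (𝟙 ∷ 𝟚 ∷ 𝟙 ∷ 𝟘 ∷ []) ∷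
  (𝟙 ∷ 𝟚 ∷ 𝟙 ∷ 𝟙 ∷ []) ∷ (𝟙 ∷ 𝟚 ∷ 𝟙 ∷ 𝟚 ∷ []) ∷ (𝟙 ∷ 𝟚 ∷ 𝟚 ∷ 𝟘 ∷ []) ∷ (𝟙 ∷ 𝟚 ∷ 𝟚 ∷ 𝟙 ∷ []) ∷
  (𝟙 ∷ 𝟚 ∷ 𝟚 ∷ 𝟚 ∷ []) ∷ (𝟚 ∷ 𝟙 ∷ 𝟚 ∷ 𝟘 ∷ []) ∷ (𝟚 ∷ 𝟙 ∷ 𝟚 ∷ 𝟙 ∷ []) ∷ (𝟚 ∷ 𝟙 ∷ 𝟚 ∷ 𝟚 ∷ []) ∷
  (𝟚 ∷ 𝟚 ∷ 𝟙 ∷ 𝟘 ∷ []) ∷ (𝟚 ∷ 𝟚 ∷ 𝟙 ∷ 𝟙 ∷ []) ∷ (𝟚 ∷ 𝟚 ∷ 𝟙 ∷ 𝟚 ∷ []) ∷ (𝟙 ∷ 𝟚 ∷ 𝟙 ∷ 𝟚 ∷ 𝟘 ∷ []) ∷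
  (𝟚 ∷ 𝟙 ∷ 𝟚 ∷ 𝟙 ∷ 𝟘 ∷ []) ∷ []

-- Conjugating β by these gives all elements of order 3 of ⟨α, β⟩.
wordsβ : List (List F3)
wordsβ =
  [] ∷ (𝟘 ∷ []) ∷ (𝟙 ∷ []) ∷ (𝟚 ∷ []) ∷ (𝟙 ∷ 𝟘 ∷ []) ∷ (𝟙 ∷ 𝟙 ∷ []) ∷ (𝟙 ∷ 𝟚 ∷ []) ∷ (𝟚 ∷ 𝟘 ∷ []) ∷
  (𝟚 ∷ 𝟙 ∷ []) ∷ (𝟚 ∷ 𝟚 ∷ []) ∷ (𝟙 ∷ 𝟚 ∷ 𝟘 ∷ []) ∷ (𝟙 ∷ 𝟚 ∷ 𝟙 ∷ []) ∷ (𝟙 ∷ 𝟚 ∷ 𝟚 ∷ []) ∷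
  (𝟚 ∷ 𝟙 ∷ 𝟘 ∷ []) ∷ (𝟚 ∷ 𝟙 ∷ 𝟙 ∷ []) ∷ (𝟚 ∷ 𝟙 ∷ 𝟚 ∷ []) ∷ (𝟙 ∷ 𝟚 ∷ 𝟙 ∷ 𝟘 ∷ []) ∷
  (𝟙 ∷ 𝟚 ∷ 𝟙 ∷ 𝟙 ∷ []) ∷ (𝟙 ∷ 𝟚 ∷ 𝟙 ∷ 𝟚 ∷ []) ∷ (𝟙 ∷ 𝟚 ∷ 𝟙 ∷ 𝟚 ∷ 𝟘 ∷ []) ∷ []

-- Representatives of R modulo the centraliser of `β` in R, which is the dihedral factor ⟨r₀, f₀⟩.
-- Each of the 20 elements of order 3 in ⟨α, β⟩ thus yields four, 80 in all.
quaternions : List NElt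
quaternions = N1 ∷ Ni ∷ Nj ∷ Ni ⊙ Nj ∷ []

infixl 30 _^_

_^_ : Mat → NElt → Mat
z ^ x = mat⁻¹ x ⊗ (z ⊗ mat x)

conjβ : List Mat
conjβ = cartesianProductWith _^_ (map (β ^_) quaternions) (map word wordsβ)

opaque
  Conjβ : Mat → Set
  Conjβ z = z ∈ conjβ

  Conjβ⁻ : ∀ {z} → Conjβ z → ∃ λ q → ∃ λ x → z ≡ (β ^ q) ^ x
  Conjβ⁻ {z} z∈ =
    let (y , x , y∈ , _ , e) = ∈-cartesianProductWith⁻ _^_ (map (β ^_) quaternions) (map word wordsβ) z∈
        (q , _ , e′) = ∈-map⁻ (β ^_) {y} {quaternions} y∈
    in q , x , trans e (cong (_^ x) e′)

  Conjβ-All : ∀ {P : Mat → Set} → All P conjβ → ∀ {z} → Conjβ z → P z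
  Conjβ-All = All.lookup

Order3 : Mat → Set
Order3 z = z ⊗ (z ⊗ z) ≡ I₄ × z ≢ I₄

order3? : ∀ z → Dec (Order3 z)
order3? z = ((z ⊗ (z ⊗ z)) ≟M I₄) ×-dec ¬? (z ≟M I₄)

-- An element of the normaliser fixing v₁ is determined by its action on i₀ and r₀.
candidate : Mat → Mat → Mat
candidate Y X = S₀⁻¹ ⊗ ⟨ v₁ , v₁ · Y , v₁ · X , v₁ · X · Y ⟩

generators : List Mat
generators = f₀ ∷ r₀ ∷ i₀ ∷ j₀ ∷ []

generators⊆R₀ : All (_∈ R₀) generators
generators⊆R₀ = toWitness {a? = All.all? (λ X → Any.any? (X ≟M_) R₀) generators} tt

Listed : List Mat → List Mat → Mat → Set
Listed R C z = Order3 z → All (λ X → Any (λ Y → X ⊗ z ≡ z ⊗ Y) R) generators → z ∈ C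

candidates? : ∀ R C → Dec (All (λ Y → All (λ X → Listed R C (candidate Y X)) R) R)
candidates? R C = All.all? (λ Y → All.all? (λ X → listed? (candidate Y X)) R) R
  where
  listed? : ∀ z → Dec (Listed R C z)
  listed? z = order3? z →-dec (normalises? R generators z →-dec Any.any? (z ≟M_) C)

candidates : All (λ Y → All (λ X → Listed R₀ conjβ (candidate Y X)) R₀) R₀
candidates = toWitness {a? = candidates? R₀ conjβ} tt

opaque
  unfolding InR₀ Norm Conjβ

  candidate-Conjβ : ∀ {X Y} → InR₀ Y → InR₀ X → Norm (candidate Y X) → Order3 (candidate Y X) →
    Conjβ (candidate Y X)
  candidate-Conjβ Y∈ X∈ N o = All.lookup (All.lookup candidates Y∈) X∈ o
    (All.map (λ X∈ → All.lookup N X∈) generators⊆R₀)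

ConjClosed : List Mat → NElt → Set
ConjClosed C x = All (λ z → (z ^ x) ∈ C) C

conjClosed? : ∀ C x → Dec (ConjClosed C x)
conjClosed? C x = All.all? (λ z → member? (z ^ x)) C
  where
  member? : ∀ z → Dec (z ∈ C)
  member? z = Any.any? (z ≟M_) C

conjβ-α : ConjClosed conjβ Nα
conjβ-α = toWitness {a? = conjClosed? conjβ Nα} tt

conjβ-β : ConjClosed conjβ Nβ
conjβ-β = toWitness {a? = conjClosed? conjβ Nβ} tt

conjβ-r₀ : ConjClosed conjβ Nr
conjβ-r₀ = toWitness {a? = conjClosed? conjβ Nr} tt

opaque
  unfolding Conjβ

  Conjβ-^α : ∀ {z} → Conjβ z → Conjβ (z ^ Nα)
  Conjβ-^α = All.lookup conjβ-α

  Conjβ-^β : ∀ {z} → Conjβ z → Conjβ (z ^ Nβ)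
  Conjβ-^β = All.lookup conjβ-β

  Conjβ-^r₀ : ∀ {z} → Conjβ z → Conjβ (z ^ Nr)
  Conjβ-^r₀ = All.lookup conjβ-r₀

-- f₀, f₀ r₀, r₀ i₀, r₀ j₀ and r₀ k₀
fs : Fin 5 → Mat
fs zero = f₀
fs (suc zero) = ⟨ ⟨ 𝟘 , 𝟘 , 𝟙 , 𝟘 ⟩ , ⟨ 𝟘 , 𝟘 , 𝟘 , 𝟙 ⟩ , ⟨ 𝟙 , 𝟘 , 𝟘 , 𝟘 ⟩ , ⟨ 𝟘 , 𝟙 , 𝟘 , 𝟘 ⟩ ⟩
fs (suc (suc zero)) = ⟨ ⟨ 𝟙 , 𝟘 , 𝟘 , 𝟘 ⟩ , ⟨ 𝟘 , 𝟙 , 𝟙 , 𝟘 ⟩ , ⟨ 𝟘 , 𝟘 , 𝟚 , 𝟘 ⟩ , ⟨ 𝟚 , 𝟘 , 𝟘 , 𝟚 ⟩ ⟩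
fs (suc (suc (suc zero))) = ⟨ ⟨ 𝟙 , 𝟘 , 𝟚 , 𝟚 ⟩ , ⟨ 𝟘 , 𝟙 , 𝟙 , 𝟙 ⟩ , ⟨ 𝟙 , 𝟙 , 𝟚 , 𝟘 ⟩ , ⟨ 𝟚 , 𝟚 , 𝟘 , 𝟚 ⟩ ⟩
fs (suc (suc (suc (suc zero)))) = ⟨ ⟨ 𝟚 , 𝟘 , 𝟚 , 𝟙 ⟩ , ⟨ 𝟘 , 𝟚 , 𝟚 , 𝟙 ⟩ , ⟨ 𝟙 , 𝟚 , 𝟙 , 𝟘 ⟩ , ⟨ 𝟙 , 𝟚 , 𝟘 , 𝟙 ⟩ ⟩

-- An element of odd order that keeps the pair ±f cannot exchange f and -f. So for z of order 3,
-- commuting with `fs k` means fixing the k-th of the five pairs.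
record Comm (k : Fin 5) (z : Mat) : Set where
  constructor comm
  field commute : fs k ⊗ z ≡ z ⊗ fs k

comm? : ∀ k z → Dec (Comm k z)
comm? k z = map′ comm Comm.commute ((fs k ⊗ z) ≟M (z ⊗ fs k))

-- Together with `β` it generates H₀; on the five pairs the two are 3-cycles with a single common
-- point.
γ : Mat
γ = β ^ (Nα ⁻¹)

γ⁻¹ : Mat
γ⁻¹ = γ ⊗ γ

AtMostTwo : Mat → Set
AtMostTwo z = ∀ k l → k ≢ l → Comm k z → Comm l z → ∀ m → Comm m z → m ≡ k ⊎ m ≡ l

Avoids : Fin 5 → Fin 5 → Mat → Set
Avoids l m x = ¬ Comm l x × ¬ Comm m x

-- An element of order 3 commutes with two of the f k and permutes the other three cyclically.
-- In the last alternative, z ⊗ z is the inverse of z.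
Avoidable : Mat → Set
Avoidable z = ∀ k → Comm k β → Comm k z → (∃ λ l → Comm l z × ¬ Comm l β) →
  ∀ l m → l ≢ m → l ≢ k → m ≢ k → Avoids l m β ⊎ Avoids l m z ⊎ Avoids l m ((z ⊗ z) ⊗ (β ⊗ z))

-- All of these centralise `β`. The powers of `β` move the point that the 3-cycle of z shares with
-- that of `β`, and the products of `f₀` and `r₀` run through the four elements of order 3 that
-- induce a given 3-cycle. Only the choice between `γ` and its inverse remains.
centralisers : List NElt
centralisers = cartesianProductWith _⊙_ (N1 ∷ Nβ ∷ Nβ ⁻¹ ∷ []) (N1 ∷ Nf ∷ Nr ∷ Nf ⊙ Nr ∷ [])

ConjToγ : Mat → Set
ConjToγ z = (∀ k → ¬ (Comm k β × Comm k z)) → Any (λ c → z ^ c ≡ γ ⊎ z ^ c ≡ γ⁻¹) centralisers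

PairFacts : Mat → Set
PairFacts z = AtMostTwo z × Avoidable z × ConjToγ z

-- Passing the five decisions as arguments makes evaluation compute each of them only once.
tabulated : ∀ {P : Fin 5 → Set} {Q : Set} → (∀ k → Dec (P k)) → ((∀ k → Dec (P k)) → Q) → Q
tabulated {P} {Q} d K = share (d zero) (d (suc zero)) (d (suc (suc zero)))
  (d (suc (suc (suc zero)))) (d (suc (suc (suc (suc zero)))))
  where
  share : Dec (P zero) → Dec (P (suc zero)) → Dec (P (suc (suc zero))) →
    Dec (P (suc (suc (suc zero)))) → Dec (P (suc (suc (suc (suc zero))))) → Q
  share a b c d e = K λ where
    zero → a
    (suc zero) → b
    (suc (suc zero)) → c
    (suc (suc (suc zero))) → d
    (suc (suc (suc (suc zero)))) → e

pairFacts? : ∀ C → Dec (All PairFacts C)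
pairFacts? C = tabulated (λ k → comm? k β) λ commβ? → All.all? (λ z →
    tabulated (λ k → comm? k z) λ commz? →
    tabulated (λ k → comm? k ((z ⊗ z) ⊗ (β ⊗ z))) λ commy? →
    atMostTwo? commz? ×-dec avoidable? commβ? commz? commy? ×-dec
    (Fin.all? (λ k → ¬? (commβ? k ×-dec commz? k)) →-dec conjTo? γ γ⁻¹ z)) C
  where
  conjTo? : ∀ g g′ z → Dec (Any (λ c → z ^ c ≡ g ⊎ z ^ c ≡ g′) centralisers)
  conjTo? g g′ z = Any.any? (λ c → one-of? (z ^ c)) centralisers
    where
    one-of? : ∀ x → Dec (x ≡ g ⊎ x ≡ g′)
    one-of? x = (x ≟M g) ⊎-dec (x ≟M g′)

  atMostTwo? : ∀ {z} → (∀ k → Dec (Comm k z)) → Dec (AtMostTwo z)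
  atMostTwo? c? = Fin.all? λ k → Fin.all? λ l → ¬? (k Fin.≟ l) →-dec (c? k →-dec (c? l →-dec
    Fin.all? λ m → c? m →-dec ((m Fin.≟ k) ⊎-dec (m Fin.≟ l))))

  avoids? : ∀ {x} → (∀ k → Dec (Comm k x)) → ∀ l m → Dec (Avoids l m x)
  avoids? c? l m = ¬? (c? l) ×-dec ¬? (c? m)

  avoidable? : ∀ {z} → (∀ k → Dec (Comm k β)) → (∀ k → Dec (Comm k z)) →
    (∀ k → Dec (Comm k ((z ⊗ z) ⊗ (β ⊗ z)))) → Dec (Avoidable z)
  avoidable? b? z? y? = Fin.all? λ k → b? k →-dec (z? k →-dec
    (Fin.any? (λ l → z? l ×-dec ¬? (b? l)) →-dec
    (Fin.all? λ l → Fin.all? λ m → ¬? (l Fin.≟ m) →-dec (¬? (l Fin.≟ k) →-dec (¬? (m Fin.≟ k) →-dec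
      (avoids? b? l m ⊎-dec (avoids? z? l m ⊎-dec avoids? y? l m)))))))

pairFacts : All PairFacts conjβ
pairFacts = toWitness {a? = pairFacts? conjβ} tt

Conjβ-pairFacts : ∀ {z} → Conjβ z → PairFacts z
Conjβ-pairFacts = Conjβ-All pairFacts

-- Counting flags

Preserves : Design 9 3 → Mat → Set
Preserves D A = ∀ i → ∃ λ j → ∀ x → inc D j (x · A) ≡ inc D i x

-- Membership in Ĝ. Asking the same of the inverse makes closure under inverses immediate.
IsAut : Design 9 3 → Mat → Set
IsAut D A = ∃ λ A' → Inverses A A' × (Norm A × Norm A') × (Preserves D A × Preserves D A')

-- What flag-transitivity contributes from here on, in a form that is stable under conjugation by
-- elements of N(R).
record Setup (D : Design 9 3) : Set where
  field
    translate  : ∀ c i → ∃ λ j → ∀ x → inc D j (x ⊕ c) ≡ inc D i x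
    transitive : ∀ i j → inc D i 𝟎 ≡ true → inc D j 𝟎 ≡ true →
                 ∃ λ A → IsAut D A × (∀ x → inc D j (x · A) ≡ inc D i x)

module FV = Finite V-finite
module FM = Finite Mat-finite

∑V : (V → ℕ) → ℕ
∑V = ∑ allV

∑M : (Mat → ℕ) → ℕ
∑M = ∑ FM.elems

∑V-linear : ∀ {A A'} → Inverses A A' → ∀ h → ∑V (λ x → h (x · A)) ≡ ∑V h
∑V-linear {A} {A'} (p , q) = FV.∑-bij (_· A) (_· A') (cancelʳ q) (cancelʳ p)

∑V-translate : ∀ c h → ∑V (λ x → h (x ⊕ c)) ≡ ∑V h
∑V-translate c = FV.∑-bij (_⊕ c) (_⊕ neg c) (λ x → neg-⊕-cancel x c) (λ x → ⊕-neg-cancel x c)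

length-allV : length allV ≡ 81
length-allV = subst (λ vs → length vs ≡ 81) (sym allV≡vectors) refl

module Counting (D : Design 9 3) (S : Setup D) where
  open Setup S

  n : ℕ
  n = nblocks D

  incD : Fin n → V → Bool
  incD = inc D

  ∑B : (Fin n → ℕ) → ℕ
  ∑B = ∑ (allFin n)

  module FB = Finite (Fin-finite n)

  block-ext : ∀ {i j} → (∀ x → incD i x ≡ incD j x) → i ≡ j
  block-ext = simple D _ _

  block-size : ∀ i → ∑V (λ x → ⟦ incD i x ⟧) ≡ 9
  block-size i = trans (sym (count≡∑ (incD i) allV)) (size D i)

  pair-count : ∀ {x y} → x ≢ y → ∑B (λ i → ⟦ incD i x ∧ incD i y ⟧) ≡ 3
  pair-count {x} {y} x≢y = trans (sym (count≡∑ _ (allFin n))) (balance D x y x≢y)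

  degree : V → ℕ
  degree p = ∑B λ i → ⟦ incD i p ⟧

  -- Both sides count the pairs of a block through p and a point of W on it. As W avoids p, each
  -- point of W shares exactly λ = 3 blocks with p.
  flag-count : ∀ p (W : V → Bool) c → W p ≡ false →
    (∀ i → incD i p ≡ true → ∑V (λ x → ⟦ incD i x ∧ W x ⟧) ≡ c) →
    degree p * c ≡ ∑V (λ x → ⟦ W x ⟧) * 3
  flag-count p W c Wp h = begin
    degree p * c
      ≡⟨ ∑-*ʳ c (allFin n) _ ⟨
    ∑B (λ i → ⟦ incD i p ⟧ * c)
      ≡⟨ ∑-cong (allFin n) step₁ ⟩
    ∑B (λ i → ∑V λ x → ⟦ incD i p ∧ incD i x ⟧ * ⟦ W x ⟧)
      ≡⟨ ∑-swap (allFin n) allV _ ⟩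
    ∑V (λ x → ∑B λ i → ⟦ incD i p ∧ incD i x ⟧ * ⟦ W x ⟧)
      ≡⟨ ∑-cong allV (λ x → ∑-*ʳ ⟦ W x ⟧ (allFin n) _) ⟩
    ∑V (λ x → ∑B (λ i → ⟦ incD i p ∧ incD i x ⟧) * ⟦ W x ⟧)
      ≡⟨ ∑-cong allV step₂ ⟩
    ∑V (λ x → ⟦ W x ⟧ * 3)
      ≡⟨ ∑-*ʳ 3 allV _ ⟩
    ∑V (λ x → ⟦ W x ⟧) * 3 ∎
    where
    step₁ : ∀ i → ⟦ incD i p ⟧ * c ≡ ∑V λ x → ⟦ incD i p ∧ incD i x ⟧ * ⟦ W x ⟧
    step₁ i with incD i p in e
    ... | true  = trans (ℕ.*-identityˡ c) (trans (sym (h i e)) (∑-cong allV λ x → ⟦∧⟧ (incD i x) (W x)))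
    ... | false = sym (∑-0 allV)
    step₂ : ∀ x → ∑B (λ i → ⟦ incD i p ∧ incD i x ⟧) * ⟦ W x ⟧ ≡ ⟦ W x ⟧ * 3
    step₂ x with W x in e
    ... | true  = cong (_* 1) (pair-count λ { refl → case trans (sym e) Wp of λ () })
    ... | false = ℕ.*-zeroʳ (∑B (λ i → ⟦ incD i p ∧ incD i x ⟧))

  ≢-split : ∀ p x → 1 ≡ ⟦ not (does (x ≟V p)) ⟧ + ⟦ does (x ≟V p) ⟧
  ≢-split p x with does (x ≟V p)
  ... | true = refl
  ... | false = refl

  others : ∀ p → ∑V (λ x → ⟦ not (does (x ≟V p)) ⟧) ≡ 80
  others p = ℕ.+-cancelʳ-≡ 1 _ 80 (begin
    ∑V (λ x → ⟦ not (does (x ≟V p)) ⟧) + 1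
      ≡⟨ cong (∑V (λ x → ⟦ not (does (x ≟V p)) ⟧) +_) (FV.once p) ⟨
    ∑V (λ x → ⟦ not (does (x ≟V p)) ⟧) + ∑V (λ x → ⟦ does (x ≟V p) ⟧)
      ≡⟨ ∑-+ allV _ _ ⟨
    ∑V (λ x → ⟦ not (does (x ≟V p)) ⟧ + ⟦ does (x ≟V p) ⟧)
      ≡⟨ ∑-cong allV (≢-split p) ⟨
    ∑V (λ _ → 1)
      ≡⟨ trans (∑-const 1 allV) (trans (ℕ.*-identityʳ (length allV)) length-allV) ⟩
    81 ∎)

  block-others : ∀ p i → incD i p ≡ true → ∑V (λ x → ⟦ incD i x ∧ not (does (x ≟V p)) ⟧) ≡ 8
  block-others p i e = ℕ.+-cancelʳ-≡ 1 _ 8 (begin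
    ∑V (λ x → ⟦ incD i x ∧ not (does (x ≟V p)) ⟧) + 1
      ≡⟨ cong (∑V (λ x → ⟦ incD i x ∧ not (does (x ≟V p)) ⟧) +_) (FV.once p) ⟨
    ∑V (λ x → ⟦ incD i x ∧ not (does (x ≟V p)) ⟧) + ∑V (λ x → ⟦ does (x ≟V p) ⟧)
      ≡⟨ ∑-+ allV _ _ ⟨
    ∑V (λ x → ⟦ incD i x ∧ not (does (x ≟V p)) ⟧ + ⟦ does (x ≟V p) ⟧)
      ≡⟨ ∑-cong allV step ⟩
    ∑V (λ x → ⟦ incD i x ⟧)
      ≡⟨ block-size i ⟩
    9 ∎)
    where
    step : ∀ x → ⟦ incD i x ∧ not (does (x ≟V p)) ⟧ + ⟦ does (x ≟V p) ⟧ ≡ ⟦ incD i x ⟧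
    step x with x ≟V p
    ... | yes refl rewrite e = refl
    ... | no _ = trans (ℕ.+-identityʳ _) (cong ⟦_⟧ (Bool.∧-identityʳ (incD i x)))

  degree≡30 : ∀ p → degree p ≡ 30
  degree≡30 p = ℕ.*-cancelʳ-≡ (degree p) 30 8 (begin
    degree p * 8
      ≡⟨ flag-count p (λ x → not (does (x ≟V p))) 8 (cong not (dec-true (p ≟V p) refl)) (block-others p) ⟩
    ∑V (λ x → ⟦ not (does (x ≟V p)) ⟧) * 3
      ≡⟨ cong (_* 3) {y = 80} (others p) ⟩
    80 * 3 ∎)

  ∑B-const : ∀ c → ∑B (λ _ → c) ≡ n * c
  ∑B-const c = trans (∑-const c (allFin n)) (cong (_* c) (length-tabulate {n = n} (λ i → i)))

  nblocks≡270 : n ≡ 270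
  nblocks≡270 = ℕ.*-cancelʳ-≡ n 270 9 (begin
    n * 9 ≡⟨ ∑B-const 9 ⟨
    ∑B (λ _ → 9) ≡⟨ ∑-cong (allFin n) block-size ⟨
    ∑B (λ i → ∑V λ x → ⟦ incD i x ⟧) ≡⟨ ∑-swap (allFin n) allV _ ⟩
    ∑V degree ≡⟨ ∑-cong allV degree≡30 ⟩
    ∑V (λ _ → 30) ≡⟨ ∑-const 30 allV ⟩
    length allV * 30 ≡⟨ cong (_* 30) {y = 81} length-allV ⟩
    81 * 30 ∎)

  base-block : ∀ p → ∃ λ i → incD i p ≡ true
  base-block p with ∑-positive (allFin n) _ (λ e → case trans (sym e) (degree≡30 p) of λ ())
  ... | i , h with incD i p in e
  ... | true  = i , e
  ... | false = contradiction refl h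

  IsAut-inverse : ∀ {A} ((A' , _) : IsAut D A) → IsAut D A'
  IsAut-inverse (A' , i , (p , q) , (r , s)) = _ , Inverses-sym i , (q , p) , (s , r)

  -- If W meets every block through 0 in c points, flag counting gives 30 c = 3 ∣W∣.
  moved : ∀ (W : V → Bool) → W 𝟎 ≡ false → ¬ (10 ∣ ∑V (λ x → ⟦ W x ⟧)) →
    ∃ λ A → IsAut D A × ∃ λ x → W x ≡ true × W (x · A) ≡ false
  moved W W0 10∤ with base-block 𝟎
  ... | i₀ , i₀∋0 = from-block (FB.any? λ i → (incD i 𝟎 Bool.≟ true) ×-dec ¬? (meet i ℕ.≟ meet i₀))
    where
    meet : Fin n → ℕ
    meet i = ∑V λ x → ⟦ incD i x ∧ W x ⟧
    -- The matrix may bring a point into W instead of taking one out; then its inverse does the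
    -- latter.
    split : ∀ A → IsAut D A → (∃ λ x → W (x · A) ≢ W x) →
      ∃ λ A → IsAut D A × ∃ λ x → W x ≡ true × W (x · A) ≡ false
    split A a@(A' , (_ , A'A) , _) (x , h) with W x in e | W (x · A) in e'
    ... | true  | true  = contradiction refl h
    ... | false | false = contradiction refl h
    ... | true  | false = A , a , x , e , e'
    ... | false | true  = A' , IsAut-inverse a , x · A , e' ,
      trans (cong W (cancelʳ (proj₁ (proj₁ (proj₂ a))) x)) e
    from-block : Dec _ → ∃ λ A → IsAut D A × ∃ λ x → W x ≡ true × W (x · A) ≡ false
    from-block (no none) = contradiction (divides (meet i₀) (ℕ.*-cancelʳ-≡ _ _ 3 (begin
      ∑V (λ x → ⟦ W x ⟧) * 3
        ≡⟨ flag-count 𝟎 W (meet i₀) W0 const ⟨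
      degree 𝟎 * meet i₀
        ≡⟨ cong (_* meet i₀) (degree≡30 𝟎) ⟩
      30 * meet i₀
        ≡⟨ ℕ.*-comm 30 (meet i₀) ⟩
      meet i₀ * 30
        ≡⟨ ℕ.*-assoc (meet i₀) 10 3 ⟨
      meet i₀ * 10 * 3 ∎))) 10∤
      where
      const : ∀ i → incD i 𝟎 ≡ true → meet i ≡ meet i₀
      const i i∋0 with meet i ℕ.≟ meet i₀
      ... | yes e = e
      ... | no ¬e = contradiction (i , i∋0 , ¬e) none
    from-block (yes (i , i∋0 , ¬e)) with transitive i₀ i i₀∋0 i∋0
    ... | A , a , h with FV.any? (λ x → ¬? (W (x · A) Bool.≟ W x))
    ... | yes w = split A a w
    ... | no none = contradiction (begin
      meet i
        ≡⟨ ∑V-linear (proj₁ (proj₂ a)) (λ x → ⟦ incD i x ∧ W x ⟧) ⟨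
      ∑V (λ x → ⟦ incD i (x · A) ∧ W (x · A) ⟧)
        ≡⟨ ∑-cong allV (λ x → cong ⟦_⟧ (cong₂ _∧_ (h x) (same x))) ⟩
      meet i₀ ∎) ¬e
      where
      same : ∀ x → W (x · A) ≡ W x
      same x with W (x · A) Bool.≟ W x
      ... | yes e = e
      ... | no ¬e = contradiction (x , ¬e) none

-- The order of Ĝ and Cauchy's theorem for the prime 3

module RM = Rotation Mat-finite

module _ (D : Design 9 3) (S : Setup D) where
  open Setup S
  open Counting D S

  Sends : Mat → Fin n → Fin n → Set
  Sends A i j = ∀ x → incD j (x · A) ≡ incD i x

  opaque
    sends? : ∀ A i j → Dec (Sends A i j)
    sends? A i j = FV.all? λ x → incD j (x · A) Bool.≟ incD i x

  IsAut-⊗ : ∀ {A B} → IsAut D A → IsAut D B → IsAut D (A ⊗ B)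
  IsAut-⊗ {A} {B} (A' , i , (p , q) , r , s) (B' , i' , (p' , q') , r' , s') =
    B' ⊗ A' , Inverses-⊗ i i' , (Norm-⊗ p p' , Norm-⊗ q' q) , preserves r r' , preserves s' s
    where
    preserves : ∀ {A B} → Preserves D A → Preserves D B → Preserves D (A ⊗ B)
    preserves {A} {B} f g k with f k
    ... | l , h with g l
    ... | m , h' = m , λ x → trans (cong (incD m) (·-⊗ x A B)) (trans (h' (x · A)) (h x))

  IsAut-I : IsAut D I₄
  IsAut-I = I₄ , (⊗-identityˡ I₄ , ⊗-identityˡ I₄) , (Norm-I , Norm-I) , (pres , pres)
    where
    pres : Preserves D I₄
    pres i = i , λ x → cong (incD i) (·-I x)

  preserves? : ∀ A → Dec (Preserves D A)
  preserves? A = FB.all? λ i → FB.any? λ j → sends? A i j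

  opaque
    isAut? : ∀ A → Dec (IsAut D A)
    isAut? A = FM.any? λ A' →
      (((A ⊗ A') ≟M I₄) ×-dec ((A' ⊗ A) ≟M I₄)) ×-dec (norm? A ×-dec norm? A') ×-dec
      (preserves? A ×-dec preserves? A')

  opaque
    isAut : Mat → Bool
    isAut A = does (isAut? A)

    isAut-true : ∀ {A} → IsAut D A → isAut A ≡ true
    isAut-true {A} = dec-true (isAut? A)

    isAut-sound : ∀ {A} → isAut A ≡ true → IsAut D A
    isAut-sound {A} = does⁻ (isAut? A)

  isAut-cong : ∀ {A B} → (IsAut D A → IsAut D B) → (IsAut D B → IsAut D A) → isAut A ≡ isAut B
  isAut-cong {A} {B} f g with isAut A in a | isAut B in b
  ... | true  | true  = refl
  ... | false | false = refl
  ... | true  | false = trans (sym (isAut-true (f (isAut-sound a)))) b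
  ... | false | true  = trans (sym a) (isAut-true (g (isAut-sound b)))

  IsAut-cancel : ∀ {A B} → IsAut D B → IsAut D (A ⊗ B) → IsAut D A
  IsAut-cancel {A} b ab = subst (IsAut D) (⊗-cancelʳ (proj₁ (proj₁ (proj₂ b))) A)
    (IsAut-⊗ ab (IsAut-inverse b))

  order : ℕ
  order = ∑M λ A → ⟦ isAut A ⟧

  -- Orbit and stabiliser: s is the order of the stabiliser of one block through 0, and the elements
  -- carrying that block to another form a coset, whose size is compared by right multiplication.
  order-multiple : ∃ λ s → order ≡ 30 * s
  order-multiple with base-block 𝟎
  ... | i₀ , i₀∋0 = s , (begin
      ∑M (λ A → ⟦ isAut A ⟧)
        ≡⟨ ∑-cong FM.elems (λ A → trans (sym (ℕ.*-identityʳ ⟦ isAut A ⟧)) (image A)) ⟩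
      ∑M (λ A → ∑B λ i → ⟦ isAut A ⟧ * ⟦ does (sends? A i₀ i) ⟧)
        ≡⟨ ∑-swap FM.elems (allFin n) _ ⟩
      ∑B (λ i → ∑M λ A → ⟦ isAut A ⟧ * ⟦ does (sends? A i₀ i) ⟧)
        ≡⟨ ∑-cong (allFin n) coset ⟩
      ∑B (λ i → ⟦ incD i 𝟎 ⟧ * s)
        ≡⟨ ∑-*ʳ s (allFin n) _ ⟩
      degree 𝟎 * s
        ≡⟨ cong (_* s) (degree≡30 𝟎) ⟩
      30 * s ∎)
    where
    s : ℕ
    s = ∑M λ A → ⟦ isAut A ⟧ * ⟦ does (sends? A i₀ i₀) ⟧
    image : ∀ A → ⟦ isAut A ⟧ * 1 ≡ ∑B λ i → ⟦ isAut A ⟧ * ⟦ does (sends? A i₀ i) ⟧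
    image A with isAut A in e
    ... | false = sym (∑-0 (allFin n))
    ... | true with isAut-sound e
    ... | A' , (AA' , A'A) , _ , (pres , _) with pres i₀
    ... | j , h = sym (trans (∑-cong (allFin n) λ i → trans (ℕ.*-identityˡ _) (cong ⟦_⟧
        (does-cong (sends? A i₀ i) (FB._≟_ i j) (λ h' → block-ext λ x → to h' x) λ { refl → h })))
        (FB.once j))
      where
      to : ∀ {i} → Sends A i₀ i → ∀ x → incD i x ≡ incD j x
      to {i} h' x = subst (λ y → incD i y ≡ incD j y) (cancelʳ A'A x)
        (trans (h' (x · A')) (sym (h (x · A'))))
    coset : ∀ i → ∑M (λ A → ⟦ isAut A ⟧ * ⟦ does (sends? A i₀ i) ⟧) ≡ ⟦ incD i 𝟎 ⟧ * s
    coset i with incD i 𝟎 in i∌0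
    ... | false = trans (∑-cong FM.elems none) (∑-0 FM.elems)
      where
      none : ∀ A → ⟦ isAut A ⟧ * ⟦ does (sends? A i₀ i) ⟧ ≡ 0
      none A = trans (cong (λ t → ⟦ isAut A ⟧ * ⟦ t ⟧) (dec-false (sends? A i₀ i) λ h →
        case trans (sym i∌0) (trans (trans (cong (incD i) (sym (vecMat-𝟎 A))) (h 𝟎)) i₀∋0) of λ ()))
        (ℕ.*-zeroʳ ⟦ isAut A ⟧)
    ... | true with transitive i₀ i i₀∋0 i∌0
    ... | B , b@(B' , (BB' , B'B) , _) , h = trans
      (sym (FM.∑-bij (_⊗ B) (_⊗ B') (⊗-cancelʳ B'B) (⊗-cancelʳ BB') _))
      (trans (∑-cong FM.elems λ A → cong₂ (λ p q → ⟦ p ⟧ * ⟦ q ⟧)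
          (isAut-cong (IsAut-cancel b) (λ a → IsAut-⊗ a b))
          (does-cong (sends? (A ⊗ B) i₀ i) (sends? A i₀ i₀)
            (λ g x → trans (sym (h (x · A))) (trans (cong (incD i) (sym (·-⊗ x A B))) (g x)))
            (λ g x → trans (cong (incD i) (·-⊗ x A B)) (trans (h (x · A)) (g x)))))
        (sym (ℕ.*-identityˡ s)))

  -- McKay's proof of Cauchy's theorem: rotate the triples with product 1.
  triple : Mat → Mat → Mat → ℕ
  triple A B C = ⟦ isAut A ⟧ * (⟦ isAut B ⟧ * (⟦ isAut C ⟧ * ⟦ does (FM._≟_ (A ⊗ (B ⊗ C)) I₄) ⟧))

  triple-rotate : ∀ A B C → triple A B C ≡ triple B C A
  triple-rotate A B C with isAut A in a | isAut B in b
  ... | false | false = refl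
  ... | false | true  = sym (trans (ℕ.*-identityˡ _) (ℕ.*-zeroʳ ⟦ isAut C ⟧))
  ... | true  | false = refl
  ... | true  | true  = begin
    1 * (1 * (c * x)) ≡⟨ trans (ℕ.*-identityˡ _) (ℕ.*-identityˡ _) ⟩
    c * x ≡⟨ cong (λ t → c * ⟦ t ⟧) (does-cong (FM._≟_ _ I₄) (FM._≟_ _ I₄) (λ e → trans (sym (⊗-assoc B C A)) (to e)) (λ e → from (trans (⊗-assoc B C A) e))) ⟩
    c * y ≡⟨ cong (c *_) (ℕ.*-identityˡ y) ⟨
    c * (1 * y) ≡⟨ ℕ.*-identityˡ _ ⟨
    1 * (c * (1 * y)) ∎
    where
    c = ⟦ isAut C ⟧
    x = ⟦ does (FM._≟_ (A ⊗ (B ⊗ C)) I₄) ⟧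
    y = ⟦ does (FM._≟_ (B ⊗ (C ⊗ A)) I₄) ⟧
    A-A⁻¹ : Inverses A (proj₁ (isAut-sound a))
    A-A⁻¹ = proj₁ (proj₂ (isAut-sound a))
    to : A ⊗ (B ⊗ C) ≡ I₄ → (B ⊗ C) ⊗ A ≡ I₄
    to e = trans (cong (_⊗ A) (trans (sym (⊗-cancelˡ (proj₂ A-A⁻¹) (B ⊗ C)))
      (trans (cong (proj₁ (isAut-sound a) ⊗_) e) (⊗-identityʳ _)))) (proj₂ A-A⁻¹)
    from : (B ⊗ C) ⊗ A ≡ I₄ → A ⊗ (B ⊗ C) ≡ I₄
    from e = trans (cong (A ⊗_) (trans (sym (⊗-cancelʳ (proj₁ A-A⁻¹) (B ⊗ C)))
      (trans (cong (_⊗ proj₁ (isAut-sound a)) e) (⊗-identityˡ _)))) (proj₁ A-A⁻¹)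

  completions : ∀ A B → IsAut D (A ⊗ B) →
    ∑M (λ C → ⟦ isAut C ⟧ * ⟦ does (FM._≟_ (A ⊗ (B ⊗ C)) I₄) ⟧) ≡ 1
  completions A B ab@(C₀ , (e , f) , _) = trans (∑-cong FM.elems λ C → step C (FM._≟_ C C₀)) (FM.once C₀)
    where
    step : ∀ C (d : Dec (C ≡ C₀)) → ⟦ isAut C ⟧ * ⟦ does (FM._≟_ (A ⊗ (B ⊗ C)) I₄) ⟧ ≡ ⟦ does d ⟧
    step C (yes refl) = cong₂ (λ p q → ⟦ p ⟧ * ⟦ q ⟧) (isAut-true (IsAut-inverse ab))
      (dec-true (FM._≟_ (A ⊗ (B ⊗ C)) I₄) (trans (sym (⊗-assoc A B C)) e))
    step C (no C≢) = trans (cong (λ q → ⟦ isAut C ⟧ * ⟦ q ⟧) (dec-false (FM._≟_ (A ⊗ (B ⊗ C)) I₄) λ g → C≢ (begin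
        C ≡⟨ ⊗-cancelˡ f C ⟨
        C₀ ⊗ ((A ⊗ B) ⊗ C) ≡⟨ cong (C₀ ⊗_) (trans (⊗-assoc A B C) g) ⟩
        C₀ ⊗ I₄ ≡⟨ ⊗-identityʳ C₀ ⟩
        C₀ ∎)))
      (ℕ.*-zeroʳ ⟦ isAut C ⟧)

  triples-total : RM.∑³ triple ≡ order * order
  triples-total = begin
    ∑M (λ A → ∑M λ B → ∑M λ C → triple A B C)
      ≡⟨ ∑-cong FM.elems (λ A → ∑-cong FM.elems λ B → third A B) ⟩
    ∑M (λ A → ∑M λ B → ⟦ isAut A ⟧ * ⟦ isAut B ⟧)
      ≡⟨ ∑-cong FM.elems (λ A → ∑-*ˡ ⟦ isAut A ⟧ FM.elems _) ⟩
    ∑M (λ A → ⟦ isAut A ⟧ * order)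
      ≡⟨ ∑-*ʳ order FM.elems _ ⟩
    order * order ∎
    where
    third : ∀ A B → ∑M (triple A B) ≡ ⟦ isAut A ⟧ * ⟦ isAut B ⟧
    third A B with isAut A in a | isAut B in b
    ... | false | _ = ∑-0 FM.elems
    ... | true  | false = ∑-0 FM.elems
    ... | true  | true  = trans (∑-cong FM.elems λ C → trans (ℕ.*-identityˡ _) (ℕ.*-identityˡ _))
      (completions A B (IsAut-⊗ (isAut-sound a) (isAut-sound b)))

  -- The number of triples is the square of a multiple of 3, and it differs by a multiple of 3 from
  -- the number of A in Ĝ with A³ = 1; so the identity is not the only such A. The search for z is
  -- decidable, hence refuting its failure yields a witness.
  cauchy₃ : ∃ λ z → IsAut D z × Order3 z
  cauchy₃ = decide (FM.any? λ z → isAut? z ×-dec order3? z)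
    where
    identity-only : ¬ (∃ λ z → IsAut D z × Order3 z) → ∑M (λ A → triple A A A) ≡ 1
    identity-only none = trans (∑-cong FM.elems λ A → step A (FM._≟_ A I₄)) (FM.once I₄)
      where
      step : ∀ A (d : Dec (A ≡ I₄)) → triple A A A ≡ ⟦ does d ⟧
      step A (yes refl) = cong₂ (λ p q → ⟦ p ⟧ * (⟦ p ⟧ * (⟦ p ⟧ * ⟦ q ⟧)))
        (isAut-true IsAut-I) (dec-true (FM._≟_ (A ⊗ (A ⊗ A)) I₄) refl)
      step A (no A≢I) with isAut A in a
      ... | false = refl
      ... | true = trans (trans (ℕ.*-identityˡ _) (trans (ℕ.*-identityˡ _) (ℕ.*-identityˡ _)))
            (cong ⟦_⟧ (dec-false (FM._≟_ (A ⊗ (A ⊗ A)) I₄) λ e → none (A , isAut-sound a , e , A≢I)))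
    3∤1 : ¬ (3 ∣ 1)
    3∤1 (divides zero ())
    3∤1 (divides (suc q) ())
    mod-3 : ∀ o s m t → o ≡ 30 * s → t ≡ o * o → t ≡ 3 * m + 1 → 3 ∣ 1
    mod-3 o s m t ord total mod = ∣m+n∣m⇒∣n (subst (3 ∣_) (trans (sym total) mod)
      (∣m⇒∣m*n o (subst (3 ∣_) (sym ord) (∣m⇒∣m*n s (divides 10 refl))))) (m∣m*n m)
    decide : Dec (∃ λ z → IsAut D z × Order3 z) → ∃ λ z → IsAut D z × Order3 z
    decide (yes found) = found
    decide (no none) = contradiction
      (mod-3 order (proj₁ order-multiple) (proj₁ rotated) (RM.∑³ triple) (proj₂ order-multiple) triples-total
        (trans (proj₂ rotated) (cong (3 * proj₁ rotated +_) (identity-only none)))) 3∤1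
      where
      rotated : ∃ λ m → RM.∑³ triple ≡ 3 * m + ∑M (λ A → triple A A A)
      rotated = RM.∑³-rotation triple triple-rotate

-- Elements of order 3

·-conj : ∀ {C C'} → Inverses C C' → ∀ A x → x · C' · A · C ≡ x · (C' ⊗ (A ⊗ C))
·-conj {C} {C'} _ A x = trans (sym (·-⊗ (x · C') A C)) (sym (·-⊗ x C' (A ⊗ C)))

transport : (D : Design 9 3) {C C' : Mat} → Inverses C C' → Design 9 3
transport D {C} {C'} i@(CC' , C'C) = record
  { nblocks = nblocks D
  ; inc     = λ b x → inc D b (x · C')
  ; simple  = λ b b' h → simple D b b' λ x →
      subst (λ y → inc D b y ≡ inc D b' y) (cancelʳ CC' x) (h (x · C))
  ; size    = λ b → begin
      count (λ x → inc D b (x · C')) allV ≡⟨ count≡∑ _ allV ⟩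
      ∑V (λ x → ⟦ inc D b (x · C') ⟧) ≡⟨ ∑V-linear (Inverses-sym i) (λ x → ⟦ inc D b x ⟧) ⟩
      ∑V (λ x → ⟦ inc D b x ⟧) ≡⟨ count≡∑ (inc D b) allV ⟨
      count (inc D b) allV ≡⟨ size D b ⟩
      9 ∎
  ; balance = λ x y x≢y → balance D (x · C') (y · C') λ e →
      x≢y (trans (sym (cancelʳ C'C x)) (trans (cong (_· C) e) (cancelʳ C'C y)))
  }

conj-inverses : ∀ {C C' A A'} → Inverses C C' → Inverses A A' → Inverses (C' ⊗ (A ⊗ C)) (C' ⊗ (A' ⊗ C))
conj-inverses {C} {C'} {A} {A'} i j = subst (Inverses _) (⊗-assoc C' A' C)
  (Inverses-⊗ (Inverses-sym i) (Inverses-⊗ j i))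

preserves-transport : ∀ D {C C'} (i : Inverses C C') {A} → Preserves D A →
  Preserves (transport D i) (C' ⊗ (A ⊗ C))
preserves-transport D {C} {C'} i@(CC' , C'C) {A} p b with p b
... | b' , h = b' , λ x → trans
  (cong (inc D b') (trans (cong (_· C') (sym (·-conj i A x))) (cancelʳ CC' (x · C' · A)))) (h (x · C'))

translate-transport : ∀ D {C C'} (i : Inverses C C') →
  (∀ c b → ∃ λ b' → ∀ x → inc D b' (x ⊕ c) ≡ inc D b x) →
  ∀ c b → ∃ λ b' → ∀ x → inc (transport D i) b' (x ⊕ c) ≡ inc (transport D i) b x
translate-transport D {C} {C'} i t c b with t (c · C') b
... | b' , h = b' , λ x → trans (cong (inc D b') (vecMat-⊕ x c C')) (h (x · C'))

IsAut-transport : ∀ {D} (x : NElt) {A} → IsAut D A → IsAut (transport D (inverses x)) (A ^ x)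
IsAut-transport {D} x (A' , j , (p , q) , (r , s)) = A' ^ x ,
  conj-inverses (inverses x) j ,
  (Norm-⊗ (norm⁻¹ x) (Norm-⊗ p (norm x)) , Norm-⊗ (norm⁻¹ x) (Norm-⊗ q (norm x))) ,
  (preserves-transport D (inverses x) r , preserves-transport D (inverses x) s)

Setup-transport : ∀ {D} (x : NElt) → Setup D → Setup (transport D (inverses x))
Setup-transport {D} x S = record
  { translate = translate-transport D (inverses x) (Setup.translate S)
  ; transitive = trans′
  }
  where
  D′ = transport D (inverses x)
  trans′ : ∀ i j → inc D′ i 𝟎 ≡ true → inc D′ j 𝟎 ≡ true →
    ∃ λ A → IsAut D′ A × (∀ y → inc D′ j (y · A) ≡ inc D′ i y)
  trans′ i j p q with Setup.transitive S i j (trans (cong (inc D i) (sym (vecMat-𝟎 (mat⁻¹ x)))) p)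
                                             (trans (cong (inc D j) (sym (vecMat-𝟎 (mat⁻¹ x)))) q)
  ... | A , a , h = A ^ x , IsAut-transport {D} x {A} a , λ y → trans
    (cong (inc D j) (trans (cong (_· mat⁻¹ x) (sym (·-conj (inverses x) A y)))
      (cancelʳ (proj₁ (inverses x)) (y · mat⁻¹ x · A)))) (h (y · mat⁻¹ x))

LinearlyIsoToD₃ : Design 9 3 → Set
LinearlyIsoToD₃ D = ∃ λ C → ∃ λ C' → Inverses C C' ×
  (∀ i → IsD₃Block (λ y → inc D i (y · C'))) ×
  (∀ B → IsD₃Block B → ∃ λ i → ∀ y → B y ≡ inc D i (y · C'))

IsD₃Block-cong : ∀ {B B'} → (∀ y → B y ≡ B' y) → IsD₃Block B → IsD₃Block B'
IsD₃Block-cong e (A , c , A∈ , h) = A , c , A∈ , λ x →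
  (λ p → proj₁ (h x) (trans (e x) p)) , (λ q → trans (sym (e x)) (proj₂ (h x) q))

untransport : ∀ {D C C'} (i : Inverses C C') → LinearlyIsoToD₃ (transport D i) → LinearlyIsoToD₃ D
untransport {D} {C} {C'} i (E , E' , j , f , g) = C ⊗ E , E' ⊗ C' , Inverses-⊗ i j ,
  (λ b → IsD₃Block-cong (λ y → sym (step b y)) (f b)) ,
  (λ B B∈ → let (b , h) = g B B∈ in b , λ y → trans (h y) (sym (step b y)))
  where
  step : ∀ b y → inc D b (y · (E' ⊗ C')) ≡ inc D b (y · E' · C')
  step b y = cong (inc D b) (·-⊗ y E' C')

^-⊗ : ∀ (x : NElt) a b → (a ^ x) ⊗ (b ^ x) ≡ (a ⊗ b) ^ x
^-⊗ x a b = begin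
  (mat⁻¹ x ⊗ (a ⊗ mat x)) ⊗ (mat⁻¹ x ⊗ (b ⊗ mat x))
    ≡⟨ ⊗-assoc (mat⁻¹ x) (a ⊗ mat x) _ ⟩
  mat⁻¹ x ⊗ ((a ⊗ mat x) ⊗ (mat⁻¹ x ⊗ (b ⊗ mat x)))
    ≡⟨ cong (mat⁻¹ x ⊗_) (⊗-assoc a (mat x) _) ⟩
  mat⁻¹ x ⊗ (a ⊗ (mat x ⊗ (mat⁻¹ x ⊗ (b ⊗ mat x))))
    ≡⟨ cong (λ t → mat⁻¹ x ⊗ (a ⊗ t)) (⊗-cancelˡ (proj₁ (inverses x)) _) ⟩
  mat⁻¹ x ⊗ (a ⊗ (b ⊗ mat x))
    ≡⟨ cong (mat⁻¹ x ⊗_) (⊗-assoc a b (mat x)) ⟨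
  mat⁻¹ x ⊗ ((a ⊗ b) ⊗ mat x) ∎

^-I : ∀ (x : NElt) → I₄ ^ x ≡ I₄
^-I x = trans (cong (mat⁻¹ x ⊗_) (⊗-identityˡ (mat x))) (proj₂ (inverses x))

^-⊙ : ∀ z (x y : NElt) → z ^ (x ⊙ y) ≡ (z ^ x) ^ y
^-⊙ z x y = begin
  (mat⁻¹ y ⊗ mat⁻¹ x) ⊗ (z ⊗ (mat x ⊗ mat y))
    ≡⟨ ⊗-assoc (mat⁻¹ y) (mat⁻¹ x) _ ⟩
  mat⁻¹ y ⊗ (mat⁻¹ x ⊗ (z ⊗ (mat x ⊗ mat y)))
    ≡⟨ cong (λ t → mat⁻¹ y ⊗ (mat⁻¹ x ⊗ t)) (⊗-assoc z (mat x) (mat y)) ⟨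
  mat⁻¹ y ⊗ (mat⁻¹ x ⊗ ((z ⊗ mat x) ⊗ mat y))
    ≡⟨ cong (mat⁻¹ y ⊗_) (⊗-assoc (mat⁻¹ x) (z ⊗ mat x) (mat y)) ⟨
  mat⁻¹ y ⊗ ((mat⁻¹ x ⊗ (z ⊗ mat x)) ⊗ mat y) ∎

^-inverse : ∀ z (x : NElt) → (z ^ x) ^ (x ⁻¹) ≡ z
^-inverse z x = begin
  (z ^ x) ^ (x ⁻¹) ≡⟨ ^-⊙ z x (x ⁻¹) ⟨
  z ^ (x ⊙ x ⁻¹) ≡⟨ cong₂ (λ s t → s ⊗ (z ⊗ t)) (proj₁ (inverses x)) (proj₁ (inverses x)) ⟩
  I₄ ⊗ (z ⊗ I₄) ≡⟨ trans (⊗-identityˡ _) (⊗-identityʳ z) ⟩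
  z ∎

^-order3 : ∀ (x : NElt) {z} → Order3 z → Order3 (z ^ x)
^-order3 x {z} (e , z≢I) =
  trans (cong ((z ^ x) ⊗_) (^-⊗ x z z)) (trans (^-⊗ x z (z ⊗ z)) (trans (cong (_^ x) e) (^-I x))) ,
  λ f → z≢I (trans (sym (^-inverse z x)) (trans (cong (_^ (x ⁻¹)) f) (^-I (x ⁻¹))))

-- Listing the elements of order 3 of N(R)

infixl 20 _⊖_

_⊖_ : V → V → V
u ⊖ v = u ⊕ neg v

⊖≡𝟎 : ∀ u v → u ⊖ v ≡ 𝟎 → u ≡ v
⊖≡𝟎 u v e = trans (sym (neg-⊕-cancel u v)) (trans (cong (_⊕ v) e) (⊕-identityˡ v))

·-⊖ : ∀ u v A → (u ⊖ v) · A ≡ u · A ⊖ v · A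
·-⊖ u v A = trans (vecMat-⊕ u (neg v) A) (cong (u · A ⊕_) (vecMat-scale 𝟚 v A))

-- In characteristic 3, (z - 1)³ = z³ - 1.
third-difference : ∀ {n} (a b c : Vec F3 n) →
  ((a ⊕ neg c) ⊕ neg (c ⊕ neg b)) ⊕ neg ((c ⊕ neg b) ⊕ neg (b ⊕ neg a)) ≡ 𝟎
third-difference [] [] [] = refl
third-difference (a ∷ as) (b ∷ bs) (c ∷ cs) = cong₂ _∷_ (h a b c) (third-difference as bs cs)
  where
  -′ : F3 → F3
  -′ = 𝟚 *₃_
  h : ∀ a b c → ((a +₃ -′ c) +₃ -′ (c +₃ -′ b)) +₃ -′ ((c +₃ -′ b) +₃ -′ (b +₃ -′ a)) ≡ 𝟘
  h = toWitness {a? = F3-all? λ a → F3-all? λ b → F3-all? λ c → _ ≟F 𝟘} tt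
    where F3-all? = Finite.all? F3-finite

-- As (z - 1)³ = 0, the last non-zero vector among x, x (z - 1), x (z - 1)² is fixed by z. Taking x
-- not fixed makes the second of them non-zero.
fixed-vector : ∀ {z} → Order3 z → ∃ λ w → w ≢ 𝟎 × w · z ≡ w
fixed-vector {z} (z³ , z≢I) with FV.any? (λ x → ¬? ((x · z) ≟V x))
... | no none = contradiction (Mat-ext λ v → trans (fix v) (sym (·-I v))) z≢I
  where
  fix : ∀ v → v · z ≡ v
  fix v with (v · z) ≟V v
  ... | yes e = e
  ... | no e = contradiction (v , e) none
... | yes (x , xz≢x) = case (x₁ · z) ≟V x₁ of λ where
    (yes e) → x₁ , (λ f → xz≢x (⊖≡𝟎 (x · z) x f)) , e
    (no e)  → x₂ , (λ f → e (⊖≡𝟎 (x₁ · z) x₁ f)) , ⊖≡𝟎 (x₂ · z) x₂ x₃≡𝟎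
  where
  x₁ x₂ : V
  x₁ = x · z ⊖ x
  x₂ = x₁ · z ⊖ x₁
  a b c : V
  a = x
  b = x · z
  c = x · z · z
  x₁z : x₁ · z ≡ c ⊖ b
  x₁z = ·-⊖ (x · z) x z
  zzz : c · z ≡ a
  zzz = trans (sym (trans (·-⊗ x z (z ⊗ z)) (·-⊗ (x · z) z z))) (trans (cong (x ·_) z³) (·-I x))
  x₃≡𝟎 : x₂ · z ⊖ x₂ ≡ 𝟎
  x₃≡𝟎 = begin
    x₂ · z ⊖ x₂
      ≡⟨ cong (_⊖ x₂) (trans (·-⊖ (x₁ · z) x₁ z) (cong (λ t → t · z ⊖ x₁ · z) x₁z)) ⟩
    ((c ⊖ b) · z ⊖ x₁ · z) ⊖ x₂
      ≡⟨ cong (λ t → (t ⊖ x₁ · z) ⊖ x₂) (trans (·-⊖ c b z) (cong (_⊖ c) zzz)) ⟩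
    ((a ⊖ c) ⊖ x₁ · z) ⊖ (x₁ · z ⊖ x₁)
      ≡⟨ cong (λ t → ((a ⊖ c) ⊖ t) ⊖ (t ⊖ x₁)) x₁z ⟩
    ((a ⊖ c) ⊖ (c ⊖ b)) ⊖ ((c ⊖ b) ⊖ (b ⊖ a))
      ≡⟨ third-difference a b c ⟩
    𝟎 ∎

Reached : List Mat → V → Set
Reached As w = Any (λ A → v₁ · A ≡ w ⊎ v₂ · A ≡ w) As

opaque
  orbits : All (λ w → w ≡ 𝟎 ⊎ Reached (map (mat ∘ word) words) w) (allVec 4)
  orbits = toWitness {a? = orbits? (map (mat ∘ word) words)} tt
    where
    orbits? : ∀ As → Dec (All (λ w → w ≡ 𝟎 ⊎ Reached As w) (allVec 4))
    orbits? As = All.all? (λ w → (w ≟V 𝟎) ⊎-dec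
      Any.any? (λ A → ((v₁ · A) ≟V w) ⊎-dec ((v₂ · A) ≟V w)) As) (allVec 4)

∈-allVec : ∀ w → w ∈ allVec 4
∈-allVec w = subst (w ∈_) (trans allV≡vectors (sym (allVec≡vectors 4))) (FV.complete w)

Reached-word : ∀ us {w} → Reached (map (mat ∘ word) us) w →
  ∃ λ u → v₁ · mat (word u) ≡ w ⊎ v₂ · mat (word u) ≡ w
Reached-word (u ∷ us) (here p) = u , p
Reached-word (u ∷ us) (there p) = Reached-word us p

reach : ∀ w → w ≢ 𝟎 → ∃ λ u → v₁ · mat (word u) ≡ w ⊎ v₂ · mat (word u) ≡ w
reach w w≢𝟎 = [ (λ e → contradiction e w≢𝟎) , Reached-word words ]′ (All.lookup orbits (∈-allVec w))

^-word-closed : ∀ (P : Mat → Set) → (∀ {z} → P z → P (z ^ Nα)) → (∀ {z} → P z → P (z ^ Nβ)) →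
  ∀ u {z} → P z → P (z ^ word u)
^-word-closed P hα hβ [] {z} p = subst P (sym (trans (⊗-identityˡ (z ⊗ I₄)) (⊗-identityʳ z))) p
^-word-closed P hα hβ (c ∷ u) {z} p =
  subst P (sym (^-⊙ z (Nα ⊙ β^ c) (word u))) (^-word-closed P hα hβ u
    (subst P (sym (^-⊙ z Nα (β^ c))) (power c (hα p))))
  where
  power : ∀ c {z} → P z → P (z ^ β^ c)
  power 𝟘 {z} p = subst P (sym (trans (⊗-identityˡ (z ⊗ I₄)) (⊗-identityʳ z))) p
  power 𝟙 p = hβ p
  power 𝟚 {z} p = subst P (sym β²) (hβ (hβ p))
    where
    β² : z ^ (Nβ ⁻¹) ≡ (z ^ Nβ) ^ Nβ
    β² = ^-⊙ z Nβ Nβ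

Conjβ-word : ∀ u {z} → Conjβ z → Conjβ (z ^ word u)
Conjβ-word = ^-word-closed Conjβ Conjβ-^α Conjβ-^β

-- The rows of `S₀` are the images of `v₁` under 1, `i₀`, `r₀` and `r₀` `i₀`. If X and Y are the
-- conjugates of `r₀` and `i₀` by z, then z sends these rows to the images of `v₁` under 1, Y, X and
-- X Y.
fixing-v₁ : ∀ {z} → Norm z → Order3 z → v₁ · z ≡ v₁ → Conjβ z
fixing-v₁ {z} N o v₁z = subst Conjβ (sym z≡) (candidate-Conjβ Y∈ X∈ (subst Norm z≡ N) (subst Order3 z≡ o))
  where
  norm-i : ∃ λ Y → InR₀ Y × i₀ ⊗ z ≡ z ⊗ Y
  norm-i = Norm⁻ N (InR₀⁺ (All.lookup generators⊆R₀ (there (there (here refl)))))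
  norm-r : ∃ λ X → InR₀ X × r₀ ⊗ z ≡ z ⊗ X
  norm-r = Norm⁻ N (InR₀⁺ (All.lookup generators⊆R₀ (there (here refl))))
  X Y : Mat
  Y = proj₁ norm-i
  X = proj₁ norm-r
  Y∈ = proj₁ (proj₂ norm-i)
  X∈ = proj₁ (proj₂ norm-r)
  image : ∀ v {A B} → A ⊗ z ≡ z ⊗ B → v · A · z ≡ v · z · B
  image v {A} {B} e = trans (sym (·-⊗ v A z)) (trans (cong (v ·_) e) (·-⊗ v z B))
  iz : v₁ · i₀ · z ≡ v₁ · Y
  iz = trans (image v₁ {i₀} {Y} (proj₂ (proj₂ norm-i))) (cong (_· Y) v₁z)
  rz : v₁ · r₀ · z ≡ v₁ · X
  rz = trans (image v₁ {r₀} {X} (proj₂ (proj₂ norm-r))) (cong (_· X) v₁z)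
  riz : v₁ · r₀ · i₀ · z ≡ v₁ · X · Y
  riz = trans (image (v₁ · r₀) {i₀} {Y} (proj₂ (proj₂ norm-i))) (cong (_· Y) {v₁ · r₀ · z} {v₁ · X} rz)
  rows : ∀ {a b c d a' b' c' d' : V} → a ≡ a' → b ≡ b' → c ≡ c' → d ≡ d' →
    ⟨ a , b , c , d ⟩ ≡ ⟨ a' , b' , c' , d' ⟩
  rows refl refl refl refl = refl
  z≡ : z ≡ candidate Y X
  z≡ = trans (sym (⊗-cancelˡ {S₀⁻¹} {S₀} refl z))
    (cong (S₀⁻¹ ⊗_) (rows v₁z iz rz riz))

-- A non-zero vector fixed by z can be moved to `v₁` inside N(R), through `r₀` if it lies in the
-- orbit of `v₂`. The list is closed under conjugation by `α`, `β` and `r₀`, which allows the way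
-- back.
order3⇒Conjβ : ∀ {z} → Norm z → Order3 z → Conjβ z
order3⇒Conjβ {z} N o = from-word (reach w w≢𝟎)
  where
  w = proj₁ (fixed-vector o)
  w≢𝟎 = proj₁ (proj₂ (fixed-vector o))
  wz : w · z ≡ w
  wz = proj₂ (proj₂ (fixed-vector o))
  fixes : ∀ (x : NElt) → v₁ · mat x ≡ w → Conjβ (z ^ (x ⁻¹))
  fixes x e = fixing-v₁ (Norm-⊗ (norm x) (Norm-⊗ N (norm⁻¹ x))) (^-order3 (x ⁻¹) o) (begin
    v₁ · (mat x ⊗ (z ⊗ mat⁻¹ x)) ≡⟨ ·-⊗ v₁ (mat x) _ ⟩
    v₁ · mat x · (z ⊗ mat⁻¹ x) ≡⟨ cong (_· (z ⊗ mat⁻¹ x)) e ⟩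
    w · (z ⊗ mat⁻¹ x) ≡⟨ ·-⊗ w z (mat⁻¹ x) ⟩
    w · z · mat⁻¹ x ≡⟨ cong (_· mat⁻¹ x) (trans wz (sym e)) ⟩
    v₁ · mat x · mat⁻¹ x ≡⟨ cancelʳ (proj₁ (inverses x)) v₁ ⟩
    v₁ ∎)
  from-word : (∃ λ u → v₁ · mat (word u) ≡ w ⊎ v₂ · mat (word u) ≡ w) → Conjβ z
  from-word (u , inj₁ e) = subst Conjβ (^-inverse z (word u ⁻¹)) (Conjβ-word u (fixes (word u) e))
  from-word (u , inj₂ e) = subst Conjβ
    (trans (sym (^-⊙ (z ^ (x ⁻¹)) Nr (word u))) (^-inverse z (x ⁻¹)))
    (Conjβ-word u {(z ^ (x ⁻¹)) ^ Nr} (Conjβ-^r₀ {z ^ (x ⁻¹)} (fixes x v₁x)))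
    where
    x : NElt
    x = Nr ⊙ word u
    v₁x : v₁ · (r₀ ⊗ mat (word u)) ≡ w
    v₁x = trans (·-⊗ v₁ r₀ (mat (word u))) e

Conjβ-conj : ∀ {z} → Conjβ z → ∃ λ (x : NElt) → z ^ x ≡ β
Conjβ-conj z∈ = let (q , x , e) = Conjβ⁻ z∈ in (q ⊙ x) ⁻¹ ,
  trans (cong (_^ ((q ⊙ x) ⁻¹)) (trans e (sym (^-⊙ β q x)))) (^-inverse β (q ⊙ x))

-- The action of N(R) on the five pairs of involutions

-- The ten non-central involutions ±f of R₀ come in the five pairs listed by fs.
IsInvolution : Mat → Fin 5 → Set
IsInvolution Y k = Y ≡ fs k ⊎ Y ≡ negM (fs k)

involutions : All (λ Y → Y ⊗ Y ≡ I₄ → (Y ≡ I₄ ⊎ Y ≡ negM I₄) ⊎ ∃ (IsInvolution Y)) R₀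
involutions = toWitness {a? = All.all? (λ Y → ((Y ⊗ Y) ≟M I₄) →-dec
  (((Y ≟M I₄) ⊎-dec (Y ≟M negM I₄)) ⊎-dec Fin.any? λ k → (Y ≟M fs k) ⊎-dec (Y ≟M negM (fs k)))) R₀} tt

fs∈R₀ : ∀ k → fs k ∈ R₀
fs∈R₀ = toWitness {a? = Fin.all? λ k → Any.any? (fs k ≟M_) R₀} tt

fs-square : ∀ k → fs k ⊗ fs k ≡ I₄
fs-square = toWitness {a? = Fin.all? λ k → (fs k ⊗ fs k) ≟M I₄} tt

fs-noncentral : ∀ k → fs k ≢ I₄ × fs k ≢ negM I₄
fs-noncentral = toWitness {a? = Fin.all? λ k → ¬? (fs k ≟M I₄) ×-dec ¬? (fs k ≟M negM I₄)} tt

fs-distinct : ∀ k l → IsInvolution (fs k) l → k ≡ l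
fs-distinct = toWitness {a? = Fin.all? λ k → Fin.all? λ l →
  ((fs k ≟M fs l) ⊎-dec (fs k ≟M negM (fs l))) →-dec (k Fin.≟ l)} tt

record Maps (A : Mat) (k l : Fin 5) : Set where
  constructor maps-by
  field
    image      : Mat
    intertwine : fs k ⊗ A ≡ A ⊗ image
    involution : IsInvolution image l

InR₀-involutions : ∀ {Y} → InR₀ Y → Y ⊗ Y ≡ I₄ → (Y ≡ I₄ ⊎ Y ≡ negM I₄) ⊎ ∃ (IsInvolution Y)
InR₀-involutions Y∈ = All.lookup involutions (InR₀⁻ Y∈)

-- A conjugate of an involution is an involution, and it is not central when the original is not;
-- within `R₀` this leaves the ten listed ones.
maps : (x : NElt) → ∀ k → ∃ (Maps (mat x) k)
maps x k = go (InR₀-involutions Y∈ Y²)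
  where
  A = mat x
  A' = mat⁻¹ x
  N = Norm⁻ (norm x) (InR₀⁺ (fs∈R₀ k))
  Y = proj₁ N
  Y∈ = proj₁ (proj₂ N)
  e : fs k ⊗ A ≡ A ⊗ Y
  e = proj₂ (proj₂ N)
  Y² : Y ⊗ Y ≡ I₄
  Y² = begin
    Y ⊗ Y ≡⟨ ⊗-cancelˡ (proj₂ (inverses x)) (Y ⊗ Y) ⟨
    A' ⊗ (A ⊗ (Y ⊗ Y)) ≡⟨ cong (A' ⊗_) (trans (sym (⊗-assoc A Y Y)) (cong (_⊗ Y) (sym e))) ⟩
    A' ⊗ ((fs k ⊗ A) ⊗ Y) ≡⟨ cong (A' ⊗_) (trans (⊗-assoc (fs k) A Y) (cong (fs k ⊗_) (sym e))) ⟩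
    A' ⊗ (fs k ⊗ (fs k ⊗ A)) ≡⟨ cong (A' ⊗_) (⊗-cancelˡ (fs-square k) A) ⟩
    A' ⊗ A ≡⟨ proj₂ (inverses x) ⟩
    I₄ ∎
  recover : ∀ {Z} → Y ≡ Z → fs k ≡ (A ⊗ Z) ⊗ A'
  recover refl = trans (sym (⊗-cancelʳ (proj₁ (inverses x)) (fs k))) (cong (_⊗ A') e)
  go : (Y ≡ I₄ ⊎ Y ≡ negM I₄) ⊎ ∃ (IsInvolution Y) → ∃ (Maps A k)
  go (inj₂ (l , i)) = l , maps-by Y e i
  go (inj₁ (inj₁ f)) = contradiction
    (trans (recover f) (trans (cong (_⊗ A') (⊗-identityʳ A)) (proj₁ (inverses x)))) (proj₁ (fs-noncentral k))
  go (inj₁ (inj₂ f)) = contradiction (begin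
    fs k ≡⟨ recover f ⟩
    (A ⊗ negM I₄) ⊗ A' ≡⟨ cong (_⊗ A') (trans (⊗-negM A I₄) (cong negM (⊗-identityʳ A))) ⟩
    negM A ⊗ A' ≡⟨ trans (negM-⊗ A A') (cong negM (proj₁ (inverses x))) ⟩
    negM I₄ ∎) (proj₂ (fs-noncentral k))

IsInvolution-sign : ∀ {X Y k} → IsInvolution X k → IsInvolution Y k → X ≡ Y ⊎ X ≡ negM Y
IsInvolution-sign (inj₁ refl) (inj₁ refl) = inj₁ refl
IsInvolution-sign (inj₁ refl) (inj₂ refl) = inj₂ (sym (negM-involutive _))
IsInvolution-sign (inj₂ refl) (inj₁ refl) = inj₂ refl
IsInvolution-sign (inj₂ refl) (inj₂ refl) = inj₁ refl

maps-injective : ∀ (x : NElt) {k l m} → Maps (mat x) k m → Maps (mat x) l m → k ≡ l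
maps-injective x {k} {l} {m} (maps-by X e i) (maps-by Y f j) = fs-distinct k l (go (IsInvolution-sign {X} {Y} {m} i j))
  where
  A = mat x
  A' = mat⁻¹ x
  fk : fs k ≡ (A ⊗ X) ⊗ A'
  fk = trans (sym (⊗-cancelʳ (proj₁ (inverses x)) (fs k))) (cong (_⊗ A') e)
  fl : fs l ≡ (A ⊗ Y) ⊗ A'
  fl = trans (sym (⊗-cancelʳ (proj₁ (inverses x)) (fs l))) (cong (_⊗ A') f)
  go : X ≡ Y ⊎ X ≡ negM Y → IsInvolution (fs k) l
  go (inj₁ X≡Y) = inj₁ (trans fk (trans (cong (λ Z → (A ⊗ Z) ⊗ A') X≡Y) (sym fl)))
  go (inj₂ X≡-Y) = inj₂ (begin
    fs k ≡⟨ fk ⟩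
    (A ⊗ X) ⊗ A' ≡⟨ cong (λ Z → (A ⊗ Z) ⊗ A') X≡-Y ⟩
    (A ⊗ negM Y) ⊗ A' ≡⟨ cong (_⊗ A') (⊗-negM A Y) ⟩
    negM (A ⊗ Y) ⊗ A' ≡⟨ negM-⊗ (A ⊗ Y) A' ⟩
    negM ((A ⊗ Y) ⊗ A') ≡⟨ cong negM fl ⟨
    negM (fs l) ∎)

Comm-^ : ∀ (x : NElt) {k l z} → Maps (mat x) k l → Comm k z → Comm l (z ^ x)
Comm-^ x {k} {l} {z} (maps-by Y e i) (comm c) = unsign i commutes
  where
  A = mat x
  A' = mat⁻¹ x
  YA' : Y ⊗ A' ≡ A' ⊗ fs k
  YA' = begin
    Y ⊗ A' ≡⟨ cong (_⊗ A') (⊗-cancelˡ (proj₂ (inverses x)) Y) ⟨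
    (A' ⊗ (A ⊗ Y)) ⊗ A' ≡⟨ cong (λ t → (A' ⊗ t) ⊗ A') e ⟨
    (A' ⊗ (fs k ⊗ A)) ⊗ A' ≡⟨ cong (_⊗ A') (⊗-assoc A' (fs k) A) ⟨
    ((A' ⊗ fs k) ⊗ A) ⊗ A' ≡⟨ ⊗-cancelʳ (proj₁ (inverses x)) (A' ⊗ fs k) ⟩
    A' ⊗ fs k ∎
  commutes : Y ⊗ (z ^ x) ≡ (z ^ x) ⊗ Y
  commutes = begin
    Y ⊗ (A' ⊗ (z ⊗ A)) ≡⟨ ⊗-assoc Y A' _ ⟨
    (Y ⊗ A') ⊗ (z ⊗ A) ≡⟨ cong (_⊗ (z ⊗ A)) YA' ⟩
    (A' ⊗ fs k) ⊗ (z ⊗ A) ≡⟨ ⊗-assoc A' (fs k) _ ⟩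
    A' ⊗ (fs k ⊗ (z ⊗ A)) ≡⟨ cong (A' ⊗_) (trans (sym (⊗-assoc (fs k) z A)) (trans (cong (_⊗ A) c) (⊗-assoc z (fs k) A))) ⟩
    A' ⊗ (z ⊗ (fs k ⊗ A)) ≡⟨ cong (λ t → A' ⊗ (z ⊗ t)) e ⟩
    A' ⊗ (z ⊗ (A ⊗ Y)) ≡⟨ cong (A' ⊗_) (⊗-assoc z A Y) ⟨
    A' ⊗ ((z ⊗ A) ⊗ Y) ≡⟨ ⊗-assoc A' (z ⊗ A) Y ⟨
    (A' ⊗ (z ⊗ A)) ⊗ Y ∎
  unsign : IsInvolution Y l → Y ⊗ (z ^ x) ≡ (z ^ x) ⊗ Y → Comm l (z ^ x)
  unsign (inj₁ refl) h = comm h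
  unsign (inj₂ refl) h = comm (begin
    fs l ⊗ (z ^ x) ≡⟨ negM-involutive _ ⟨
    negM (negM (fs l ⊗ (z ^ x))) ≡⟨ cong negM (trans (sym (negM-⊗ (fs l) (z ^ x))) (trans h (⊗-negM (z ^ x) (fs l)))) ⟩
    negM (negM ((z ^ x) ⊗ fs l)) ≡⟨ negM-involutive _ ⟩
    (z ^ x) ⊗ fs l ∎)

Eigen : Fin 5 → V → Set
Eigen k v = v · fs k ≡ v ⊎ v · fs k ≡ neg v

-- Each non-zero vector is an eigenvector of exactly one pair ±f, so this set has 16 ∣S∣ elements.
Spanned : (Fin 5 → Bool) → V → Set
Spanned S v = v ≢ 𝟎 × ∃ λ k → S k ≡ true × Eigen k v

spanned? : ∀ S v → Dec (Spanned S v)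
spanned? S v = ¬? (v ≟V 𝟎) ×-dec Fin.any? λ k → (S k Bool.≟ true) ×-dec
  (((v · fs k) ≟V v) ⊎-dec ((v · fs k) ≟V neg v))

Eigen-· : ∀ {A k l v} → Maps A k l → Eigen k v → Eigen l (v · A)
Eigen-· {A} {k} {l} {v} (maps-by Y e i) h = go i h
  where
  vAY : v · A · Y ≡ v · fs k · A
  vAY = trans (sym (·-⊗ v A Y)) (trans (cong (v ·_) (sym e)) (·-⊗ v (fs k) A))
  neg-A : v · fs k ≡ neg v → v · A · Y ≡ neg (v · A)
  neg-A h = trans vAY (trans (cong (_· A) h) (vecMat-scale 𝟚 v A))
  swap : ∀ {w} → v · A · negM (fs l) ≡ w → v · A · fs l ≡ neg w
  swap {w} h = trans (sym (neg-involutive _)) (cong neg (trans (sym (·-negM (v · A) (fs l))) h))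
  go : IsInvolution Y l → Eigen k v → Eigen l (v · A)
  go (inj₁ refl) (inj₁ h) = inj₁ (trans vAY (cong (_· A) h))
  go (inj₁ refl) (inj₂ h) = inj₂ (neg-A h)
  go (inj₂ refl) (inj₁ h) = inj₂ (swap (trans vAY (cong (_· A) h)))
  go (inj₂ refl) (inj₂ h) = inj₁ (trans (swap (neg-A h)) (neg-involutive _))

commβ : Fin 5 → Bool
commβ k = does (comm? k β)

singleton : Fin 5 → Fin 5 → Bool
singleton k l = does (k Fin.≟ l)

partner : ∀ k → Comm k β → ∃ λ a → Comm a β × a ≢ k
partner = toWitness {a? = Fin.all? λ k → comm? k β →-dec Fin.any? λ a → comm? a β ×-dec ¬? (a Fin.≟ k)} tt

allVec-weight-commβ : ∑ (allVec 4) (λ x → ⟦ does (spanned? commβ x) ⟧) ≡ 32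
allVec-weight-commβ = refl

allVec-weight-singleton : ∀ k → ∑ (allVec 4) (λ x → ⟦ does (spanned? (singleton k) x) ⟧) ≡ 16
allVec-weight-singleton zero = refl
allVec-weight-singleton (suc zero) = refl
allVec-weight-singleton (suc (suc zero)) = refl
allVec-weight-singleton (suc (suc (suc zero))) = refl
allVec-weight-singleton (suc (suc (suc (suc zero)))) = refl

allV≡allVec : allV ≡ allVec 4
allV≡allVec = trans allV≡vectors (sym (allVec≡vectors 4))

∑V≡∑-allVec : ∀ f → ∑V f ≡ ∑ (allVec 4) f
∑V≡∑-allVec f = cong (λ vs → ∑ vs f) {allV} {allVec 4} allV≡allVec

opaque
  inSpan : (Fin 5 → Bool) → V → Bool
  inSpan T x = does (spanned? T x)

  inSpan-true : ∀ {T x} → Spanned T x → inSpan T x ≡ true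
  inSpan-true {T} {x} = dec-true (spanned? T x)

  inSpan-sound : ∀ {T x} → inSpan T x ≡ true → Spanned T x
  inSpan-sound {T} {x} = does⁻ (spanned? T x)

  weight-commβ : ∑V (λ x → ⟦ inSpan commβ x ⟧) ≡ 32
  weight-commβ = trans (∑V≡∑-allVec (λ x → ⟦ does (spanned? commβ x) ⟧)) allVec-weight-commβ

  weight-singleton : ∀ k → ∑V (λ x → ⟦ inSpan (singleton k) x ⟧) ≡ 16
  weight-singleton k = trans (∑V≡∑-allVec (λ x → ⟦ does (spanned? (singleton k) x) ⟧)) (allVec-weight-singleton k)

inSpan-𝟎 : ∀ T → inSpan T 𝟎 ≡ false
inSpan-𝟎 T with inSpan T 𝟎 in e
... | false = refl
... | true = contradiction refl (proj₁ (inSpan-sound {T} {𝟎} e))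

-- Two elements of order 3 whose 3-cycles overlap in one point

elt : ∀ {D A} → IsAut D A → NElt
elt {A = A} (A' , i , (p , q) , _) = record { mat = A ; mat⁻¹ = A' ; inverses = i ; norm = p ; norm⁻¹ = q }

Disjoint : Mat → Mat → Set
Disjoint x z = ∀ k → ¬ (Comm k x × Comm k z)

Disjoint-^ : ∀ (t : NElt) {x z} → Disjoint x z → Disjoint (x ^ t) (z ^ t)
Disjoint-^ t {x} {z} d l (p , q) = let (k , m) = maps (t ⁻¹) l in d k
  ( subst (Comm k) (^-inverse x t) (Comm-^ (t ⁻¹) {l} {k} {x ^ t} m p)
  , subst (Comm k) (^-inverse z t) (Comm-^ (t ⁻¹) {l} {k} {z ^ t} m q))

module Generation (D : Design 9 3) (S : Setup D) where
  open Counting D S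

  -- If all of Ĝ kept the pairs in T among themselves, their eigenvectors would form an invariant
  -- set, whose size would have to be a multiple of 10.
  leaves : ∀ (T : Fin 5 → Bool) → ¬ (10 ∣ ∑V (λ x → ⟦ inSpan T x ⟧)) →
    ∃ λ A → Σ (IsAut D A) λ a → ∃ λ k → ∃ λ l → T k ≡ true × T l ≡ false × Maps A k l
  leaves T 10∤ = go (moved (inSpan T) (inSpan-𝟎 T) 10∤)
    where
    go : (∃ λ A → IsAut D A × ∃ λ x → inSpan T x ≡ true × inSpan T (x · A) ≡ false) →
      ∃ λ A → Σ (IsAut D A) λ a → ∃ λ k → ∃ λ l → T k ≡ true × T l ≡ false × Maps A k l
    go (A , a , x , p , q) = go′ (inSpan-sound {T} {x} p) (maps (elt {D} {A} a))
      where
      A' = mat⁻¹ (elt {D} {A} a)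
      nonzero : x ≢ 𝟎 → x · A ≢ 𝟎
      nonzero x≢𝟎 e = x≢𝟎 (trans (sym (cancelʳ (proj₁ (inverses (elt {D} {A} a))) x))
        (trans (cong (_· A') e) (vecMat-𝟎 A')))
      go′ : Spanned T x → (∀ k → ∃ (Maps A k)) →
        ∃ λ A → Σ (IsAut D A) λ a → ∃ λ k → ∃ λ l → T k ≡ true × T l ≡ false × Maps A k l
      go′ (x≢𝟎 , k , k∈T , h) m = A , a , k , l , k∈T , l∉T (T l) refl , proj₂ (m k)
        where
        l = proj₁ (m k)
        l∉T : ∀ b → T l ≡ b → T l ≡ false
        l∉T false e = e
        l∉T true  e = contradiction (trans (sym (inSpan-true {T} {x · A}
          (nonzero x≢𝟎 , l , e , Eigen-· {A} {k} {l} {x} (proj₂ (m k)) h))) q) λ ()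

  record Good (z : Mat) : Set where
    constructor good
    field
      aut    : IsAut D z
      order3 : Order3 z

  open Good

  Good⇒Conjβ : ∀ {z} → Good z → Conjβ z
  Good⇒Conjβ {z} (good (_ , _ , (N , _) , _) o) = order3⇒Conjβ {z} N o

  Good-^ : ∀ {A z} (a : IsAut D A) → Good z → Good (z ^ elt {D} {A} a)
  Good-^ {A} {z} a (good z∈ o) = good
    (IsAut-⊗ D S {proj₁ a} {z ⊗ A} (IsAut-inverse {A} a) (IsAut-⊗ D S {z} {A} z∈ a))
    (^-order3 (elt {D} {A} a) {z} o)

  square-inverse : ∀ {z} (g : Good z) → mat⁻¹ (elt {D} {z} (aut g)) ≡ z ⊗ z
  square-inverse {z} (good (z' , (zz' , z'z) , _) (z³ , _)) =
    trans (sym (⊗-identityʳ z')) (trans (cong (z' ⊗_) (sym z³)) (⊗-cancelˡ z'z (z ⊗ z)))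

  -- Think of 3-cycles on five points. The two points fixed by `β` span 32 vectors, not a multiple
  -- of 10, so some conjugate z of `β` fixes a point that `β` moves. If `β` and z still fix a common
  -- point k, an element moving k exists because 16 is no multiple of 10; it conjugates `β` or z to
  -- a 3-cycle y that moves k.
  disjoint-pair : Good β → ∃ λ x → ∃ λ z → Good x × Good z × Disjoint x z
  disjoint-pair β∈ = first (leaves commβ λ d → toWitnessFalse {a? = 10 ∣? 32} tt (subst (10 ∣_) weight-commβ d))
    where
    Pair : Set
    Pair = ∃ λ x → ∃ λ z → Good x × Good z × Disjoint x z
    avoid : ∀ {x y m n} → Good y → m ≢ n → Comm m y → Comm n y → Avoids m n x → Disjoint x y
    avoid {m = m} {n} y∈ m≢n my ny (¬m , ¬n) j (jx , jy) =
      [ (λ { refl → ¬m jx }) , (λ { refl → ¬n jx }) ]′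
        (proj₁ (Conjβ-pairFacts (Good⇒Conjβ y∈)) m n m≢n my ny j jy)
    -- Apart from k, the three elements `β`, z and z⁻¹ `β` z fix three distinct points. The 3-cycle
    -- y fixes only m and n, so at least one of the three elements fixes neither.
    finish : ∀ {z y k l} → Good z → Good y → Comm k β → Comm k z → Comm l z → ¬ Comm l β →
      ∀ m n → m ≢ n → m ≢ k → n ≢ k → Comm m y → Comm n y → Pair
    finish {z} {y} {k} {l} z∈ y∈ kβ kz lz l∤β m n m≢n m≢k n≢k my ny =
      [ (λ av → β , y , β∈ , y∈ , avoid {m = m} {n} y∈ m≢n my ny av)
      , [ (λ av → z , y , z∈ , y∈ , avoid {m = m} {n} y∈ m≢n my ny av)
        , (λ av → (z ⊗ z) ⊗ (β ⊗ z) , y ,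
             subst (λ t → Good (t ⊗ (β ⊗ z))) (square-inverse {z} z∈) (Good-^ {z} {β} (aut z∈) β∈) ,
             y∈ , avoid {m = m} {n} y∈ m≢n my ny av)
        ]′ ]′
      (proj₁ (proj₂ (Conjβ-pairFacts (Good⇒Conjβ z∈))) k kβ kz (l , lz , l∤β) m n m≢n m≢k n≢k)
    -- z commutes with f k and f l only, β with f k and f a only, and B moves k.
    second : ∀ {z k l a} → Good z → Comm k β → Comm k z → Comm l z → ¬ Comm l β → Comm a β → a ≢ k →
      (∃ λ B → Σ (IsAut D B) λ b → ∃ λ k′ → ∃ λ m → singleton k k′ ≡ true × singleton k m ≡ false × Maps B k′ m) →
      Pair
    second {z} {k} {l} {a} z∈ kβ kz lz l∤β aβ a≢k (B , b , k′ , m , k≡ , k≢ , k′↦m) =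
      go (proj₁ (maps x a) Fin.≟ k) (proj₂ (maps x a)) (proj₂ (maps x l))
      where
      x : NElt
      x = elt {D} {B} b
      m≢k : m ≢ k
      m≢k e = contradiction (trans (sym (dec-true (k Fin.≟ m) (sym e))) k≢) λ ()
      k↦m : Maps B k m
      k↦m = subst (λ t → Maps B t m) (sym (does⁻ (k Fin.≟ k′) k≡)) k′↦m
      go : ∀ {a′ l′} → Dec (a′ ≡ k) → Maps B a a′ → Maps B l l′ → Pair
      go {a′} {l′} (no a′≢k) a↦ l↦ =
        finish {z} {β ^ x} {k} {l} z∈ (Good-^ {B} {β} b β∈) kβ kz lz l∤β m a′
        (λ e → a≢k (maps-injective x a↦ (subst (Maps B k) e k↦m))) m≢k a′≢k
        (Comm-^ x {k} {m} {β} k↦m kβ) (Comm-^ x {a} {a′} {β} a↦ aβ)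
      go {a′} {l′} (yes a′≡k) a↦ l↦ =
        finish {z} {z ^ x} {k} {l} z∈ (Good-^ {B} {z} b z∈) kβ kz lz l∤β m l′
        (λ e → l∤β (subst (λ t → Comm t β) (maps-injective x (subst (Maps B k) e k↦m) l↦) kβ)) m≢k
        (λ e → l∤β (subst (λ t → Comm t β) (maps-injective x a↦ (subst (Maps B l) (trans e (sym a′≡k)) l↦)) aβ))
        (Comm-^ x {k} {m} {z} k↦m kz) (Comm-^ x {l} {l′} {z} l↦ lz)
    first : (∃ λ A → Σ (IsAut D A) λ a → ∃ λ k → ∃ λ l → commβ k ≡ true × commβ l ≡ false × Maps A k l) → Pair
    first (A , a , k , l , kβ , l∤β , k↦l) = meet (Fin.any? λ j → comm? j β ×-dec comm? j z)
      where
      z : Mat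
      z = β ^ elt {D} {A} a
      z∈ : Good z
      z∈ = Good-^ {A} {β} a β∈
      meet : Dec (∃ λ j → Comm j β × Comm j z) → Pair
      meet (no none) = β , z , β∈ , z∈ , λ j c → none (j , c)
      meet (yes (j , jβ , jz)) = second {z} {j} {l} {proj₁ (partner j jβ)} z∈ jβ jz
        (Comm-^ (elt {D} {A} a) {k} {l} {β} k↦l (does⁻ (comm? k β) kβ))
        (λ c → contradiction (trans (sym (dec-true (comm? l β) c)) l∤β) λ ())
        (proj₁ (proj₂ (partner j jβ))) (proj₂ (proj₂ (partner j jβ)))
        (leaves (singleton j) λ d → toWitnessFalse {a? = 10 ∣? 16} tt (subst (10 ∣_) (weight-singleton j) d))

-- Conjugating Ĝ so that it contains H₀

-- The conclusion for the conjugated design comes with its way back to `D`, so that successive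
-- conjugations compose as functions.
data Standard (D : Design 9 3) : Set where
  standard : ∀ D′ → (LinearlyIsoToD₃ D′ → LinearlyIsoToD₃ D) → Setup D′ → IsAut D′ α → IsAut D′ β → Standard D

centralisers-β : All (λ c → β ^ c ≡ β) centralisers
centralisers-β = toWitness {a? = All.all? (λ c → (β ^ c) ≟M β) centralisers} tt

-- α = β⁻¹ γ⁻¹ β⁻¹ γ⁻¹ β⁻¹
α-from : ∀ D S → IsAut D β → IsAut D γ → IsAut D α
α-from D S b g = _∙_ {β²} {γ² ⊗ (β² ⊗ (γ² ⊗ β²))} b² (_∙_ {γ²} {β² ⊗ (γ² ⊗ β²)} g²
    (_∙_ {β²} {γ² ⊗ β²} b² (_∙_ {γ²} {β²} g² b²)))
  where
  β² γ² : Mat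
  β² = β ⊗ β
  γ² = γ ⊗ γ
  _∙_ : ∀ {A B} → IsAut D A → IsAut D B → IsAut D (A ⊗ B)
  _∙_ {A} {B} = IsAut-⊗ D S {A} {B}
  b² : IsAut D (β ⊗ β)
  b² = _∙_ {β} {β} b b
  g² : IsAut D (γ ⊗ γ)
  g² = _∙_ {γ} {γ} g g

-- Three conjugations in N(R). The first makes some element of order 3 equal to `β`, as the facts on
-- pairs are tabulated relative to `β`. The second takes the first member of a disjoint pair to `β`,
-- and the third, centralising `β`, takes the other member to `γ` or its inverse.
standardise : ∀ D → Setup D → Standard D
standardise D S = move-β (cauchy₃ D S)
  where
  final : ∀ D₂ → (LinearlyIsoToD₃ D₂ → LinearlyIsoToD₃ D) → Setup D₂ → IsAut D₂ β →
    ∀ z → IsAut D₂ z → Order3 z → Disjoint β z → Standard D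
  final D₂ back S₂ b z z∈@(_ , _ , (N , _) , _) o d = go (find (proj₂ (proj₂ (Conjβ-pairFacts (order3⇒Conjβ N o))) d))
    where
    go : (∃ λ c → c ∈ centralisers × (z ^ c ≡ γ ⊎ z ^ c ≡ γ⁻¹)) → Standard D
    go (c , c∈ , e) = standard D₃ (back ∘ untransport {D₂} (inverses c)) S₃ (α-from D₃ S₃ b₃ (γ∈ e)) b₃
      where
      D₃ = transport D₂ (inverses c)
      S₃ = Setup-transport c S₂
      b₃ : IsAut D₃ β
      b₃ = subst (IsAut D₃) (All.lookup centralisers-β c∈) (IsAut-transport {D₂} c {β} b)
      zc : IsAut D₃ (z ^ c)
      zc = IsAut-transport {D₂} c {z} z∈
      γ∈ : z ^ c ≡ γ ⊎ z ^ c ≡ γ⁻¹ → IsAut D₃ γ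
      γ∈ (inj₁ e) = subst (IsAut D₃) e zc
      γ∈ (inj₂ e) = IsAut-⊗ D₃ S₃ {γ⁻¹} {γ⁻¹} (subst (IsAut D₃) e zc) (subst (IsAut D₃) e zc)
  move-pair : ∀ D₁ → (LinearlyIsoToD₃ D₁ → LinearlyIsoToD₃ D) → Setup D₁ → IsAut D₁ β → Standard D
  move-pair D₁ back S₁ b = go (G.disjoint-pair (G.good b β-order3))
    where
    module G = Generation D₁ S₁
    β-order3 : Order3 β
    β-order3 = refl , λ ()
    go : (∃ λ x → ∃ λ z → G.Good x × G.Good z × Disjoint x z) → Standard D
    go (x , z , x∈ , z∈ , d) = go′ (Conjβ-conj (G.Good⇒Conjβ x∈))
      where
      go′ : (∃ λ (t : NElt) → x ^ t ≡ β) → Standard D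
      go′ (t , e) = final (transport D₁ (inverses t)) (back ∘ untransport {D₁} (inverses t)) (Setup-transport t S₁)
        (subst (IsAut (transport D₁ (inverses t))) e (IsAut-transport {D₁} t {x} (G.Good.aut x∈)))
        (z ^ t) (IsAut-transport {D₁} t {z} (G.Good.aut z∈)) (^-order3 t {z} (G.Good.order3 z∈))
        (subst (λ y → Disjoint y (z ^ t)) e (Disjoint-^ t {x} {z} d))
  move-β : (∃ λ z → IsAut D z × Order3 z) → Standard D
  move-β (z , z∈ , o) = go (Conjβ-conj (Generation.Good⇒Conjβ D S {z} (Generation.good z∈ o)))
    where
    go : (∃ λ (t : NElt) → z ^ t ≡ β) → Standard D
    go (t , e) = move-pair (transport D (inverses t)) (untransport {D} (inverses t)) (Setup-transport t S)
      (subst (IsAut (transport D (inverses t))) e (IsAut-transport {D} t {z} z∈))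

-- Translation stabilisers

argmin : ∀ {A : Set} (f : A → ℕ) (x : A) (xs : List A) → ∃ λ y → ∀ {z} → z ∈ (x ∷ xs) → f y ≤ f z
argmin f x [] = x , λ { (here refl) → ℕ.≤-refl }
argmin f x (x′ ∷ xs) with argmin f x′ xs
... | y , h with ℕ.≤-total (f x) (f y)
... | inj₁ x≤y = x , λ { (here refl) → ℕ.≤-refl ; (there z∈) → ℕ.≤-trans x≤y (h z∈) }
... | inj₂ y≤x = y , λ { (here refl) → y≤x ; (there z∈) → h z∈ }

wordMats : List Mat
wordMats = map (mat ∘ word) words

-- The value 1 at every w says that 0 and the two families of images partition V, so that a sum over
-- V splits along the orbits.
covers : List Mat → V → ℕ
covers As w = ⟦ does (𝟎 ≟V w) ⟧ +
  (∑ As (λ A → ⟦ does ((v₁ · A) ≟V w) ⟧) + ∑ As (λ A → ⟦ does ((v₂ · A) ≟V w) ⟧))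

covers-once : All (λ w → covers wordMats w ≡ 1) (allVec 4)
covers-once = toWitness {a? = once? wordMats} tt
  where
  once? : ∀ As → Dec (All (λ w → covers As w ≡ 1) (allVec 4))
  once? As = All.all? (λ w → covers As w ℕ.≟ 1) (allVec 4)

∑V-covers : ∀ As → (∀ w → covers As w ≡ 1) → ∀ f →
  ∑V f ≡ f 𝟎 + (∑ As (λ A → f (v₁ · A)) + ∑ As (λ A → f (v₂ · A)))
∑V-covers As once f = begin
  ∑V f
    ≡⟨ ∑-cong allV (λ w → trans (sym (ℕ.*-identityˡ (f w))) (cong (_* f w) (sym (once w)))) ⟩
  ∑V (λ w → covers As w * f w)
    ≡⟨ ∑-cong allV (λ w → trans (ℕ.*-distribʳ-+ (f w) (δ 𝟎 w) _) (cong (δ 𝟎 w * f w +_)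
         (trans (ℕ.*-distribʳ-+ (f w) (∑ As (λ A → δ (v₁ · A) w)) _)
           (cong₂ _+_ (sym (∑-*ʳ (f w) As _)) (sym (∑-*ʳ (f w) As _)))))) ⟩
  ∑V (λ w → δ 𝟎 w * f w + (∑ As (λ A → δ (v₁ · A) w * f w) + ∑ As (λ A → δ (v₂ · A) w * f w)))
    ≡⟨ trans (∑-+ allV _ _) (cong₂ _+_ (δ-sum 𝟎) (trans (∑-+ allV _ _) (cong₂ _+_ (orbit v₁) (orbit v₂)))) ⟩
  f 𝟎 + (∑ As (λ A → f (v₁ · A)) + ∑ As (λ A → f (v₂ · A))) ∎
  where
  δ : V → V → ℕ
  δ a w = ⟦ does (a ≟V w) ⟧
  δ-sum : ∀ a → ∑V (λ w → δ a w * f w) ≡ f a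
  δ-sum a = trans (∑-cong allV λ w → cong (λ b → ⟦ b ⟧ * f w) (does-cong (a ≟V w) (w ≟V a) sym sym)) (FV.∑-δ a f)
  orbit : ∀ v → ∑V (λ w → ∑ As (λ A → δ (v · A) w * f w)) ≡ ∑ As (λ A → f (v · A))
  orbit v = trans (∑-swap allV As _) (∑-cong As λ A → δ-sum (v · A))

∑-words-const : ∀ us (f : Mat → ℕ) c → (∀ u → f (mat (word u)) ≡ c) →
  ∑ (map (λ u → mat (word u)) us) f ≡ length us * c
∑-words-const [] f c h = refl
∑-words-const (u ∷ us) f c h = cong₂ _+_ (h u) (∑-words-const us f c h)

∑V-invariant : ∀ f → (∀ u v → f (v · mat (word u)) ≡ f v) → ∑V f ≡ f 𝟎 + (40 * f v₁ + 40 * f v₂)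
∑V-invariant f h = trans (∑V-covers wordMats (λ w → All.lookup covers-once (∈-allVec w)) f)
  (cong (f 𝟎 +_) (cong₂ _+_ (∑-words-const words (λ A → f (v₁ · A)) (f v₁) (λ u → h u v₁))
                            (∑-words-const words (λ A → f (v₂ · A)) (f v₂) (λ u → h u v₂))))

40-multiple : ∀ {x} a b → 270 + x ≡ 270 + (40 * a + 40 * b) → 40 ∣ x
40-multiple a b e = divides (a + b) (trans (ℕ.+-cancelˡ-≡ 270 _ _ e)
  (trans (sym (ℕ.*-distribˡ-+ 40 a b)) (ℕ.*-comm 40 (a + b))))

81∤ : ∀ {x c} → {True (¬? (81 ∣? x))} → x ≡ c * 81 → ⊥
81∤ {x} {c} {t} e = toWitness t (divides c e)

-- The first equation forces 3 ∣ s, the second excludes 0 because its right side is positive, and 40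
-- divides neither 270 · 2 nor 270 · 5.
stabiliser-size : ∀ s c a b → s ≤ 9 → 270 * s ≡ c * 81 → 270 * s ≡ 270 + (40 * a + 40 * b) → s ≡ 9
stabiliser-size 0 c a b _ e f = case f of λ ()
stabiliser-size 1 c a b _ e f = ⊥-elim (81∤ {270} {c} e)
stabiliser-size 2 c a b _ e f = ⊥-elim (81∤ {540} {c} e)
stabiliser-size 3 c a b _ e f = ⊥-elim (toWitnessFalse {a? = 40 ∣? 540} tt (40-multiple {540} a b f))
stabiliser-size 4 c a b _ e f = ⊥-elim (81∤ {1080} {c} e)
stabiliser-size 5 c a b _ e f = ⊥-elim (81∤ {1350} {c} e)
stabiliser-size 6 c a b _ e f = ⊥-elim (toWitnessFalse {a? = 40 ∣? 1350} tt (40-multiple {1350} a b f))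
stabiliser-size 7 c a b _ e f = ⊥-elim (81∤ {1890} {c} e)
stabiliser-size 8 c a b _ e f = ⊥-elim (81∤ {2160} {c} e)
stabiliser-size 9 c a b _ e f = refl
stabiliser-size (suc (suc (suc (suc (suc (suc (suc (suc (suc (suc s)))))))))) c a b
  (s≤s (s≤s (s≤s (s≤s (s≤s (s≤s (s≤s (s≤s (s≤s ()))))))))) e f

module Translations (D : Design 9 3) (S : Setup D) where
  open Setup S
  open Counting D S

  -- Blocks are determined by their points, so the translate is unique and this is an action of the
  -- translation group.
  act : Fin n → V → Fin n
  act i t = proj₁ (translate t i)

  act-inc : ∀ i t x → incD (act i t) (x ⊕ t) ≡ incD i x
  act-inc i t = proj₂ (translate t i)

  act-unique : ∀ {i j t} → (∀ x → incD j (x ⊕ t) ≡ incD i x) → act i t ≡ j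
  act-unique {i} {j} {t} h = block-ext λ x →
    subst (λ y → incD (act i t) y ≡ incD j y) (neg-⊕-cancel x t)
      (trans (act-inc i t (x ⊕ neg t)) (sym (h (x ⊕ neg t))))

  act-⊕ : ∀ i t u → act (act i t) u ≡ act i (t ⊕ u)
  act-⊕ i t u = act-unique λ x → begin
    incD (act i (t ⊕ u)) (x ⊕ u) ≡⟨ cong (incD (act i (t ⊕ u))) (lemma x) ⟨
    incD (act i (t ⊕ u)) ((x ⊕ neg t) ⊕ (t ⊕ u)) ≡⟨ act-inc i (t ⊕ u) (x ⊕ neg t) ⟩
    incD i (x ⊕ neg t) ≡⟨ act-inc i t (x ⊕ neg t) ⟨
    incD (act i t) ((x ⊕ neg t) ⊕ t) ≡⟨ cong (incD (act i t)) (neg-⊕-cancel x t) ⟩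
    incD (act i t) x ∎
    where
    lemma : ∀ x → (x ⊕ neg t) ⊕ (t ⊕ u) ≡ x ⊕ u
    lemma x = trans (sym (⊕-assoc (x ⊕ neg t) t u)) (cong (_⊕ u) (neg-⊕-cancel x t))

  act-𝟎 : ∀ i → act i 𝟎 ≡ i
  act-𝟎 i = act-unique λ x → cong (incD i) (⊕-identityʳ x)

  act-neg : ∀ i t → act (act i t) (neg t) ≡ i
  act-neg i t = trans (act-⊕ i t (neg t)) (trans (cong (act i) (⊕-inverseʳ t)) (act-𝟎 i))

  act-neg′ : ∀ i t → act (act i (neg t)) t ≡ i
  act-neg′ i t = trans (act-⊕ i (neg t) t)
    (trans (cong (act i) (trans (⊕-comm (neg t) t) (⊕-inverseʳ t))) (act-𝟎 i))

  act-comm : ∀ i t u → act (act i t) u ≡ act (act i u) t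
  act-comm i t u = trans (act-⊕ i t u) (trans (cong (act i) (⊕-comm t u)) (sym (act-⊕ i u t)))

  act-injective : ∀ {i j} t → act i t ≡ act j t → i ≡ j
  act-injective {i} {j} t e = trans (sym (act-neg i t)) (trans (cong (λ k → act k (neg t)) e) (act-neg j t))

  fixes : Fin n → V → Bool
  fixes i t = does (FB._≟_ (act i t) i)

  stab : Fin n → ℕ
  stab i = ∑V λ t → ⟦ fixes i t ⟧

  stab-act : ∀ i t → stab (act i t) ≡ stab i
  stab-act i t = ∑-cong allV λ u → cong ⟦_⟧ (does-cong (FB._≟_ _ _) (FB._≟_ _ _)
    (λ e → act-injective t (trans (act-comm i u t) e))
    (λ e → trans (act-comm i t u) (cong (λ k → act k t) e)))

  Linear : Mat → Fin n → Fin n → Set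
  Linear A i j = ∀ x → incD j (x · A) ≡ incD i x

  act-linear : ∀ {A A' i j} → Inverses A A' → Linear A i j → ∀ t → Linear A (act i t) (act j (t · A))
  act-linear {A} {A'} {i} {j} (_ , _) h t x = begin
    incD (act j (t · A)) (x · A)
      ≡⟨ cong (λ y → incD (act j (t · A)) (y · A)) (neg-⊕-cancel x t) ⟨
    incD (act j (t · A)) (((x ⊕ neg t) ⊕ t) · A)
      ≡⟨ cong (incD (act j (t · A))) (vecMat-⊕ (x ⊕ neg t) t A) ⟩
    incD (act j (t · A)) (((x ⊕ neg t) · A) ⊕ (t · A))
      ≡⟨ act-inc j (t · A) ((x ⊕ neg t) · A) ⟩
    incD j ((x ⊕ neg t) · A)
      ≡⟨ h (x ⊕ neg t) ⟩
    incD i (x ⊕ neg t)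
      ≡⟨ act-inc i t (x ⊕ neg t) ⟨
    incD (act i t) ((x ⊕ neg t) ⊕ t)
      ≡⟨ cong (incD (act i t)) (neg-⊕-cancel x t) ⟩
    incD (act i t) x ∎

  linear-≡ : ∀ {A A' i j i′ j′} → Inverses A A' → Linear A i j → Linear A i′ j′ → i ≡ i′ → j ≡ j′
  linear-≡ {A} {A'} {i} {j} {_} {j′} (_ , A'A) h h′ refl = block-ext λ x →
    subst (λ y → incD j y ≡ incD j′ y) (cancelʳ A'A x) (trans (h (x · A')) (sym (h′ (x · A'))))

  linear-≡′ : ∀ {A i j i′ j′} → Linear A i j → Linear A i′ j′ → j ≡ j′ → i ≡ i′
  linear-≡′ h h′ refl = block-ext λ x → trans (sym (h x)) (h′ x)

  fixes-linear : ∀ {A A' i j} → Inverses A A' → Linear A i j → ∀ t → fixes j (t · A) ≡ fixes i t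
  fixes-linear {A} {A'} {i} {j} iA h t = does-cong (FB._≟_ _ _) (FB._≟_ _ _)
    (linear-≡′ {A} (act-linear {A} {A'} iA h t) h)
    (linear-≡ {A} {A'} iA (act-linear {A} {A'} iA h t) h)

  stab-linear : ∀ {A A' i j} → Inverses A A' → Linear A i j → stab j ≡ stab i
  stab-linear {A} {A'} {i} {j} iA h = trans (sym (∑V-linear iA (λ t → ⟦ fixes j t ⟧)))
    (∑-cong allV λ t → cong ⟦_⟧ (fixes-linear {A} {A'} iA h t))

  member : ∀ i → ∃ λ x → incD i x ≡ true
  member i with ∑-positive allV (λ x → ⟦ incD i x ⟧) (λ e → case trans (sym e) (block-size i) of λ ())
  ... | x , h with incD i x in e
  ... | true  = x , e
  ... | false = contradiction refl h

  to-origin : ∀ i x → incD i x ≡ true → incD (act i (neg x)) 𝟎 ≡ true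
  to-origin i x e = trans (cong (incD (act i (neg x))) (sym (⊕-inverseʳ x))) (trans (act-inc i (neg x) x) e)

  -- Each block has a translate through 0, with the same stabiliser because translations commute.
  -- Between blocks through 0 an element of Ĝ carries one stabiliser to the other.
  stab-const : ∀ i j → stab i ≡ stab j
  stab-const i j = trans (sym (stab-act i _)) (trans (sym equal) (stab-act j _))
    where
    x = proj₁ (member i)
    y = proj₁ (member j)
    equal : stab (act j (neg y)) ≡ stab (act i (neg x))
    equal = let (A , (A' , iA , _) , h) = transitive (act i (neg x)) (act j (neg y))
                  (to-origin i x (proj₂ (member i))) (to-origin j y (proj₂ (member j)))
            in stab-linear {A} {A'} iA h

  -- The translates of a block are counted through the one of least index.
  minimal : Fin n → Bool
  minimal j = does (FV.all? λ t → toℕ j ≤? toℕ (act j t))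

  -- Each translation orbit has one block of least index, and the translations taking the given
  -- block to it form a coset of the stabiliser.
  minimal-translates : ∀ i → ∑V (λ t → ⟦ minimal (act i t) ⟧) ≡ stab i
  minimal-translates i = begin
    ∑V (λ t → ⟦ minimal (act i t) ⟧)
      ≡⟨ ∑-cong allV (λ t → cong ⟦_⟧ (does-cong (FV.all? _) (FB._≟_ (act i t) least-block) (to t) (from t))) ⟩
    ∑V (λ t → ⟦ does (FB._≟_ (act i t) least-block) ⟧)
      ≡⟨ ∑V-translate t₀ (λ t → ⟦ does (FB._≟_ (act i t) least-block) ⟧) ⟨
    ∑V (λ t → ⟦ does (FB._≟_ (act i (t ⊕ t₀)) least-block) ⟧)
      ≡⟨ ∑-cong allV (λ t → cong (λ k → ⟦ does (FB._≟_ k least-block) ⟧)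
           (trans (cong (act i) (⊕-comm t t₀)) (sym (act-⊕ i t₀ t)))) ⟩
    stab least-block
      ≡⟨ stab-act i t₀ ⟩
    stab i ∎
    where
    least : ∃ λ t → ∀ {z} → z ∈ (𝟎 ∷ allV) → toℕ (act i t) ≤ toℕ (act i z)
    least = argmin (λ t → toℕ (act i t)) 𝟎 allV
    t₀ = proj₁ least
    least-block = act i t₀
    below : ∀ z → toℕ least-block ≤ toℕ (act i z)
    below z = proj₂ least (there (FV.complete z))
    to : ∀ t → (∀ u → toℕ (act i t) ≤ toℕ (act (act i t) u)) → act i t ≡ least-block
    to t h = Fin.toℕ-injective (ℕ.≤-antisym
      (subst (λ k → toℕ (act i t) ≤ toℕ k)
        (trans (act-⊕ i t _) (cong (act i) (trans (⊕-comm t _) (neg-⊕-cancel t₀ t)))) (h (t₀ ⊕ neg t)))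
      (below t))
    from : ∀ t → act i t ≡ least-block → ∀ u → toℕ (act i t) ≤ toℕ (act (act i t) u)
    from t e u = subst (λ k → toℕ k ≤ toℕ (act k u)) (sym e)
      (subst (λ k → toℕ least-block ≤ toℕ k) (sym (act-⊕ i t₀ u)) (below (t₀ ⊕ u)))

  fixed-blocks : V → ℕ
  fixed-blocks t = ∑B λ i → ⟦ fixes i t ⟧

  module _ (aα : IsAut D α) (aβ : IsAut D β) where

    IsAut-word : ∀ u → IsAut D (mat (word u))
    IsAut-word [] = IsAut-I D S
    IsAut-word (c ∷ u) = IsAut-⊗ D S {α ⊗ mat (β^ c)} {mat (word u)}
      (IsAut-⊗ D S {α} {mat (β^ c)} aα (power c)) (IsAut-word u)
      where
      power : ∀ c → IsAut D (mat (β^ c))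
      power 𝟘 = IsAut-I D S
      power 𝟙 = aβ
      power 𝟚 = IsAut-⊗ D S {β} {β} aβ aβ

    ∑B-linear : ∀ {A} → IsAut D A → (f g : Fin n → ℕ) → (∀ {i j} → Linear A i j → f j ≡ g i) → ∑B f ≡ ∑B g
    ∑B-linear {A} (A' , iA@(AA' , A'A) , _ , (p , q)) f g h = trans
      (sym (FB.∑-bij (λ i → proj₁ (p i)) (λ i → proj₁ (q i))
        (λ i → block-ext λ x → trans (cong (incD _) (sym (cancelʳ A'A x)))
          (trans (proj₂ (p (proj₁ (q i))) (x · A')) (proj₂ (q i) x)))
        (λ i → block-ext λ x → trans (cong (incD _) (sym (cancelʳ AA' x)))
          (trans (proj₂ (q (proj₁ (p i))) (x · A)) (proj₂ (p i) x))) f))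
      (∑-cong (allFin n) λ i → h (proj₂ (p i)))

    fixed-blocks-word : ∀ u v → fixed-blocks (v · mat (word u)) ≡ fixed-blocks v
    fixed-blocks-word u v = ∑B-linear {mat (word u)} (IsAut-word u) _ _ λ h →
      cong ⟦_⟧ (fixes-linear {mat (word u)} (inverses (word u)) h v)

    -- A translation by t that fixes a block through 0 takes 0 to a point of it; so the stabiliser,
    -- as a set of vectors, lies inside the block.
    stab≤9 : ∀ i → incD i 𝟎 ≡ true → ∀ t → ⟦ fixes i t ⟧ ≤ ⟦ incD i t ⟧
    stab≤9 i i∋𝟎 t = go (FB._≟_ (act i t) i)
      where
      go : (d : Dec (act i t ≡ i)) → ⟦ does d ⟧ ≤ ⟦ incD i t ⟧
      go (no _) = z≤n
      go (yes e) = ℕ.≤-reflexive (cong ⟦_⟧ (sym (trans (cong₂ incD (sym e) (sym (⊕-identityˡ t)))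
        (trans (act-inc i t 𝟎) i∋𝟎))))

    -- The pairs of a block and a translation fixing it are counted by blocks, by translation orbits
    -- of blocks, and by translations. In the last count the zero translation fixes all 270 blocks,
    -- and the others contribute equally along each orbit of H₀.
    stab≡9 : ∀ i → incD i 𝟎 ≡ true → stab i ≡ 9
    stab≡9 i i∋𝟎 = stabiliser-size (stab i) (∑B (λ j → ⟦ minimal j ⟧)) (fixed-blocks v₁) (fixed-blocks v₂)
      (ℕ.≤-trans (∑-mono allV (stab≤9 i i∋𝟎)) (ℕ.≤-reflexive (block-size i))) translates orbits′
      where
      total : ∑B stab ≡ 270 * stab i
      total = trans (∑-cong (allFin n) λ j → stab-const j i) (trans (∑B-const (stab i)) (cong (_* stab i) {n} {270} nblocks≡270))
      translates : 270 * stab i ≡ ∑B (λ j → ⟦ minimal j ⟧) * 81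
      translates = begin
        270 * stab i
          ≡⟨ total ⟨
        ∑B stab
          ≡⟨ ∑-cong (allFin n) minimal-translates ⟨
        ∑B (λ j → ∑V λ t → ⟦ minimal (act j t) ⟧)
          ≡⟨ ∑-swap (allFin n) allV _ ⟩
        ∑V (λ t → ∑B λ j → ⟦ minimal (act j t) ⟧)
          ≡⟨ ∑-cong allV (λ t → FB.∑-bij (λ j → act j t) (λ j → act j (neg t))
               (λ j → act-neg′ j t) (λ j → act-neg j t) (λ j → ⟦ minimal j ⟧)) ⟩
        ∑V (λ t → ∑B λ j → ⟦ minimal j ⟧)
          ≡⟨ ∑-const _ allV ⟩
        length allV * ∑B (λ j → ⟦ minimal j ⟧)
          ≡⟨ trans (cong (_* ∑B (λ j → ⟦ minimal j ⟧)) {length allV} {81} length-allV) (ℕ.*-comm 81 (∑B (λ j → ⟦ minimal j ⟧))) ⟩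
        ∑B (λ j → ⟦ minimal j ⟧) * 81 ∎
      fixed-𝟎 : fixed-blocks 𝟎 ≡ 270
      fixed-𝟎 = trans (∑-cong (allFin n) λ j → cong ⟦_⟧ (dec-true (FB._≟_ (act j 𝟎) j) (act-𝟎 j)))
        (trans (∑B-const 1) (trans (ℕ.*-identityʳ n) nblocks≡270))
      orbits′ : 270 * stab i ≡ 270 + (40 * fixed-blocks v₁ + 40 * fixed-blocks v₂)
      orbits′ = begin
        270 * stab i ≡⟨ total ⟨
        ∑B stab ≡⟨ ∑-swap (allFin n) allV _ ⟩
        ∑V fixed-blocks ≡⟨ ∑V-invariant fixed-blocks fixed-blocks-word ⟩
        fixed-blocks 𝟎 + (40 * fixed-blocks v₁ + 40 * fixed-blocks v₂)
          ≡⟨ cong (_+ (40 * fixed-blocks v₁ + 40 * fixed-blocks v₂)) {fixed-blocks 𝟎} {270} fixed-𝟎 ⟩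
        270 + (40 * fixed-blocks v₁ + 40 * fixed-blocks v₂) ∎

    -- The stabiliser lies inside the block and also has nine elements, so the two coincide and
    -- translation by a vector of the block preserves the block.
    subspace : ∀ i → incD i 𝟎 ≡ true → ∀ t → incD i t ≡ true → ∀ x → incD i (x ⊕ t) ≡ incD i x
    subspace i i∋𝟎 t i∋t x = trans (cong (λ k → incD k (x ⊕ t)) (sym t-fixes)) (act-inc i t x)
      where
      agree : ⟦ fixes i t ⟧ ≡ 1
      agree = trans (FV.∑-all (stab≤9 i i∋𝟎) (trans (stab≡9 i i∋𝟎) (sym (block-size i))) t) (cong ⟦_⟧ i∋t)
      t-fixes : act i t ≡ i
      t-fixes = go (FB._≟_ (act i t) i) agree
        where
        go : (d : Dec (act i t ≡ i)) → ⟦ does d ⟧ ≡ 1 → act i t ≡ i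
        go (yes e) _ = e

-- Lines of PG(3, 3)

record Spans (v u x : V) : Set where
  constructor spanned
  field
    coeff₁ coeff₂ : F3
    combination   : x ≡ scale coeff₁ v ⊕ scale coeff₂ u

spans? : ∀ v u x → Dec (Spans v u x)
spans? v u x = map′ (λ (a , b , e) → spanned a b e) (λ (spanned a b e) → a , b , e)
  (Finite.any? F3-finite λ a → Finite.any? F3-finite λ b → x ≟V (scale a v ⊕ scale b u))

Spans-· : ∀ {v u x} A → Spans v u x → Spans (v · A) (u · A) (x · A)
Spans-· {v} {u} A (spanned a b e) = spanned a b (trans (cong (_· A) e)
  (trans (vecMat-⊕ (scale a v) (scale b u) A) (cong₂ _⊕_ (vecMat-scale a v A) (vecMat-scale b u A))))

-- (u , w , o) says that w maps the line ⟨v , u⟩ to the o-th representative of the nine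
-- orbits of ⟨α, β⟩ on the 130 lines; orbits 0 and 1 have length 30, orbits 2 and 3 consist
-- of the eigenspaces of the involutions ±f.
Row : Set
Row = V × List F3 × Fin 9

point : Row → V
point = proj₁

to-representative : Row → Mat
to-representative (_ , w , _) = mat (word w)

orbit : Row → Fin 9
orbit (_ , _ , o) = o

rows₁ : List Row
rows₁ =
  (⟨ 𝟘 , 𝟘 , 𝟙 , 𝟙 ⟩ , (𝟙 ∷ 𝟚 ∷ 𝟚 ∷ []) , # 0) ∷
  (⟨ 𝟘 , 𝟘 , 𝟙 , 𝟚 ⟩ , (𝟙 ∷ 𝟙 ∷ 𝟚 ∷ 𝟙 ∷ []) , # 0) ∷
  (⟨ 𝟘 , 𝟘 , 𝟙 , 𝟘 ⟩ , (𝟚 ∷ 𝟚 ∷ 𝟙 ∷ 𝟚 ∷ []) , # 0) ∷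
  (⟨ 𝟙 , 𝟘 , 𝟚 , 𝟚 ⟩ , [] , # 1) ∷
  (⟨ 𝟙 , 𝟘 , 𝟚 , 𝟙 ⟩ , (𝟘 ∷ 𝟚 ∷ []) , # 1) ∷
  (⟨ 𝟙 , 𝟘 , 𝟚 , 𝟘 ⟩ , (𝟘 ∷ 𝟙 ∷ []) , # 1) ∷
  (⟨ 𝟙 , 𝟘 , 𝟘 , 𝟙 ⟩ , [] , # 2) ∷
  (⟨ 𝟙 , 𝟘 , 𝟙 , 𝟚 ⟩ , [] , # 4) ∷
  (⟨ 𝟙 , 𝟘 , 𝟙 , 𝟙 ⟩ , (𝟘 ∷ 𝟙 ∷ []) , # 4) ∷
  (⟨ 𝟙 , 𝟘 , 𝟙 , 𝟘 ⟩ , (𝟘 ∷ 𝟚 ∷ []) , # 4) ∷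
  (⟨ 𝟘 , 𝟘 , 𝟘 , 𝟙 ⟩ , [] , # 6) ∷
  (⟨ 𝟙 , 𝟘 , 𝟘 , 𝟘 ⟩ , [] , # 7) ∷
  (⟨ 𝟙 , 𝟘 , 𝟘 , 𝟚 ⟩ , [] , # 8) ∷
  []

rows₂ : List Row
rows₂ =
  (⟨ 𝟙 , 𝟙 , 𝟘 , 𝟘 ⟩ , (𝟘 ∷ 𝟚 ∷ []) , # 0) ∷
  (⟨ 𝟙 , 𝟚 , 𝟘 , 𝟘 ⟩ , (𝟘 ∷ 𝟙 ∷ []) , # 0) ∷
  (⟨ 𝟙 , 𝟘 , 𝟘 , 𝟘 ⟩ , [] , # 0) ∷
  (⟨ 𝟙 , 𝟚 , 𝟙 , 𝟘 ⟩ , (𝟙 ∷ 𝟙 ∷ []) , # 1) ∷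
  (⟨ 𝟙 , 𝟙 , 𝟙 , 𝟘 ⟩ , (𝟚 ∷ 𝟚 ∷ []) , # 1) ∷
  (⟨ 𝟙 , 𝟘 , 𝟙 , 𝟘 ⟩ , (𝟘 ∷ 𝟙 ∷ 𝟚 ∷ 𝟚 ∷ []) , # 1) ∷
  (⟨ 𝟘 , 𝟙 , 𝟙 , 𝟘 ⟩ , [] , # 3) ∷
  (⟨ 𝟘 , 𝟘 , 𝟙 , 𝟘 ⟩ , (𝟙 ∷ 𝟚 ∷ 𝟙 ∷ 𝟘 ∷ []) , # 4) ∷
  (⟨ 𝟘 , 𝟙 , 𝟚 , 𝟘 ⟩ , [] , # 5) ∷
  (⟨ 𝟘 , 𝟙 , 𝟘 , 𝟘 ⟩ , [] , # 6) ∷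
  (⟨ 𝟙 , 𝟘 , 𝟚 , 𝟘 ⟩ , (𝟘 ∷ []) , # 7) ∷
  (⟨ 𝟙 , 𝟚 , 𝟚 , 𝟘 ⟩ , (𝟘 ∷ 𝟙 ∷ 𝟘 ∷ []) , # 7) ∷
  (⟨ 𝟙 , 𝟙 , 𝟚 , 𝟘 ⟩ , (𝟘 ∷ 𝟚 ∷ 𝟘 ∷ []) , # 7) ∷
  []

representative : Fin 9 → V × V
representative = Vec.lookup (
  (⟨ 𝟙 , 𝟘 , 𝟘 , 𝟘 ⟩ , ⟨ 𝟘 , 𝟘 , 𝟘 , 𝟙 ⟩) ∷
  (⟨ 𝟚 , 𝟘 , 𝟙 , 𝟙 ⟩ , ⟨ 𝟘 , 𝟙 , 𝟘 , 𝟘 ⟩) ∷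
  (⟨ 𝟘 , 𝟙 , 𝟘 , 𝟘 ⟩ , ⟨ 𝟙 , 𝟘 , 𝟘 , 𝟙 ⟩) ∷
  (⟨ 𝟘 , 𝟘 , 𝟘 , 𝟙 ⟩ , ⟨ 𝟘 , 𝟙 , 𝟙 , 𝟘 ⟩) ∷
  (⟨ 𝟘 , 𝟙 , 𝟘 , 𝟘 ⟩ , ⟨ 𝟙 , 𝟘 , 𝟙 , 𝟚 ⟩) ∷
  (⟨ 𝟘 , 𝟘 , 𝟘 , 𝟙 ⟩ , ⟨ 𝟘 , 𝟙 , 𝟚 , 𝟘 ⟩) ∷
  (⟨ 𝟘 , 𝟙 , 𝟘 , 𝟘 ⟩ , ⟨ 𝟘 , 𝟘 , 𝟘 , 𝟙 ⟩) ∷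
  (⟨ 𝟘 , 𝟙 , 𝟘 , 𝟘 ⟩ , ⟨ 𝟙 , 𝟘 , 𝟘 , 𝟘 ⟩) ∷
  (⟨ 𝟘 , 𝟙 , 𝟘 , 𝟘 ⟩ , ⟨ 𝟙 , 𝟘 , 𝟘 , 𝟚 ⟩) ∷
  [])

SpanSize : V → V → Set
SpanSize v u = ∑ (allVec 4) (λ x → ⟦ does (spans? v u x) ⟧) ≡ 9

record SameSpan (v u p q : V) : Set where
  constructor same-span
  field
    p∈ : Spans v u p
    q∈ : Spans v u q
    v∈ : Spans p q v
    u∈ : Spans p q u

sameSpan? : ∀ v u p q → Dec (SameSpan v u p q)
sameSpan? v u p q = map′ (λ (a , b , c , d) → same-span a b c d) (λ (same-span a b c d) → a , b , c , d)
  (spans? v u p ×-dec spans? v u q ×-dec spans? p q v ×-dec spans? p q u)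

rep₁ rep₂ : Fin 9 → V
rep₁ o = proj₁ (representative o)
rep₂ o = proj₂ (representative o)

-- `Spans v 𝟎` is the point ⟨v⟩ of PG(3, 3). Any x off it determines a line through v, which has to
-- contain a listed point.
Hits : V → List Row → Set
Hits v T = All (λ x → Spans v 𝟎 x ⊎ Any (λ r → Spans v x (point r)) T) (allVec 4)

hits? : ∀ v T → Dec (Hits v T)
hits? v T = All.all? (λ x → spans? v 𝟎 x ⊎-dec Any.any? (λ r → spans? v x (point r)) T) (allVec 4)

-- The middle condition says that the line of a row contains no listed point other than its own, so
-- that distinct rows give distinct lines.
Valid : V → List Row → Row → Set
Valid v T r = SpanSize v (point r) ×
  ∑ T (λ r′ → ⟦ does (spans? v (point r) (point r′)) ⟧) ≡ 1 ×
  SameSpan (v · to-representative r) (point r · to-representative r) (rep₁ (orbit r)) (rep₂ (orbit r))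

valid? : ∀ v T → Dec (All (Valid v T) T)
valid? v T = All.all? (λ r → (_ ℕ.≟ 9) ×-dec (_ ℕ.≟ 1) ×-dec sameSpan? _ _ _ _) T

record LineTable (v : V) (T : List Row) : Set where
  field
    hits     : Hits v T
    valid    : All (Valid v T) T
    nonzero  : v ≢ 𝟎
    multiple : ∑ (allVec 4) (λ x → ⟦ does (spans? v 𝟎 x) ⟧) ≡ 3

table₁ : LineTable v₁ rows₁
table₁ = record { hits = toWitness {a? = hits? v₁ rows₁} tt ; valid = toWitness {a? = valid? v₁ rows₁} tt
  ; nonzero = λ () ; multiple = refl }

table₂ : LineTable v₂ rows₂
table₂ = record { hits = toWitness {a? = hits? v₂ rows₂} tt ; valid = toWitness {a? = valid? v₂ rows₂} tt
  ; nonzero = λ () ; multiple = refl }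

representative-size : ∀ o → SpanSize (rep₁ o) (rep₂ o)
representative-size = toWitness {a? = Fin.all? λ o → _ ℕ.≟ 9} tt

Bool-finite : Finite Bool
Bool-finite = record { elems = false ∷ true ∷ [] ; _≟_ = Bool._≟_ ; once = λ { false → refl ; true → refl } }

only : Fin 9 → Vec Bool 9
only o = Vec.tabulate λ o′ → does (o′ Fin.≟ o)

-- Every point is on exactly three of the lines, which leaves the two orbits of length 30
-- once the eigenspaces are excluded.
OrbitChoice : Vec Bool 9 → Set
OrbitChoice b = ∑ rows₁ (λ r → ⟦ Vec.lookup b (orbit r) ⟧) ≡ 3 → ∑ rows₂ (λ r → ⟦ Vec.lookup b (orbit r) ⟧) ≡ 3 →
  Vec.lookup b (# 2) ≡ false → Vec.lookup b (# 3) ≡ false → b ≡ only (# 0) ⊎ b ≡ only (# 1)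

-- Orbits 0 and 1 have three lines on either point, so each excludes everything else. Without them
-- the two equations leave only the selections {3, 4, 5}, {2, 7, 8} and {2, 3, 5, 6, 8}, each
-- containing orbit 2 or orbit 3.
orbit-choice : ∀ b → OrbitChoice b
orbit-choice = toWitness {a? = Finite.all? (Vec-finite Bool-finite 9) λ b →
  (_ ℕ.≟ 3) →-dec ((_ ℕ.≟ 3) →-dec ((_ Bool.≟ false) →-dec ((_ Bool.≟ false) →-dec
    (Vecₚ.≡-dec Bool._≟_ b (only (# 0)) ⊎-dec Vecₚ.≡-dec Bool._≟_ b (only (# 1))))))} tt

∑-unique : ∀ {A : Set} (F : Finite A) (p : A → Bool) → (∀ {x y} → p x ≡ true → p y ≡ true → x ≡ y) →
  ∑ (Finite.elems F) (λ x → ⟦ p x ⟧) ≤ 1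
∑-unique F p h = go (Finite.any? F λ x → p x Bool.≟ true)
  where
  open Finite F
  go : Dec (∃ λ x → p x ≡ true) → ∑ elems (λ x → ⟦ p x ⟧) ≤ 1
  go (no none) = ℕ.≤-trans (∑-mono elems (λ x → ℕ.≤-reflexive (zero-at x (p x) refl)))
    (ℕ.≤-trans (ℕ.≤-reflexive (∑-0 elems)) z≤n)
    where
    zero-at : ∀ x b → p x ≡ b → ⟦ p x ⟧ ≡ 0
    zero-at x true  e = contradiction (x , e) none
    zero-at x false e = cong ⟦_⟧ e
  go (yes (y , py)) = ℕ.≤-trans (∑-mono elems λ x → at x (p x) refl) (ℕ.≤-reflexive (once y))
    where
    at : ∀ x b → p x ≡ b → ⟦ p x ⟧ ≤ ⟦ does (x ≟ y) ⟧
    at x false e = ℕ.≤-trans (ℕ.≤-reflexive (cong ⟦_⟧ e)) z≤n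
    at x true  e = ℕ.≤-reflexive (cong ⟦_⟧ (trans e (sym (dec-true (x ≟ y) (h e py)))))

∧-true : ∀ {a b} → a ∧ b ≡ true → a ≡ true × b ≡ true
∧-true {true} {true} _ = refl , refl

true-iff : ∀ {a b} → (a ≡ true → b ≡ true) → (b ≡ true → a ≡ true) → a ≡ b
true-iff {true}  {b} f g = sym (f refl)
true-iff {false} {false} f g = refl
true-iff {false} {true} f g = g refl

-- Which orbits of lines consist of blocks

module Lines (D : Design 9 3) (S : Setup D) (aα : IsAut D α) (aβ : IsAut D β) where
  open Setup S
  open Counting D S
  open Translations D S

  closed : ∀ i → incD i 𝟎 ≡ true → ∀ {v u x} → incD i v ≡ true → incD i u ≡ true → Spans v u x → incD i x ≡ true
  closed i i∋𝟎 {v} {u} iv iu (spanned a b e) = trans (cong (incD i) e) (sum (multiple a iv) (multiple b iu))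
    where
    sum : ∀ {x y} → incD i x ≡ true → incD i y ≡ true → incD i (x ⊕ y) ≡ true
    sum {x} {y} p q = trans (subspace aα aβ i i∋𝟎 y q x) p
    multiple : ∀ a {x} → incD i x ≡ true → incD i (scale a x) ≡ true
    multiple 𝟘 {x} p = trans (cong (incD i) (scale-𝟘 x)) i∋𝟎
    multiple 𝟙 {x} p = trans (cong (incD i) (scale-𝟙 x)) p
    multiple 𝟚 {x} p = trans (cong (incD i) (trans (scale-+₃ 𝟙 𝟙 x) (cong₂ _⊕_ (scale-𝟙 x) (scale-𝟙 x)))) (sum p p)

  is-span : ∀ i → incD i 𝟎 ≡ true → ∀ {v u} → SpanSize v u → incD i v ≡ true → incD i u ≡ true →
    ∀ x → does (spans? v u x) ≡ incD i x
  is-span i i∋𝟎 {v} {u} size iv iu x = ⟦⟧-injective _ _ (FV.∑-all below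
    (trans (trans (∑V≡∑-allVec (λ x → ⟦ does (spans? v u x) ⟧)) size) (sym (block-size i))) x)
    where
    ⟦⟧-injective : ∀ a b → ⟦ a ⟧ ≡ ⟦ b ⟧ → a ≡ b
    ⟦⟧-injective true true _ = refl
    ⟦⟧-injective false false _ = refl
    below : ∀ x → ⟦ does (spans? v u x) ⟧ ≤ ⟦ incD i x ⟧
    below x = go (does (spans? v u x)) refl
      where
      go : ∀ b → does (spans? v u x) ≡ b → ⟦ b ⟧ ≤ ⟦ incD i x ⟧
      go false _ = z≤n
      go true e = ℕ.≤-reflexive (cong ⟦_⟧ (sym (closed i i∋𝟎 iv iu (does⁻ (spans? v u x) e))))

  escape : ∀ i (P : V → Bool) → ∑V (λ x → ⟦ P x ⟧) < 9 → ∃ λ x → incD i x ≡ true × P x ≡ false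
  escape i P small = go (FV.any? λ x → (incD i x Bool.≟ true) ×-dec (P x Bool.≟ false))
    where
    go : Dec (∃ λ x → incD i x ≡ true × P x ≡ false) → ∃ λ x → incD i x ≡ true × P x ≡ false
    go (yes found) = found
    go (no none) = contradiction (ℕ.≤-trans (ℕ.≤-reflexive (sym (block-size i))) (∑-mono allV below)) (ℕ.<⇒≱ small)
      where
      below : ∀ x → ⟦ incD i x ⟧ ≤ ⟦ P x ⟧
      below x = go′ (incD i x) (P x) refl refl
        where
        go′ : ∀ a b → incD i x ≡ a → P x ≡ b → ⟦ a ⟧ ≤ ⟦ b ⟧
        go′ false b _ _ = z≤n
        go′ true true _ _ = s≤s z≤n
        go′ true false p q = contradiction (x , p , q) none

  onLine : V → V → Fin n → Bool
  onLine v u i = incD i 𝟎 ∧ (incD i v ∧ incD i u)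

  through : V → V → ℕ
  through v u = ∑B λ i → ⟦ onLine v u i ⟧

  onLine⁻ : ∀ {v u i} → onLine v u i ≡ true → incD i 𝟎 ≡ true × incD i v ≡ true × incD i u ≡ true
  onLine⁻ e = let (p , q) = ∧-true e in p , ∧-true q

  onLine⁺ : ∀ {v u i} → incD i 𝟎 ≡ true → incD i v ≡ true → incD i u ≡ true → onLine v u i ≡ true
  onLine⁺ p q r = cong₂ _∧_ p (cong₂ _∧_ q r)

  through≤1 : ∀ {v u} → SpanSize v u → through v u ≤ 1
  through≤1 {v} {u} size = ∑-unique (Fin-finite n) (onLine v u) λ {i} {j} p q →
    let (i∋𝟎 , iv , iu) = onLine⁻ p ; (j∋𝟎 , jv , ju) = onLine⁻ q
    in block-ext λ x → trans (sym (is-span i i∋𝟎 size iv iu x)) (is-span j j∋𝟎 size jv ju x)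

  through-SameSpan : ∀ {v u p q} → SameSpan v u p q → through v u ≡ through p q
  through-SameSpan {v} {u} {p} {q} (same-span p∈ q∈ v∈ u∈) = ∑-cong (allFin n) λ i → cong ⟦_⟧ (true-iff
    (λ e → let (i∋𝟎 , iv , iu) = onLine⁻ e in onLine⁺ i∋𝟎 (closed i i∋𝟎 iv iu p∈) (closed i i∋𝟎 iv iu q∈))
    (λ e → let (i∋𝟎 , ip , iq) = onLine⁻ e in onLine⁺ i∋𝟎 (closed i i∋𝟎 ip iq v∈) (closed i i∋𝟎 ip iq u∈)))

  through-word : ∀ w v u → through (v · mat (word w)) (u · mat (word w)) ≡ through v u
  through-word w v u = ∑B-linear aα aβ {mat (word w)} (IsAut-word aα aβ w) _ _ λ {i} {j} h →
    cong ⟦_⟧ (cong₂ _∧_ (trans (cong (incD j) (sym (vecMat-𝟎 (mat (word w))))) (h 𝟎)) (cong₂ _∧_ (h v) (h u)))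

  through-orbit : Fin 9 → ℕ
  through-orbit o = through (rep₁ o) (rep₂ o)

  through-orbit≤1 : ∀ o → through-orbit o ≤ 1
  through-orbit≤1 o = through≤1 (representative-size o)

  -- H₀ permutes the blocks, so an orbit of lines consists of blocks or contains none, and its
  -- representative tells which.
  choices : Vec Bool 9
  choices = Vec.tabulate λ o → does (through-orbit o ℕ.≟ 1)

  choices-orbit : ∀ o → ⟦ Vec.lookup choices o ⟧ ≡ through-orbit o
  choices-orbit o = trans (cong ⟦_⟧ (Vecₚ.lookup∘tabulate (λ o → does (through-orbit o ℕ.≟ 1)) o))
    (go (through-orbit o) (through-orbit≤1 o))
    where
    go : ∀ m → m ≤ 1 → ⟦ does (m ℕ.≟ 1) ⟧ ≡ m
    go 0 _ = refl
    go 1 _ = refl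
    go (suc (suc m)) (s≤s ())

  module Through {v : V} {T : List Row} (t : LineTable v T) where
    open LineTable t

    one-row : ∀ i → incD i 𝟎 ≡ true → incD i v ≡ true →
      ∃ λ r → r ∈ T × incD i (point r) ≡ true
    one-row i i∋𝟎 iv = let (x , ix , x∉) = escape i (λ x → does (spans? v 𝟎 x)) small in
      [ (λ s → contradiction (trans (sym x∉) (dec-true (spans? v 𝟎 x) s)) λ ())
      , (λ hit → let (r , r∈ , s) = find hit in r , r∈ , closed i i∋𝟎 iv ix s)
      ]′ (All.lookup hits (∈-allVec x))
      where
      small : ∑V (λ x → ⟦ does (spans? v 𝟎 x) ⟧) < 9
      small = subst (_< 9) (sym (trans (∑V≡∑-allVec (λ x → ⟦ does (spans? v 𝟎 x) ⟧)) multiple))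
        (s≤s (s≤s (s≤s (s≤s z≤n))))

    rows-in-block : ∀ i → incD i 𝟎 ≡ true → incD i v ≡ true → ∑ T (λ r → ⟦ incD i (point r) ⟧) ≡ 1
    rows-in-block i i∋𝟎 iv = let (r , r∈ , ir) = one-row i i∋𝟎 iv
                                 (size , once , _) = All.lookup valid r∈ in
      trans (∑-cong T λ r′ → cong ⟦_⟧ (sym (is-span i i∋𝟎 size iv ir (point r′)))) once

    -- There are λ = 3 blocks on 0 and v, and each of them, being a line, contains exactly one
    -- listed point.
    ∑-through : ∑ T (λ r → through v (point r)) ≡ 3
    ∑-through = begin
      ∑ T (λ r → ∑B λ i → ⟦ incD i 𝟎 ∧ (incD i v ∧ incD i (point r)) ⟧)
        ≡⟨ ∑-swap T (allFin n) _ ⟩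
      ∑B (λ i → ∑ T λ r → ⟦ incD i 𝟎 ∧ (incD i v ∧ incD i (point r)) ⟧)
        ≡⟨ ∑-cong (allFin n) (λ i → step i (incD i 𝟎) (incD i v) refl refl) ⟩
      ∑B (λ i → ⟦ incD i 𝟎 ∧ incD i v ⟧)
        ≡⟨ pair-count (λ e → nonzero (sym e)) ⟩
      3 ∎
      where
      step : ∀ i a b → incD i 𝟎 ≡ a → incD i v ≡ b →
        ∑ T (λ r → ⟦ incD i 𝟎 ∧ (incD i v ∧ incD i (point r)) ⟧) ≡ ⟦ incD i 𝟎 ∧ incD i v ⟧
      step i false b p q rewrite p = ∑-0 T
      step i true false p q rewrite p | q = ∑-0 T
      step i true true p q = trans (∑-cong T λ r → cong ⟦_⟧ (cong₂ _∧_ p (cong (_∧ incD i (point r)) q)))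
        (trans (rows-in-block i p q) (sym (cong ⟦_⟧ (cong₂ _∧_ p q))))

    through-row : ∀ {r} → r ∈ T → through v (point r) ≡ through-orbit (orbit r)
    through-row {r} r∈ = let (_ , _ , same) = All.lookup valid r∈ in
      trans (sym (through-word (proj₁ (proj₂ r)) v (point r))) (through-SameSpan same)

    ∑-∈-cong : ∀ (f g : Row → ℕ) T′ → (∀ {r} → r ∈ T′ → f r ≡ g r) → ∑ T′ f ≡ ∑ T′ g
    ∑-∈-cong f g [] h = refl
    ∑-∈-cong f g (r ∷ T′) h = cong₂ _+_ (h (here refl)) (∑-∈-cong f g T′ (h ∘ there))

    ∑-choices : ∑ T (λ r → ⟦ Vec.lookup choices (orbit r) ⟧) ≡ 3
    ∑-choices = trans (∑-∈-cong _ _ T λ {r} r∈ → trans (choices-orbit (orbit r)) (sym (through-row r∈))) ∑-through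

  module T₁ = Through table₁
  module T₂ = Through table₂

  FixedBy : Mat → Fin n → Set
  FixedBy Y i = ∀ x → incD i x ≡ true → x · Y ≡ x

  Isotropic : Fin n → Set
  Isotropic i = ∃ λ Y → ∃ λ k → IsInvolution Y k × FixedBy Y i

  -- Ĝ is transitive on the blocks through 0 and permutes the ten involutions.
  fixed-transport : ∀ {i} → incD i 𝟎 ≡ true → Isotropic i → ∀ j → incD j 𝟎 ≡ true → Isotropic j
  fixed-transport {i} i∋𝟎 (Y , k , inv-Y , fix) j j∋𝟎 =
    let (A , a , h) = transitive i j i∋𝟎 j∋𝟎 in go a h (maps (elt {D} {A} a) k)
    where
    go : ∀ {A} → IsAut D A → Linear A i j → ∃ (Maps A k) → Isotropic j
    go {A} (A' , (AA' , A'A) , _) h (l , maps-by Z e inv-Z) = let (W , inv-W , f) = image inv-Y in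
      W , l , inv-W , λ x jx → let y = x · A' in begin
        x · W ≡⟨ cong (_· W) (cancelʳ A'A x) ⟨
        y · A · W ≡⟨ ·-⊗ y A W ⟨
        y · (A ⊗ W) ≡⟨ cong (y ·_) f ⟨
        y · (Y ⊗ A) ≡⟨ ·-⊗ y Y A ⟩
        y · Y · A ≡⟨ cong (_· A) (fix y (trans (sym (h y)) (trans (cong (incD j) (cancelʳ A'A x)) jx))) ⟩
        y · A ≡⟨ cancelʳ A'A x ⟩
        x ∎
      where
      negate : IsInvolution Z l → IsInvolution (negM Z) l
      negate (inj₁ p) = inj₂ (cong negM p)
      negate (inj₂ p) = inj₁ (trans (cong negM p) (negM-involutive (fs l)))
      image : IsInvolution Y k → ∃ λ W → IsInvolution W l × Y ⊗ A ≡ A ⊗ W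
      image (inj₁ p) = Z , inv-Z , trans (cong (_⊗ A) p) e
      image (inj₂ p) = negM Z , negate inv-Z ,
        trans (cong (_⊗ A) p) (trans (negM-⊗ (fs k) A) (trans (cong negM e) (sym (⊗-negM A Z))))

  -- Otherwise every block through 0 is fixed pointwise by one of the ten involutions. Of these only
  -- `f₀` fixes `v₁`, so all three blocks on 0 and `v₁` would be the same line, the eigenspace of
  -- `f₀`.
  no-isotropic : ∀ {i} → incD i 𝟎 ≡ true → ¬ Isotropic i
  no-isotropic i∋𝟎 iso = contradiction
    (ℕ.≤-trans (ℕ.≤-reflexive (sym T₁.∑-through)) (ℕ.≤-trans (bound rows₁ (λ r∈ → r∈)) (ℕ.≤-reflexive fixed-rows)))
    (λ { (s≤s ()) })
    where
    fixed-rows : ∑ rows₁ (λ r → ⟦ does ((point r · f₀) ≟V point r) ⟧) ≡ 1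
    fixed-rows = refl
    fixed-f₀ : ∀ {j} → incD j 𝟎 ≡ true → incD j v₁ ≡ true → FixedBy f₀ j
    fixed-f₀ {j} j∋𝟎 jv = go (fixed-transport i∋𝟎 iso j j∋𝟎)
      where
      sole : ∀ k → (v₁ · fs k ≡ v₁ → k ≡ zero) × ¬ (v₁ · negM (fs k) ≡ v₁)
      sole = toWitness {a? = Fin.all? λ k → (((v₁ · fs k) ≟V v₁) →-dec (k Fin.≟ zero)) ×-dec
        ¬? ((v₁ · negM (fs k)) ≟V v₁)} tt
      go : Isotropic j → FixedBy f₀ j
      go (Y , k , inj₁ p , fix) = λ x jx → trans (cong (x ·_) (sym (trans p (cong fs
        (proj₁ (sole k) (trans (cong (v₁ ·_) (sym p)) (fix v₁ jv))))))) (fix x jx)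
      go (Y , k , inj₂ p , fix) = contradiction (trans (cong (v₁ ·_) (sym p)) (fix v₁ jv)) (proj₂ (sole k))
    bound : ∀ T → (∀ {r} → r ∈ T → r ∈ rows₁) →
      ∑ T (λ r → through v₁ (point r)) ≤ ∑ T (λ r → ⟦ does ((point r · f₀) ≟V point r) ⟧)
    bound [] _ = z≤n
    bound (r ∷ T) T⊆ = ℕ.+-mono-≤ (row ((point r · f₀) ≟V point r)) (bound T (T⊆ ∘ there))
      where
      row : (d : Dec (point r · f₀ ≡ point r)) → through v₁ (point r) ≤ ⟦ does d ⟧
      row (yes _) = through≤1 (proj₁ (All.lookup (LineTable.valid table₁) (T⊆ (here refl))))
      row (no ¬e) = ℕ.≤-trans (∑-mono (allFin n) λ i → ℕ.≤-reflexive (none i (onLine v₁ (point r) i) refl))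
        (ℕ.≤-reflexive (∑-0 (allFin n)))
        where
        none : ∀ i b → onLine v₁ (point r) i ≡ b → ⟦ b ⟧ ≡ 0
        none i false _ = refl
        none i true e = let (i∋𝟎 , iv , iu) = onLine⁻ e in
          contradiction (fixed-f₀ i∋𝟎 iv (point r) iu) ¬e

  not-chosen : ∀ o Y → IsInvolution Y zero → rep₁ o · Y ≡ rep₁ o → rep₂ o · Y ≡ rep₂ o →
    Vec.lookup choices o ≡ false
  not-chosen o Y inv-Y e₁ e₂ = go (Vec.lookup choices o) refl
    where
    go : ∀ b → Vec.lookup choices o ≡ b → Vec.lookup choices o ≡ false
    go false e = e
    go true e = ⊥-elim (block (∑-positive (allFin n) (λ i → ⟦ onLine (rep₁ o) (rep₂ o) i ⟧)
        λ z → case trans (sym z) (trans (sym (choices-orbit o)) (cong ⟦_⟧ e)) of λ ()))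
      where
      block : (∃ λ i → ⟦ onLine (rep₁ o) (rep₂ o) i ⟧ ≢ 0) → ⊥
      block (i , h) = at (onLine (rep₁ o) (rep₂ o) i) refl
        where
        at : ∀ b → onLine (rep₁ o) (rep₂ o) i ≡ b → ⊥
        at false p = h (cong ⟦_⟧ p)
        at true p = let (i∋𝟎 , i₁ , i₂) = onLine⁻ p in no-isotropic i∋𝟎 (Y , zero , inv-Y , λ x ix →
          fixed x (does⁻ (spans? _ _ x) (trans (is-span i i∋𝟎 (representative-size o) i₁ i₂ x) ix)))
          where
          fixed : ∀ x → Spans (rep₁ o) (rep₂ o) x → x · Y ≡ x
          fixed x (spanned a b e) = trans (cong (_· Y) e) (trans
            (trans (vecMat-⊕ (scale a (rep₁ o)) (scale b (rep₂ o)) Y)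
              (cong₂ _⊕_ (trans (vecMat-scale a (rep₁ o) Y) (cong (scale a) e₁))
                         (trans (vecMat-scale b (rep₂ o) Y) (cong (scale b) e₂)))) (sym e))

  chosen : choices ≡ only (# 0) ⊎ choices ≡ only (# 1)
  chosen = orbit-choice choices T₁.∑-choices T₂.∑-choices
    -- Representatives 2 and 3 are the eigenspaces of `f₀` for the eigenvalues 1 and -1.
    (not-chosen (# 2) f₀ (inj₁ refl) refl refl) (not-chosen (# 3) (negM f₀) (inj₂ refl) refl refl)

-- Identification with 𝒟₃

e₁ e₄ : V
e₁ = ⟨ 𝟙 , 𝟘 , 𝟘 , 𝟘 ⟩
e₄ = ⟨ 𝟘 , 𝟘 , 𝟘 , 𝟙 ⟩

InB₀⇒Spans : ∀ {v} → InB₀ v → Spans e₁ e₄ v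
InB₀⇒Spans (a , b , e) = spanned a b (trans e (combine a b))
  where
  combine : ∀ a b → ⟨ a , 𝟘 , 𝟘 , b ⟩ ≡ scale a e₁ ⊕ scale b e₄
  combine = toWitness {a? = Finite.all? F3-finite λ a → Finite.all? F3-finite λ b → _ ≟V _} tt

Spans⇒InB₀ : ∀ {v} → Spans e₁ e₄ v → InB₀ v
Spans⇒InB₀ (spanned a b e) = a , b , trans e (combine a b)
  where
  combine : ∀ a b → scale a e₁ ⊕ scale b e₄ ≡ ⟨ a , 𝟘 , 𝟘 , b ⟩
  combine = toWitness {a? = Finite.all? F3-finite λ a → Finite.all? F3-finite λ b → _ ≟V _} tt

InH₀-word : ∀ u → InH₀ (mat (word u))
InH₀-word [] = one
InH₀-word (c ∷ u) = mul {α ⊗ mat (β^ c)} (mul {α} genα (power c)) (InH₀-word u)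
  where
  power : ∀ c → InH₀ (mat (β^ c))
  power 𝟘 = one
  power 𝟙 = genβ
  power 𝟚 = mul {β} {β} genβ genβ

InH₀-word⁻¹ : ∀ u → InH₀ (mat⁻¹ (word u))
InH₀-word⁻¹ u = inv {mat (word u)} (InH₀-word u) (proj₁ (inverses (word u)))

Spans-trans : ∀ {p q v u x} → Spans p q v → Spans p q u → Spans v u x → Spans p q x
Spans-trans {p} {q} (spanned a b refl) (spanned a' b' refl) (spanned c d refl) =
  spanned ((c *₃ a) +₃ (d *₃ a')) ((c *₃ b) +₃ (d *₃ b')) (begin
    scale c (scale a p ⊕ scale b q) ⊕ scale d (scale a' p ⊕ scale b' q)
      ≡⟨ cong₂ _⊕_ (expand c a b) (expand d a' b') ⟩
    (scale (c *₃ a) p ⊕ scale (c *₃ b) q) ⊕ (scale (d *₃ a') p ⊕ scale (d *₃ b') q)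
      ≡⟨ ⊕-interchange (scale (c *₃ a) p) (scale (c *₃ b) q) (scale (d *₃ a') p) (scale (d *₃ b') q) ⟩
    (scale (c *₃ a) p ⊕ scale (d *₃ a') p) ⊕ (scale (c *₃ b) q ⊕ scale (d *₃ b') q)
      ≡⟨ cong₂ _⊕_ (scale-+₃ (c *₃ a) (d *₃ a') p) (scale-+₃ (c *₃ b) (d *₃ b') q) ⟨
    scale ((c *₃ a) +₃ (d *₃ a')) p ⊕ scale ((c *₃ b) +₃ (d *₃ b')) q ∎)
  where
  expand : ∀ c a b → scale c (scale a p ⊕ scale b q) ≡ scale (c *₃ a) p ⊕ scale (c *₃ b) q
  expand c a b = trans (scale-⊕ c (scale a p) (scale b q))
    (cong₂ _⊕_ (sym (scale-*₃ c a p)) (sym (scale-*₃ c b q)))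

-- X carries B₀ to the representative of the orbit o; as X centralises ⟨α, β⟩, it carries
-- 𝒟₃ to the design whose blocks are the translates of the lines in that orbit.
record CentralisesTo (o : Fin 9) : Set where
  field
    X X⁻¹ : Mat
    X-inverses : Inverses X X⁻¹
    X-α : X ⊗ α ≡ α ⊗ X
    X-β : X ⊗ β ≡ β ⊗ X
    X-e₁ : e₁ · X ≡ rep₁ o
    X-e₄ : e₄ · X ≡ rep₂ o

centralises₀ : CentralisesTo (# 0)
centralises₀ = record { X = I₄ ; X⁻¹ = I₄ ; X-inverses = refl , refl ; X-α = refl ; X-β = refl ; X-e₁ = refl ; X-e₄ = refl }

-- This `X` satisfies X² = 1 - X, so it generates a field GF(9) of matrices over which H₀ acts
-- linearly.
centralises₁ : CentralisesTo (# 1)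
centralises₁ = record
  { X = ⟨ ⟨ 𝟚 , 𝟘 , 𝟙 , 𝟙 ⟩ , ⟨ 𝟘 , 𝟚 , 𝟘 , 𝟙 ⟩ , ⟨ 𝟙 , 𝟚 , 𝟘 , 𝟘 ⟩ , ⟨ 𝟘 , 𝟙 , 𝟘 , 𝟘 ⟩ ⟩
  ; X⁻¹ = ⟨ ⟨ 𝟘 , 𝟘 , 𝟙 , 𝟙 ⟩ , ⟨ 𝟘 , 𝟘 , 𝟘 , 𝟙 ⟩ , ⟨ 𝟙 , 𝟚 , 𝟙 , 𝟘 ⟩ , ⟨ 𝟘 , 𝟙 , 𝟘 , 𝟙 ⟩ ⟩
  ; X-inverses = refl , refl ; X-α = refl ; X-β = refl ; X-e₁ = refl ; X-e₄ = refl }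

module Conclusion (D : Design 9 3) (S : Setup D) (aα : IsAut D α) (aβ : IsAut D β)
  (o : Fin 9) (choices≡ : Lines.choices D S aα aβ ≡ only o) (central : CentralisesTo o) where
  open Setup S
  open Counting D S
  open Translations D S
  open Lines D S aα aβ
  open CentralisesTo central

  IsAut-H₀ : ∀ {A} → InH₀ A → IsAut D A
  IsAut-H₀ genα = aα
  IsAut-H₀ genβ = aβ
  IsAut-H₀ one = IsAut-I D S
  IsAut-H₀ (mul {A} {B} h k) = IsAut-⊗ D S {A} {B} (IsAut-H₀ h) (IsAut-H₀ k)
  IsAut-H₀ (inv {A} {B} h e) = invert (IsAut-H₀ h)
    where
    invert : IsAut D A → IsAut D B
    invert a@(A' , (_ , A'A) , _) = subst (IsAut D)
      (trans (sym (⊗-identityʳ A')) (trans (cong (A' ⊗_) (sym e)) (⊗-cancelˡ A'A B))) (IsAut-inverse {A} a)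

  commutes-inverse : ∀ {A A'} → Inverses A A' → X ⊗ A ≡ A ⊗ X → X ⊗ A' ≡ A' ⊗ X
  commutes-inverse {A} {A'} (AA' , A'A) e = begin
    X ⊗ A' ≡⟨ ⊗-cancelˡ A'A (X ⊗ A') ⟨
    A' ⊗ (A ⊗ (X ⊗ A')) ≡⟨ cong (A' ⊗_) (trans (sym (⊗-assoc A X A')) (cong (_⊗ A') (sym e))) ⟩
    A' ⊗ ((X ⊗ A) ⊗ A') ≡⟨ cong (A' ⊗_) (⊗-cancelʳ AA' X) ⟩
    A' ⊗ X ∎

  X-H₀ : ∀ {A} → InH₀ A → X ⊗ A ≡ A ⊗ X
  X-H₀ genα = X-α
  X-H₀ genβ = X-β
  X-H₀ one = trans (⊗-identityʳ X) (sym (⊗-identityˡ X))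
  X-H₀ (mul {A} {B} h k) = begin
    X ⊗ (A ⊗ B) ≡⟨ ⊗-assoc X A B ⟨
    (X ⊗ A) ⊗ B ≡⟨ cong (_⊗ B) (X-H₀ h) ⟩
    (A ⊗ X) ⊗ B ≡⟨ ⊗-assoc A X B ⟩
    A ⊗ (X ⊗ B) ≡⟨ cong (A ⊗_) (X-H₀ k) ⟩
    A ⊗ (B ⊗ X) ≡⟨ ⊗-assoc A B X ⟨
    (A ⊗ B) ⊗ X ∎
  X-H₀ (inv {A} {B} h e) = invert (IsAut-H₀ h)
    where
    invert : IsAut D A → X ⊗ B ≡ B ⊗ X
    invert (A' , i@(_ , A'A) , _) = subst (λ Y → X ⊗ Y ≡ Y ⊗ X)
      (trans (sym (⊗-identityʳ A')) (trans (cong (A' ⊗_) (sym e)) (⊗-cancelˡ A'A B)))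
      (commutes-inverse {A} i (X-H₀ h))

  X-· : ∀ {A} → InH₀ A → ∀ v → v · X · A ≡ v · A · X
  X-· {A} h v = trans (sym (·-⊗ v X A)) (trans (cong (v ·_) (X-H₀ h)) (·-⊗ v A X))

  p q : V
  p = rep₁ o
  q = rep₂ o

  B₀X⁺ : ∀ {v} → InB₀ v → Spans p q (v · X)
  B₀X⁺ {v} v∈ = subst₂ (λ a b → Spans a b (v · X)) X-e₁ X-e₄ (Spans-· X (InB₀⇒Spans v∈))

  B₀X⁻ : ∀ {x} → Spans p q x → InB₀ (x · X⁻¹)
  B₀X⁻ {x} s = Spans⇒InB₀ (subst₂ (λ a b → Spans a b (x · X⁻¹)) (back e₁ X-e₁) (back e₄ X-e₄) (Spans-· X⁻¹ s))
    where
    back : ∀ e {r} → e · X ≡ r → r · X⁻¹ ≡ e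
    back e refl = cancelʳ (proj₁ X-inverses) e

  chosen-orbit : ∀ o′ → through-orbit o′ ≡ ⟦ does (o′ Fin.≟ o) ⟧
  chosen-orbit o′ = trans (sym (choices-orbit o′)) (cong ⟦_⟧ (trans (cong (λ b → Vec.lookup b o′) choices≡)
    (Vecₚ.lookup∘tabulate (λ o′ → does (o′ Fin.≟ o)) o′)))

  line-block : ∃ λ i → ∀ x → incD i x ≡ does (spans? p q x)
  line-block = block (∑-positive (allFin n) (λ i → ⟦ onLine p q i ⟧)
    λ z → case trans (sym z) (trans (chosen-orbit o) (cong ⟦_⟧ (dec-true (o Fin.≟ o) refl))) of λ ())
    where
    block : (∃ λ i → ⟦ onLine p q i ⟧ ≢ 0) → ∃ λ i → ∀ x → incD i x ≡ does (spans? p q x)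
    block (i , h) = i , at (onLine p q i) refl
      where
      at : ∀ b → onLine p q i ≡ b → ∀ x → incD i x ≡ does (spans? p q x)
      at false e = contradiction (cong ⟦_⟧ e) h
      at true e x = let (i∋𝟎 , ip , iq) = onLine⁻ e in sym (is-span i i∋𝟎 (representative-size o) ip iq x)

  record Straightened (i : Fin n) : Set where
    field
      M M⁻¹      : Mat
      M-inverses : Inverses M M⁻¹
      M∈         : InH₀ M
      M⁻¹∈       : InH₀ M⁻¹
      to         : ∀ {x} → incD i x ≡ true → Spans p q (x · M)
      from       : ∀ {x} → Spans p q (x · M) → incD i x ≡ true

  straighten-at : ∀ {v T} → LineTable v T → ∀ i → incD i 𝟎 ≡ true → incD i v ≡ true → Straightened i
  straighten-at {v} {T} t i i∋𝟎 iv = go (Through.one-row t i i∋𝟎 iv)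
    where
    go : (∃ λ r → r ∈ T × incD i (point r) ≡ true) → Straightened i
    go (r , r∈ , ir) = record
      { M = W ; M⁻¹ = mat⁻¹ (word u) ; M-inverses = inverses (word u) ; M∈ = InH₀-word u ; M⁻¹∈ = InH₀-word⁻¹ u
      ; to = λ {x} ix → subst (λ o′ → Spans (rep₁ o′) (rep₂ o′) (x · W)) orbit≡o
          (transitive-span (Spans-· W (does⁻ (spans? v (point r) x) (trans (is-span i i∋𝟎 nine iv ir x) ix))))
      ; from = λ {x} s → closed i i∋𝟎 iv ir (unspan (back-span
          (subst (λ o′ → Spans (rep₁ o′) (rep₂ o′) (x · W)) (sym orbit≡o) s)))
      }
      where
      u : List F3
      u = proj₁ (proj₂ r)
      W : Mat
      W = mat (word u)
      nine : SpanSize v (point r)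
      nine = proj₁ (All.lookup (LineTable.valid t) r∈)
      same : SameSpan (v · W) (point r · W) (rep₁ (orbit r)) (rep₂ (orbit r))
      same = proj₂ (proj₂ (All.lookup (LineTable.valid t) r∈))
      transitive-span : ∀ {x} → Spans (v · W) (point r · W) x → Spans (rep₁ (orbit r)) (rep₂ (orbit r)) x
      transitive-span s = Spans-trans (SameSpan.v∈ same) (SameSpan.u∈ same) s
      back-span : ∀ {x} → Spans (rep₁ (orbit r)) (rep₂ (orbit r)) x → Spans (v · W) (point r · W) x
      back-span s = Spans-trans (SameSpan.p∈ same) (SameSpan.q∈ same) s
      unspan : ∀ {x} → Spans (v · W) (point r · W) (x · W) → Spans v (point r) x
      unspan {x} s = subst₂ (λ a b → Spans a b x) (back v) (back (point r))
        (subst (Spans _ _) (back x) (Spans-· (mat⁻¹ (word u)) s))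
        where
        back : ∀ y → y · W · mat⁻¹ (word u) ≡ y
        back = cancelʳ (proj₁ (inverses (word u)))
      -- The given block is the line of this row, so the orbit of that line is a chosen one, and
      -- only o is chosen.
      positive : through-orbit (orbit r) ≢ 0
      positive e = FB.∑-pos (λ j → ⟦ onLine v (point r) j ⟧) i
        (λ z → case trans (sym (cong ⟦_⟧ (onLine⁺ {v} {point r} {i} i∋𝟎 iv ir))) z of λ ())
        (trans (Through.through-row t r∈) e)
      orbit≡o : orbit r ≡ o
      orbit≡o = at (orbit r Fin.≟ o) (chosen-orbit (orbit r))
        where
        at : (d : Dec (orbit r ≡ o)) → through-orbit (orbit r) ≡ ⟦ does d ⟧ → orbit r ≡ o
        at (yes e) _ = e
        at (no _) z = contradiction z positive

  -- The tables cover lines through `v₁` and `v₂` only, so H₀ first moves some non-zero vector of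
  -- the block to one of these.
  straighten : ∀ i → incD i 𝟎 ≡ true → Straightened i
  straighten i i∋𝟎 = go (escape i (λ x → does (x ≟V 𝟎)) (subst (_< 9) (sym (FV.once 𝟎)) (s≤s (s≤s z≤n))))
    where
    via : ∀ u v T → LineTable v T → incD i (v · mat (word u)) ≡ true → Straightened i
    via u v T t iw = move (proj₂ (proj₂ (proj₂ (proj₂ (IsAut-word aα aβ u)))) )
      where
      A A' : Mat
      A = mat (word u)
      A' = mat⁻¹ (word u)
      move : Preserves D (proj₁ (IsAut-word aα aβ u)) → Straightened i
      move pres = carry (subst (Preserves D) same pres i)
        where
        same : proj₁ (IsAut-word aα aβ u) ≡ A'
        same = let (B , (AB , BA) , _) = IsAut-word aα aβ u in
          trans (sym (⊗-identityʳ B)) (trans (cong (B ⊗_) (sym (proj₁ (inverses (word u))))) (⊗-cancelˡ BA A'))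
        carry : (∃ λ j → ∀ x → incD j (x · A') ≡ incD i x) → Straightened i
        carry (j , h) = record
          { M = A' ⊗ M ; M⁻¹ = M⁻¹ ⊗ A
          ; M-inverses = Inverses-⊗ (Inverses-sym (inverses (word u))) M-inverses
          ; M∈ = mul {A'} {M} (InH₀-word⁻¹ u) M∈ ; M⁻¹∈ = mul {M⁻¹} {A} M⁻¹∈ (InH₀-word u)
          ; to = λ {x} ix → subst (Spans p q) (sym (·-⊗ x A' M)) (to {x · A'} (trans (h x) ix))
          ; from = λ {x} s → trans (sym (h x)) (from {x · A'} (subst (Spans p q) (·-⊗ x A' M) s))
          }
          where
          open Straightened (straighten-at t j
            (trans (cong (incD j) (sym (vecMat-𝟎 A'))) (trans (h 𝟎) i∋𝟎))
            (trans (cong (incD j) (sym (cancelʳ (proj₁ (inverses (word u))) v))) (trans (h (v · A)) iw)))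
    go : (∃ λ x → incD i x ≡ true × does (x ≟V 𝟎) ≡ false) → Straightened i
    go (x , ix , x≢) = at (reach x λ e → contradiction (trans (sym (dec-true (x ≟V 𝟎) e)) x≢) λ ())
      where
      at : (∃ λ u → v₁ · mat (word u) ≡ x ⊎ v₂ · mat (word u) ≡ x) → Straightened i
      at (u , inj₁ e) = via u v₁ rows₁ table₁ (trans (cong (incD i) e) ix)
      at (u , inj₂ e) = via u v₂ rows₂ table₂ (trans (cong (incD i) e) ix)

  -- A translation takes the block through 0, and `M` takes it on to ⟨p, q⟩, the image of B₀ under
  -- `X`. Since `X` commutes with `M⁻¹`, undoing `X` leaves a translate of the image of B₀ under
  -- `M⁻¹`.
  block-is-D₃ : ∀ i → IsD₃Block (λ y → incD i (y · X))
  block-is-D₃ i = M⁻¹ , x · X⁻¹ , M⁻¹∈ , λ y → forth y , back y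
    where
    x : V
    x = proj₁ (member i)
    j : Fin n
    j = act i (neg x)
    open Straightened (straighten j (to-origin i x (proj₂ (member i))))
    shift : ∀ z → incD j (z ⊕ neg x) ≡ incD i z
    shift = act-inc i (neg x)
    image : ∀ v → aff M⁻¹ (x · X⁻¹) v · X ≡ (v · X · M⁻¹) ⊕ x
    image v = trans (vecMat-⊕ (v · M⁻¹) (x · X⁻¹) X)
      (cong₂ _⊕_ (sym (X-· M⁻¹∈ v)) (cancelʳ (proj₂ X-inverses) x))
    forth : ∀ y → incD i (y · X) ≡ true → Σ V λ v → InB₀ v × (y ≡ aff M⁻¹ (x · X⁻¹) v)
    forth y iy = z · X⁻¹ , B₀X⁻ (to (trans (shift (y · X)) iy)) , (begin
      y
        ≡⟨ cancelʳ (proj₁ X-inverses) y ⟨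
      y · X · X⁻¹
        ≡⟨ cong (_· X⁻¹) (neg-⊕-cancel (y · X) x) ⟨
      (((y · X) ⊕ neg x) ⊕ x) · X⁻¹
        ≡⟨ cong (λ t → (t ⊕ x) · X⁻¹) (cancelʳ (proj₁ M-inverses) ((y · X) ⊕ neg x)) ⟨
      ((z · M⁻¹) ⊕ x) · X⁻¹
        ≡⟨ cong (λ t → ((t · M⁻¹) ⊕ x) · X⁻¹) (cancelʳ (proj₂ X-inverses) z) ⟨
      ((z · X⁻¹ · X · M⁻¹) ⊕ x) · X⁻¹
        ≡⟨ cong (_· X⁻¹) (image (z · X⁻¹)) ⟨
      aff M⁻¹ (x · X⁻¹) (z · X⁻¹) · X · X⁻¹
        ≡⟨ cancelʳ (proj₁ X-inverses) _ ⟩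
      aff M⁻¹ (x · X⁻¹) (z · X⁻¹) ∎)
      where
      z : V
      z = ((y · X) ⊕ neg x) · M
    back : ∀ y → (Σ V λ v → InB₀ v × (y ≡ aff M⁻¹ (x · X⁻¹) v)) → incD i (y · X) ≡ true
    back y (v , v∈ , e) = trans (sym (shift (y · X))) (from (subst (Spans p q) (sym (begin
      ((y · X) ⊕ neg x) · M
        ≡⟨ cong (λ t → ((t · X) ⊕ neg x) · M) e ⟩
      ((aff M⁻¹ (x · X⁻¹) v · X) ⊕ neg x) · M
        ≡⟨ cong (λ t → (t ⊕ neg x) · M) (image v) ⟩
      (((v · X · M⁻¹) ⊕ x) ⊕ neg x) · M
        ≡⟨ cong (_· M) (⊕-neg-cancel (v · X · M⁻¹) x) ⟩
      v · X · M⁻¹ · M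
        ≡⟨ cancelʳ (proj₂ M-inverses) (v · X) ⟩
      v · X ∎)) (B₀X⁺ v∈)))

  D₃-is-block : ∀ B → IsD₃Block B → ∃ λ i → ∀ y → B y ≡ incD i (y · X)
  D₃-is-block B (A , c , A∈ , h) = go (IsAut-H₀ A∈)
    where
    go : IsAut D A → ∃ λ i → ∀ y → B y ≡ incD i (y · X)
    go (A' , (AA' , A'A) , _ , (pres , _)) = act k (c · X) , λ y → true-iff
      (λ e → forth y (proj₁ (h y) e)) (λ e → proj₂ (h y) (back y e))
      where
      i₁ k : Fin n
      i₁ = proj₁ line-block
      k = proj₁ (pres i₁)
      image : ∀ v → aff A c v · X ≡ (v · X · A) ⊕ (c · X)
      image v = trans (vecMat-⊕ (v · A) c X) (cong (_⊕ (c · X)) (sym (X-· A∈ v)))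
      forth : ∀ y → (Σ V λ v → InB₀ v × (y ≡ aff A c v)) → incD (act k (c · X)) (y · X) ≡ true
      forth y (v , v∈ , e) = begin
        incD (act k (c · X)) (y · X)
          ≡⟨ cong (incD (act k (c · X))) (trans (cong (_· X) e) (image v)) ⟩
        incD (act k (c · X)) ((v · X · A) ⊕ (c · X))
          ≡⟨ act-inc k (c · X) (v · X · A) ⟩
        incD k (v · X · A)
          ≡⟨ proj₂ (pres i₁) (v · X) ⟩
        incD i₁ (v · X)
          ≡⟨ trans (proj₂ line-block (v · X)) (dec-true (spans? p q (v · X)) (B₀X⁺ v∈)) ⟩
        true ∎
      back : ∀ y → incD (act k (c · X)) (y · X) ≡ true → Σ V λ v → InB₀ v × (y ≡ aff A c v)
      back y e = w · X⁻¹ , B₀X⁻ (does⁻ (spans? p q w) (trans (sym (proj₂ line-block w)) (begin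
          incD i₁ w ≡⟨ proj₂ (pres i₁) w ⟨
          incD k (w · A) ≡⟨ cong (incD k) wA ⟩
          incD k z ≡⟨ act-inc k (c · X) z ⟨
          incD (act k (c · X)) (z ⊕ (c · X)) ≡⟨ cong (incD (act k (c · X))) (neg-⊕-cancel (y · X) (c · X)) ⟩
          incD (act k (c · X)) (y · X) ≡⟨ e ⟩
          true ∎))) , (begin
        y
          ≡⟨ cancelʳ (proj₁ X-inverses) y ⟨
        y · X · X⁻¹
          ≡⟨ cong (_· X⁻¹) (neg-⊕-cancel (y · X) (c · X)) ⟨
        (z ⊕ (c · X)) · X⁻¹
          ≡⟨ cong (λ t → (t ⊕ (c · X)) · X⁻¹) wA ⟨
        ((w · A) ⊕ (c · X)) · X⁻¹
          ≡⟨ cong (λ t → ((t · A) ⊕ (c · X)) · X⁻¹) (cancelʳ (proj₂ X-inverses) w) ⟨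
        ((w · X⁻¹ · X · A) ⊕ (c · X)) · X⁻¹
          ≡⟨ cong (_· X⁻¹) (image (w · X⁻¹)) ⟨
        aff A c (w · X⁻¹) · X · X⁻¹
          ≡⟨ cancelʳ (proj₁ X-inverses) _ ⟩
        aff A c (w · X⁻¹) ∎)
        where
        z w : V
        z = (y · X) ⊕ neg (c · X)
        w = z · A'
        wA : w · A ≡ z
        wA = cancelʳ A'A z

  isomorphic : LinearlyIsoToD₃ D
  isomorphic = X⁻¹ , X , Inverses-sym X-inverses , block-is-D₃ , D₃-is-block

setup⇒iso : ∀ D → Setup D → LinearlyIsoToD₃ D
setup⇒iso D S = go (standardise D S)
  where
  go : Standard D → LinearlyIsoToD₃ D
  go (standard D′ back S′ aα aβ) = back ([ (λ e → Conclusion.isomorphic D′ S′ aα aβ (# 0) e centralises₀)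
    , (λ e → Conclusion.isomorphic D′ S′ aα aβ (# 1) e centralises₁) ]′ (Lines.chosen D′ S′ aα aβ))

-- The standard copy of R

module F₃ = Finite F3-finite

-- Injectivity bounds every fibre of x ↦ x P by 1, and the fibres have 81 elements in total, so each
-- has exactly one. Preimages of the unit vectors are the rows of the inverse.
invertible : ∀ P → (∀ x → x · P ≡ 𝟎 → x ≡ 𝟎) → ∃ λ P' → Inverses P P'
invertible P kernel = P' , (Mat-ext λ x → injective (begin
    x · (P ⊗ P') · P ≡⟨ cong (_· P) (·-⊗ x P P') ⟩
    x · P · P' · P ≡⟨ ·-⊗ (x · P) P' P ⟨
    x · P · (P' ⊗ P) ≡⟨ cong (x · P ·_) P'P ⟩
    x · P · I₄ ≡⟨ ·-I (x · P) ⟩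
    x · P ≡⟨ cong (_· P) (·-I x) ⟨
    x · I₄ · P ∎)) , P'P
  where
  injective : ∀ {x y} → x · P ≡ y · P → x ≡ y
  injective {x} {y} e = ⊖≡𝟎 x y (kernel (x ⊖ y)
    (trans (·-⊖ x y P) (trans (cong (_⊖ (y · P)) e) (⊕-inverseʳ (y · P)))))
  fibre : V → ℕ
  fibre y = ∑V λ x → ⟦ does ((x · P) ≟V y) ⟧
  fibre≡1 : ∀ y → fibre y ≡ 1
  fibre≡1 = FV.∑-all
    (λ y → ∑-unique V-finite (λ x → does ((x · P) ≟V y)) λ {x} {x'} p q →
      injective (trans (does⁻ ((x · P) ≟V y) p) (sym (does⁻ ((x' · P) ≟V y) q))))
    (trans (∑-swap allV allV _) (∑-cong allV λ x → trans
      (∑-cong allV λ y → cong ⟦_⟧ (does-cong ((x · P) ≟V y) (y ≟V (x · P)) sym sym)) (FV.once (x · P))))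
  preimage : ∀ y → ∃ λ x → x · P ≡ y
  preimage y = at (FV.any? λ x → (x · P) ≟V y)
    where
    at : Dec (∃ λ x → x · P ≡ y) → ∃ λ x → x · P ≡ y
    at (yes found) = found
    at (no none) = contradiction (trans (sym (fibre≡1 y)) (trans (∑-cong allV λ x →
      cong ⟦_⟧ (dec-false ((x · P) ≟V y) λ e → none (x , e))) (∑-0 allV))) λ ()
  P' : Mat
  P' = Vec.map (λ y → proj₁ (preimage y)) I₄
  P'P : P' ⊗ P ≡ I₄
  P'P = trans (sym (Vecₚ.map-∘ (_· P) (λ y → proj₁ (preimage y)) I₄))
    (trans (Vecₚ.map-cong (λ y → proj₂ (preimage y)) I₄) (Vecₚ.map-id I₄))

⊖-flip : (u v : Vec F3 d) → v ⊕ neg u ≡ neg (u ⊕ neg v)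
⊖-flip [] [] = refl
⊖-flip (a ∷ u) (b ∷ v) = cong₂ _∷_ (h a b) (⊖-flip u v)
  where
  h : ∀ a b → b +₃ (𝟚 *₃ a) ≡ 𝟚 *₃ (a +₃ (𝟚 *₃ b))
  h = toWitness {a? = F₃.all? λ a → F₃.all? λ b → _ ≟F _} tt

self-neg : (u : Vec F3 d) → u ≡ neg u → u ≡ 𝟎
self-neg [] e = refl
self-neg (a ∷ u) e = cong₂ _∷_ (h a (Vecₚ.∷-injectiveˡ e)) (self-neg u (Vecₚ.∷-injectiveʳ e))
  where
  h : ∀ a → a ≡ 𝟚 *₃ a → a ≡ 𝟘
  h = toWitness {a? = F₃.all? λ a → (_ ≟F _) →-dec (_ ≟F _)} tt

⊕-zero⇒neg : (u v : Vec F3 d) → u ⊕ v ≡ 𝟎 → v ≡ neg u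
⊕-zero⇒neg [] [] e = refl
⊕-zero⇒neg (a ∷ u) (b ∷ v) e = cong₂ _∷_ (h a b (Vecₚ.∷-injectiveˡ e)) (⊕-zero⇒neg u v (Vecₚ.∷-injectiveʳ e))
  where
  h : ∀ a b → a +₃ b ≡ 𝟘 → b ≡ 𝟚 *₃ a
  h = toWitness {a? = F₃.all? λ a → F₃.all? λ b → (_ ≟F _) →-dec (_ ≟F _)} tt

-- In the quaternion algebra, (-1 + i - j) j = (-1 + i - j) (1 + i); a, b, c, d stand for w, wi, wj, wij.
quaternion-identity : (a b c d : Vec F3 d) →
  (neg c ⊕ d) ⊕ neg (neg a) ≡ ((neg a ⊕ b) ⊕ neg c) ⊕ ((neg b ⊕ neg a) ⊕ neg (neg d))
quaternion-identity [] [] [] [] = refl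
quaternion-identity (a ∷ as) (b ∷ bs) (c ∷ cs) (d ∷ ds) = cong₂ _∷_ (h a b c d) (quaternion-identity as bs cs ds)
  where
  h : ∀ a b c d → ((𝟚 *₃ c) +₃ d) +₃ (𝟚 *₃ (𝟚 *₃ a)) ≡
    (((𝟚 *₃ a) +₃ b) +₃ (𝟚 *₃ c)) +₃ (((𝟚 *₃ b) +₃ (𝟚 *₃ a)) +₃ (𝟚 *₃ (𝟚 *₃ d)))
  h = toWitness {a? = F₃.all? λ a → F₃.all? λ b → F₃.all? λ c → F₃.all? λ d → _ ≟F _} tt

-- With the letters as above, the hypotheses say that w is killed by -1 + i - j and by its product
-- with j, and that wi is killed by -1 + i - j.
quaternion-kernel : (a b c d : Vec F3 d) → (neg a ⊕ b) ⊕ neg c ≡ 𝟎 → (neg c ⊕ d) ⊕ neg (neg a) ≡ 𝟎 →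
  (neg b ⊕ neg a) ⊕ neg d ≡ 𝟎 → b ≡ neg a
quaternion-kernel [] [] [] [] _ _ _ = refl
quaternion-kernel (a ∷ as) (b ∷ bs) (c ∷ cs) (d ∷ ds) e f g = cong₂ _∷_
  (h a b c d (Vecₚ.∷-injectiveˡ e) (Vecₚ.∷-injectiveˡ f) (Vecₚ.∷-injectiveˡ g))
  (quaternion-kernel as bs cs ds (Vecₚ.∷-injectiveʳ e) (Vecₚ.∷-injectiveʳ f) (Vecₚ.∷-injectiveʳ g))
  where
  h : ∀ a b c d → ((𝟚 *₃ a) +₃ b) +₃ (𝟚 *₃ c) ≡ 𝟘 → ((𝟚 *₃ c) +₃ d) +₃ (𝟚 *₃ (𝟚 *₃ a)) ≡ 𝟘 →
    ((𝟚 *₃ b) +₃ (𝟚 *₃ a)) +₃ (𝟚 *₃ d) ≡ 𝟘 → b ≡ 𝟚 *₃ a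
  h = toWitness {a? = F₃.all? λ a → F₃.all? λ b → F₃.all? λ c → F₃.all? λ d →
    (_ ≟F _) →-dec ((_ ≟F _) →-dec ((_ ≟F _) →-dec (_ ≟F _)))} tt

-- s² + t² = 0 only for s = t = 0.
anisotropic : ∀ s t (a b : Vec F3 d) → scale s a ⊕ scale t b ≡ 𝟎 → scale s b ⊕ scale t (neg a) ≡ 𝟎 →
  (s ≡ 𝟘 × t ≡ 𝟘) ⊎ a ≡ 𝟎
anisotropic s t [] [] _ _ = inj₂ refl
anisotropic s t (a ∷ as) (b ∷ bs) e f = go (h s t a b (Vecₚ.∷-injectiveˡ e) (Vecₚ.∷-injectiveˡ f))
  (anisotropic s t as bs (Vecₚ.∷-injectiveʳ e) (Vecₚ.∷-injectiveʳ f))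
  where
  h : ∀ s t a b → (s *₃ a) +₃ (t *₃ b) ≡ 𝟘 → (s *₃ b) +₃ (t *₃ (𝟚 *₃ a)) ≡ 𝟘 → (s ≡ 𝟘 × t ≡ 𝟘) ⊎ a ≡ 𝟘
  h = toWitness {a? = F₃.all? λ s → F₃.all? λ t → F₃.all? λ a → F₃.all? λ b →
    (_ ≟F _) →-dec ((_ ≟F _) →-dec (((_ ≟F _) ×-dec (_ ≟F _)) ⊎-dec (_ ≟F _)))} tt
  go : (s ≡ 𝟘 × t ≡ 𝟘) ⊎ a ≡ 𝟘 → (s ≡ 𝟘 × t ≡ 𝟘) ⊎ as ≡ 𝟎 → (s ≡ 𝟘 × t ≡ 𝟘) ⊎ (a ∷ as) ≡ 𝟎
  go (inj₁ z) _ = inj₁ z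
  go (inj₂ _) (inj₁ z) = inj₁ z
  go (inj₂ refl) (inj₂ refl) = inj₂ refl

Z4-all? : ∀ {P : Z4 → Set} → (∀ a → Dec (P a)) → Dec (∀ a → P a)
Z4-all? d = map′ (λ (a , b , c , e) → λ { r0 → a ; r1 → b ; r2 → c ; r3 → e })
  (λ h → h r0 , h r1 , h r2 , h r3) (d r0 ×-dec d r1 ×-dec d r2 ×-dec d r3)

U-all? : ∀ {P : U → Set} → (∀ a → Dec (P a)) → Dec (∀ a → P a)
U-all? d = map′ (λ (a , b , c , e) → λ { u1 → a ; ui → b ; uj → c ; uk → e })
  (λ h → h u1 , h ui , h uj , h uk) (d u1 ×-dec d ui ×-dec d uj ×-dec d uk)

φ₀∈R₀ : ∀ a s t u → φ₀ ((a , s) , (t , u)) ∈ R₀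
φ₀∈R₀ = toWitness {a? = in-R₀? R₀} tt
  where
  in-R₀? : ∀ R → Dec (∀ a s t u → φ₀ ((a , s) , (t , u)) ∈ R)
  in-R₀? R = Z4-all? λ a → Finite.all? Bool-finite λ s → Finite.all? Bool-finite λ t → U-all? λ u →
    Any.any? (φ₀ ((a , s) , (t , u)) ≟M_) R

R₀-D8 : List D8
R₀-D8 = cartesianProductWith _,_ (r0 ∷ r1 ∷ []) (false ∷ true ∷ [])

R₀-Q8 : List Q8
R₀-Q8 = cartesianProductWith _,_ (false ∷ true ∷ []) (u1 ∷ ui ∷ uj ∷ uk ∷ [])

InR₀⇒φ₀ : ∀ {X} → InR₀ X → ∃ λ p → X ≡ φ₀ p
InR₀⇒φ₀ {X} X∈ =
  let (_ , _ , A∈ , B∈ , e) = ∈-cartesianProductWith⁻ _⊗_ (map φD R₀-D8) (map φQ R₀-Q8) (InR₀⁻ X∈)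
      (d , _ , e₁) = ∈-map⁻ φD {xs = R₀-D8} A∈
      (q , _ , e₂) = ∈-map⁻ φQ {xs = R₀-Q8} B∈
  in (d , q) , trans e (cong₂ _⊗_ e₁ e₂)

module Frame (φ : D8 × Q8 → Mat) (rep : IsCentralProductRep φ) where

  hom : ∀ d q d' q' → φ ((d ·D d') , (q ·Q q')) ≡ φ (d , q) ⊗ φ (d' , q')
  hom = proj₁ rep

  φ-1 : φ (eD , eQ) ≡ I₄
  φ-1 = proj₂ (proj₂ (proj₂ rep))

  r f : D8
  r = r1 , false
  f = r0 , true

  i j : Q8
  i = false , ui
  j = false , uj

  R F Z I J : Mat
  R = φ (r , eQ)
  F = φ (f , eQ)
  Z = φ (zD , eQ)
  I = φ (eD , i)
  J = φ (eD , j)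

  RR : R ⊗ R ≡ Z
  RR = sym (hom r eQ r eQ)

  ZZ : Z ⊗ Z ≡ I₄
  ZZ = trans (sym (hom zD eQ zD eQ)) φ-1

  FF : F ⊗ F ≡ I₄
  FF = trans (sym (hom f eQ f eQ)) φ-1

  FR : F ⊗ R ≡ (R ⊗ Z) ⊗ F
  FR = trans (sym (hom f eQ r eQ)) (trans (hom (r3 , false) eQ f eQ) (cong (_⊗ F) (hom r eQ zD eQ)))

  zQ-Z : φ (eD , zQ) ≡ Z
  zQ-Z = begin
    φ (eD , zQ) ≡⟨ ⊗-cancelˡ ZZ (φ (eD , zQ)) ⟨
    Z ⊗ (Z ⊗ φ (eD , zQ)) ≡⟨ cong (Z ⊗_) (hom zD eQ eD zQ) ⟨
    Z ⊗ φ (zD , zQ) ≡⟨ cong (Z ⊗_) (proj₁ (proj₂ (proj₂ rep))) ⟩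
    Z ⊗ I₄ ≡⟨ ⊗-identityʳ Z ⟩
    Z ∎

  II : I ⊗ I ≡ Z
  II = trans (sym (hom eD i eD i)) zQ-Z

  JJ : J ⊗ J ≡ Z
  JJ = trans (sym (hom eD j eD j)) zQ-Z

  JI : J ⊗ I ≡ Z ⊗ (I ⊗ J)
  JI = trans (sym (hom eD j eD i)) (trans (hom eD zQ eD (false , uk))
    (cong₂ _⊗_ zQ-Z (hom eD i eD j)))

  IF : I ⊗ F ≡ F ⊗ I
  IF = trans (sym (hom eD i f eQ)) (hom f eQ eD i)

  IR : I ⊗ R ≡ R ⊗ I
  IR = trans (sym (hom eD i r eQ)) (hom r eQ eD i)

  JF : J ⊗ F ≡ F ⊗ J
  JF = trans (sym (hom eD j f eQ)) (hom f eQ eD j)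

  JR : J ⊗ R ≡ R ⊗ J
  JR = trans (sym (hom eD j r eQ)) (hom r eQ eD j)

  FZ : F ⊗ Z ≡ Z ⊗ F
  FZ = trans (sym (hom f eQ zD eQ)) (hom zD eQ f eQ)

  RZ : R ⊗ Z ≡ Z ⊗ R
  RZ = trans (sym (hom r eQ zD eQ)) (hom zD eQ r eQ)

  IZ : I ⊗ Z ≡ Z ⊗ I
  IZ = trans (sym (hom eD i zD eQ)) (hom zD eQ eD i)

  JZ : J ⊗ Z ≡ Z ⊗ J
  JZ = trans (sym (hom eD j zD eQ)) (hom zD eQ eD j)

  move : ∀ {A B C E} → A ⊗ B ≡ C ⊗ E → ∀ v → v · A · B ≡ v · C · E
  move {A} {B} {C} {E} e v = trans (sym (·-⊗ v A B)) (trans (cong (v ·_) e) (·-⊗ v C E))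

  square : ∀ {A B} → A ⊗ A ≡ B → ∀ v → v · A · A ≡ v · B
  square {A} {B} e v = trans (sym (·-⊗ v A A)) (cong (v ·_) e)

  -- At this stage `Z` is only known to be an involution, not -1. Its eigenspace for -1 is non-zero
  -- because the kernel of `φ` excludes the element behind `Z`; the relations of D₈ and Q₈ hold
  -- there with genuine signs, and the whole basis is found in it.
  Odd : V → Set
  Odd v = v · Z ≡ neg v

  odd-· : ∀ {A} → A ⊗ Z ≡ Z ⊗ A → ∀ {v} → Odd v → Odd (v · A)
  odd-· {A} e {v} h = trans (move {A} {Z} {Z} {A} e v) (trans (cong (_· A) h) (vecMat-scale 𝟚 v A))

  Fixed : V → Set
  Fixed v = v · F ≡ v

  fixed-· : ∀ {A} → A ⊗ F ≡ F ⊗ A → ∀ {v} → Fixed v → Fixed (v · A)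
  fixed-· {A} e {v} h = trans (move {A} {F} {F} {A} e v) (cong (_· A) h)

  injective-odd : ∀ {A} → A ⊗ A ≡ Z → ∀ {v} → Odd v → v · A ≡ 𝟎 → v ≡ 𝟎
  injective-odd {A} e {v} h z = trans (sym (neg-involutive v)) (trans (cong neg (begin
    neg v ≡⟨ h ⟨
    v · Z ≡⟨ square {A} e v ⟨
    v · A · A ≡⟨ cong (_· A) z ⟩
    𝟎 · A ≡⟨ vecMat-𝟎 A ⟩
    𝟎 ∎)) (scale-𝟎 𝟚))

  flip-F : ∀ {v} → Odd v → v · R · F ≡ neg (v · F · R)
  flip-F {v} h = trans (sym (neg-involutive _)) (cong neg (sym (begin
    v · F · R ≡⟨ move {F} {R} {R ⊗ Z} {F} FR v ⟩
    v · (R ⊗ Z) · F ≡⟨ cong (_· F) (·-⊗ v R Z) ⟩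
    v · R · Z · F ≡⟨ cong (_· F) (odd-· {R} RZ h) ⟩
    neg (v · R) · F ≡⟨ vecMat-scale 𝟚 (v · R) F ⟩
    neg (v · R · F) ∎)))

  odd-vector : ∃ λ v → v ≢ 𝟎 × Odd v
  odd-vector = go (FV.any? λ x → ¬? ((x · Z) ≟V x))
    where
    Z≢I : Z ≢ I₄
    Z≢I e = [ (λ { (() , _) }) , (λ { (_ , ()) }) ]′ (proj₁ (proj₂ rep) zD eQ e)
    go : Dec (∃ λ x → x · Z ≢ x) → ∃ λ v → v ≢ 𝟎 × Odd v
    go (no none) = contradiction (Mat-ext λ x → trans (fix x ((x · Z) ≟V x)) (sym (·-I x))) Z≢I
      where
      fix : ∀ x → Dec (x · Z ≡ x) → x · Z ≡ x
      fix x (yes e) = e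
      fix x (no e) = contradiction (x , e) none
    go (yes (x , h)) = x ⊖ (x · Z) , (λ e → h (sym (⊖≡𝟎 x (x · Z) e))) , (begin
      (x ⊖ (x · Z)) · Z ≡⟨ ·-⊖ x (x · Z) Z ⟩
      (x · Z) ⊖ (x · Z · Z) ≡⟨ cong ((x · Z) ⊖_) (trans (square {Z} ZZ x) (·-I x)) ⟩
      (x · Z) ⊖ x ≡⟨ ⊖-flip x (x · Z) ⟩
      neg (x ⊖ (x · Z)) ∎)

  -- The vector v + vF is fixed by `F`. If it vanishes then vF = -v, and vR is fixed, because `F`
  -- and `R` anticommute on odd vectors.
  fixed-vector₁ : ∃ λ v → v ≢ 𝟎 × Odd v × Fixed v
  fixed-vector₁ = go odd-vector
    where
    go : (∃ λ v → v ≢ 𝟎 × Odd v) → ∃ λ v → v ≢ 𝟎 × Odd v × Fixed v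
    go (v , v≢𝟎 , odd) = at ((v ⊕ (v · F)) ≟V 𝟎)
      where
      at : Dec (v ⊕ (v · F) ≡ 𝟎) → ∃ λ v → v ≢ 𝟎 × Odd v × Fixed v
      at (no h) = v ⊕ (v · F) , h ,
        trans (vecMat-⊕ v (v · F) Z) (trans (cong₂ _⊕_ odd (odd-· {F} FZ odd)) (sym (scale-⊕ 𝟚 v (v · F)))) ,
        trans (vecMat-⊕ v (v · F) F) (trans (cong ((v · F) ⊕_) (trans (square {F} FF v) (·-I v))) (⊕-comm (v · F) v))
      at (yes h) = v · R , (λ e → v≢𝟎 (injective-odd {R} RR odd e)) , odd-· {R} RZ odd ,
        trans (flip-F odd) (trans (cong (λ t → neg (t · R)) (⊕-zero⇒neg v (v · F) h))
          (trans (cong neg (vecMat-scale 𝟚 v R)) (neg-involutive (v · R))))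

  -- The action of -1 + i - j, a zero divisor as its norm is 3 = 0. Its product with j - 1 - i
  -- vanishes, so its images w satisfy wJ = w + wI, the relation that `v₁` satisfies with `i₀` and
  -- `j₀`.
  quaternion : V → V
  quaternion v = (neg v ⊕ (v · I)) ⊕ neg (v · J)

  quaternion-· : ∀ v A → quaternion v · A ≡ (neg (v · A) ⊕ (v · I · A)) ⊕ neg (v · J · A)
  quaternion-· v A = trans (vecMat-⊕ (neg v ⊕ (v · I)) (neg (v · J)) A) (cong₂ _⊕_
    (trans (vecMat-⊕ (neg v) (v · I) A) (cong (_⊕ (v · I · A)) (vecMat-scale 𝟚 v A))) (vecMat-scale 𝟚 (v · J) A))

  JI-odd : ∀ {v} → Odd v → v · J · I ≡ neg (v · I · J)
  JI-odd {v} h = begin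
    v · J · I ≡⟨ move {J} {I} {Z} {I ⊗ J} JI v ⟩
    v · Z · (I ⊗ J) ≡⟨ cong (_· (I ⊗ J)) h ⟩
    neg v · (I ⊗ J) ≡⟨ vecMat-scale 𝟚 v (I ⊗ J) ⟩
    neg (v · (I ⊗ J)) ≡⟨ cong neg (·-⊗ v I J) ⟩
    neg (v · I · J) ∎

  quaternion-J : ∀ {v} → Odd v → quaternion v · J ≡ (neg (v · J) ⊕ (v · I · J)) ⊕ neg (neg v)
  quaternion-J {v} h = trans (quaternion-· v J)
    (cong (λ t → (neg (v · J) ⊕ (v · I · J)) ⊕ neg t) (trans (square {J} JJ v) h))

  quaternion-relation : ∀ {v} → Odd v → quaternion v · J ≡ quaternion v ⊕ (quaternion v · I)
  quaternion-relation {v} h = trans (quaternion-J h) (trans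
    (quaternion-identity v (v · I) (v · J) (v · I · J))
    (cong (quaternion v ⊕_) (sym (trans (quaternion-· v I) (cong₂ (λ s t → (neg (v · I) ⊕ s) ⊕ neg t)
      (trans (square {I} II v) h) (JI-odd h))))))

  -- If v and vI were both killed then vI = -v; applying `I` once more gives vII = v, against vII =
  -- -v.
  quaternion-nonzero : ∀ {v} → Odd v → v ≢ 𝟎 → quaternion v ≡ 𝟎 → quaternion (v · I) ≢ 𝟎
  quaternion-nonzero {v} h v≢𝟎 e e' = v≢𝟎 (self-neg v (begin
    v ≡⟨ neg-involutive v ⟨
    neg (neg v) ≡⟨ cong neg (trans (sym h) (sym (square {I} II v))) ⟩
    neg (v · I · I) ≡⟨ cong (λ t → neg (t · I)) vI ⟩
    neg (neg v · I) ≡⟨ cong neg (vecMat-scale 𝟚 v I) ⟩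
    neg (neg (v · I)) ≡⟨ neg-involutive (v · I) ⟩
    v · I ≡⟨ vI ⟩
    neg v ∎))
    where
    vI : v · I ≡ neg v
    vI = quaternion-kernel v (v · I) (v · J) (v · I · J) e
      (trans (sym (quaternion-J h)) (trans (cong (_· J) e) (vecMat-𝟎 J)))
      (trans (cong (λ t → (neg (v · I) ⊕ t) ⊕ neg (v · I · J)) (sym (trans (square {I} II v) h))) e')

  opaque
    base : ∃ λ w → w ≢ 𝟎 × Odd w × Fixed w × w · J ≡ w ⊕ (w · I)
    base = go fixed-vector₁
      where
      Result : Set
      Result = ∃ λ w → w ≢ 𝟎 × Odd w × Fixed w × w · J ≡ w ⊕ (w · I)
      build : ∀ {v} → Odd v → Fixed v → quaternion v ≢ 𝟎 → Result
      build {v} odd fix h = quaternion v , h ,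
        trans (quaternion-· v Z) (trans (cong₂ (λ s t → s ⊕ neg t)
          (trans (cong₂ (λ s t → neg s ⊕ t) odd (odd-· {I} IZ odd)) (sym (scale-⊕ 𝟚 (neg v) (v · I)))) (odd-· {J} JZ odd))
          (sym (scale-⊕ 𝟚 (neg v ⊕ (v · I)) (neg (v · J))))) ,
        trans (quaternion-· v F) (cong₂ (λ s t → s ⊕ neg t)
          (cong₂ (λ s t → neg s ⊕ t) fix (fixed-· {I} IF fix)) (fixed-· {J} JF fix)) ,
        quaternion-relation odd
      go : (∃ λ v → v ≢ 𝟎 × Odd v × Fixed v) → Result
      go (v , v≢𝟎 , odd , fix) = at (quaternion v ≟V 𝟎)
        where
        at : Dec (quaternion v ≡ 𝟎) → Result
        at (no h) = build odd fix h
        at (yes e) = build (odd-· {I} IZ odd) (fixed-· {I} IF fix) (quaternion-nonzero odd v≢𝟎 e)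

  w : V
  w = proj₁ base

  w≢𝟎 : w ≢ 𝟎
  w≢𝟎 = proj₁ (proj₂ base)

  odd : Odd w
  odd = proj₁ (proj₂ (proj₂ base))

  fixed : Fixed w
  fixed = proj₁ (proj₂ (proj₂ (proj₂ base)))

  wJ : w · J ≡ w ⊕ (w · I)
  wJ = proj₂ (proj₂ (proj₂ (proj₂ base)))

  wII : w · I · I ≡ neg w
  wII = trans (square {I} II w) odd

  P : Mat
  P = ⟨ w , w · I , w · R , w · R · I ⟩

  ⊕-⊖-cancel : (a b : V) → a ⊕ b ≡ 𝟎 → a ⊕ neg b ≡ 𝟎 → a ≡ 𝟎
  ⊕-⊖-cancel a b e f = self-neg a (begin
    a ≡⟨ ⊖≡𝟎 a b f ⟩
    b ≡⟨ ⊕-zero⇒neg a b e ⟩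
    neg a ∎)

  -- Such an x P is u + u'R with u and u' in ⟨w, wI⟩. `F` fixes u and negates u'R, so both vanish.
  -- Inside ⟨w, wI⟩ the map `I` squares to -1, and independence comes from the anisotropy of s² +
  -- t².
  kernel : ∀ x → x · P ≡ 𝟎 → x ≡ 𝟎
  kernel ⟨ s , t , s' , t' ⟩ e = conclude (independent s t u≡𝟎) (independent s' t' u'≡𝟎)
    where
    part : F3 → F3 → V
    part s t = scale s w ⊕ scale t (w · I)
    part-· : ∀ s t A → part s t · A ≡ scale s (w · A) ⊕ scale t (w · I · A)
    part-· s t A = trans (vecMat-⊕ (scale s w) (scale t (w · I)) A)
      (cong₂ _⊕_ (vecMat-scale s w A) (vecMat-scale t (w · I) A))
    part-odd : ∀ s t → Odd (part s t)
    part-odd s t = trans (part-· s t Z) (trans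
      (cong₂ (λ a b → scale s a ⊕ scale t b) odd (odd-· {I} IZ odd))
      (trans (cong₂ _⊕_ (swap s w) (swap t (w · I))) (sym (scale-⊕ 𝟚 (scale s w) (scale t (w · I))))))
      where
      swap : ∀ s v → scale s (neg v) ≡ neg (scale s v)
      swap s v = trans (sym (scale-*₃ s 𝟚 v)) (trans (cong (λ c → scale c v) (*₃-comm s 𝟚)) (scale-*₃ 𝟚 s v))
    part-fixed : ∀ s t → Fixed (part s t)
    part-fixed s t = trans (part-· s t F) (cong₂ (λ a b → scale s a ⊕ scale t b) fixed (fixed-· {I} IF fixed))
    u u' : V
    u = part s t
    u' = part s' t'
    xP : u ⊕ (u' · R) ≡ 𝟎
    xP = begin
      u ⊕ (u' · R)
        ≡⟨ cong (u ⊕_) (trans (part-· s' t' R) (cong (λ a → scale s' (w · R) ⊕ scale t' a) (move {I} {R} {R} {I} IR w))) ⟩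
      (scale s w ⊕ scale t (w · I)) ⊕ (scale s' (w · R) ⊕ scale t' (w · R · I))
        ≡⟨ ⊕-assoc (scale s w) (scale t (w · I)) _ ⟩
      scale s w ⊕ (scale t (w · I) ⊕ (scale s' (w · R) ⊕ scale t' (w · R · I)))
        ≡⟨ cong (λ a → scale s w ⊕ (scale t (w · I) ⊕ (scale s' (w · R) ⊕ a))) (⊕-identityʳ _) ⟨
      ⟨ s , t , s' , t' ⟩ · P
        ≡⟨ e ⟩
      𝟎 ∎
    xPF : u ⊕ neg (u' · R) ≡ 𝟎
    xPF = begin
      u ⊕ neg (u' · R)
        ≡⟨ cong₂ _⊕_ (part-fixed s t) (trans (flip-F (part-odd s' t')) (cong (λ a → neg (a · R)) (part-fixed s' t'))) ⟨
      (u · F) ⊕ (u' · R · F)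
        ≡⟨ vecMat-⊕ u (u' · R) F ⟨
      (u ⊕ (u' · R)) · F
        ≡⟨ trans (cong (_· F) xP) (vecMat-𝟎 F) ⟩
      𝟎 ∎
    u≡𝟎 : u ≡ 𝟎
    u≡𝟎 = ⊕-⊖-cancel u (u' · R) xP xPF
    u'≡𝟎 : u' ≡ 𝟎
    u'≡𝟎 = injective-odd {R} RR (part-odd s' t')
      (trans (sym (⊕-identityˡ (u' · R))) (trans (cong (_⊕ (u' · R)) (sym u≡𝟎)) xP))
    independent : ∀ s t → part s t ≡ 𝟎 → s ≡ 𝟘 × t ≡ 𝟘
    independent s t h = [ (λ z → z) , (λ z → contradiction z w≢𝟎) ]′ (anisotropic s t w (w · I) h
      (trans (cong (λ a → scale s (w · I) ⊕ scale t a) (sym wII))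
        (trans (sym (part-· s t I)) (trans (cong (_· I) h) (vecMat-𝟎 I)))))
    conclude : s ≡ 𝟘 × t ≡ 𝟘 → s' ≡ 𝟘 × t' ≡ 𝟘 → ⟨ s , t , s' , t' ⟩ ≡ 𝟎
    conclude (refl , refl) (refl , refl) = refl

  opaque
    P-invertible : ∃ λ P' → Inverses P P'
    P-invertible = invertible P kernel

  P⁻¹ : Mat
  P⁻¹ = proj₁ P-invertible

  C C⁻¹ : Mat
  C = P⁻¹ ⊗ S₀
  C⁻¹ = S₀⁻¹ ⊗ P

  C-inverses : Inverses C C⁻¹
  C-inverses = Inverses-⊗ {P⁻¹} {P} {S₀} {S₀⁻¹} (Inverses-sym (proj₂ P-invertible)) (refl , refl)

  Intertwines : Mat → Mat → Set
  Intertwines A B = A ⊗ C⁻¹ ≡ C⁻¹ ⊗ B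

  intertwines-⊗ : ∀ {A A' B B'} → Intertwines A B → Intertwines A' B' → Intertwines (A ⊗ A') (B ⊗ B')
  intertwines-⊗ {A} {A'} {B} {B'} e f = begin
    (A ⊗ A') ⊗ C⁻¹ ≡⟨ ⊗-assoc A A' C⁻¹ ⟩
    A ⊗ (A' ⊗ C⁻¹) ≡⟨ cong (A ⊗_) f ⟩
    A ⊗ (C⁻¹ ⊗ B') ≡⟨ ⊗-assoc A C⁻¹ B' ⟨
    (A ⊗ C⁻¹) ⊗ B' ≡⟨ cong (_⊗ B') e ⟩
    (C⁻¹ ⊗ B) ⊗ B' ≡⟨ ⊗-assoc C⁻¹ B B' ⟩
    C⁻¹ ⊗ (B ⊗ B') ∎

  -- The rows of S₀ are v₁, v₁ i₀, v₁ r₀ and v₁ r₀ i₀, and C⁻¹ carries them to the rows of P.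
  b₁ b₂ b₃ b₄ : V
  b₁ = v₁
  b₂ = v₁ · i₀
  b₃ = v₁ · r₀
  b₄ = v₁ · r₀ · i₀

  rows : ⟨ b₁ · C⁻¹ , b₂ · C⁻¹ , b₃ · C⁻¹ , b₄ · C⁻¹ ⟩ ≡ P
  rows = ⊗-cancelˡ {S₀} {S₀⁻¹} refl P

  c₁ : b₁ · C⁻¹ ≡ w
  c₁ = Vecₚ.∷-injectiveˡ rows

  c₂ : b₂ · C⁻¹ ≡ w · I
  c₂ = Vecₚ.∷-injectiveˡ (Vecₚ.∷-injectiveʳ rows)

  c₃ : b₃ · C⁻¹ ≡ w · R
  c₃ = Vecₚ.∷-injectiveˡ (Vecₚ.∷-injectiveʳ (Vecₚ.∷-injectiveʳ rows))

  c₄ : b₄ · C⁻¹ ≡ w · R · I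
  c₄ = Vecₚ.∷-injectiveˡ (Vecₚ.∷-injectiveʳ (Vecₚ.∷-injectiveʳ (Vecₚ.∷-injectiveʳ rows)))

  on-basis : ∀ A B → b₁ · A · C⁻¹ ≡ w · B → b₂ · A · C⁻¹ ≡ w · I · B →
    b₃ · A · C⁻¹ ≡ w · R · B → b₄ · A · C⁻¹ ≡ w · R · I · B → Intertwines A B
  on-basis A B e₁ e₂ e₃ e₄ = begin
    A ⊗ C⁻¹ ≡⟨ ⊗-cancelˡ {S₀⁻¹} {S₀} refl (A ⊗ C⁻¹) ⟨
    S₀⁻¹ ⊗ (S₀ ⊗ (A ⊗ C⁻¹)) ≡⟨ cong (S₀⁻¹ ⊗_) (trans (sym (⊗-assoc S₀ A C⁻¹)) (four e₁ e₂ e₃ e₄)) ⟩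
    S₀⁻¹ ⊗ (P ⊗ B) ≡⟨ ⊗-assoc S₀⁻¹ P B ⟨
    C⁻¹ ⊗ B ∎
    where
    four : ∀ {a b c d a' b' c' d' : V} → a ≡ a' → b ≡ b' → c ≡ c' → d ≡ d' →
      ⟨ a , b , c , d ⟩ ≡ ⟨ a' , b' , c' , d' ⟩
    four refl refl refl refl = refl

  neg-image : ∀ {b v} → b · C⁻¹ ≡ v → neg b · C⁻¹ ≡ neg v
  neg-image {b} e = trans (vecMat-scale 𝟚 b C⁻¹) (cong neg e)

  sum-image : ∀ {b b' v v'} → b · C⁻¹ ≡ v → b' · C⁻¹ ≡ v' → (b ⊕ b') · C⁻¹ ≡ v ⊕ v'
  sum-image {b} {b'} e e' = trans (vecMat-⊕ b b' C⁻¹) (cong₂ _⊕_ e e')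

  fixed-I : Fixed (w · I)
  fixed-I = fixed-· {I} IF fixed

  wRF : w · R · F ≡ neg (w · R)
  wRF = trans (flip-F odd) (cong (λ t → neg (t · R)) fixed)

  wRIF : w · R · I · F ≡ neg (w · R · I)
  wRIF = trans (move {I} {F} {F} {I} IF (w · R)) (trans (cong (_· I) wRF) (vecMat-scale 𝟚 (w · R) I))

  wRR : w · R · R ≡ neg w
  wRR = trans (square {R} RR w) odd

  wIR : w · I · R ≡ w · R · I
  wIR = move {I} {R} {R} {I} IR w

  wRII : w · R · I · I ≡ neg (w · R)
  wRII = trans (square {I} II (w · R)) (odd-· {R} RZ odd)

  wRIR : w · R · I · R ≡ neg (w · I)
  wRIR = trans (move {I} {R} {R} {I} IR (w · R)) (trans (cong (_· I) wRR) (vecMat-scale 𝟚 w I))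

  wIJ : w · I · J ≡ w ⊕ neg (w · I)
  wIJ = begin
    w · I · J ≡⟨ neg-involutive _ ⟨
    neg (neg (w · I · J)) ≡⟨ cong neg (JI-odd odd) ⟨
    neg (w · J · I) ≡⟨ cong (λ t → neg (t · I)) wJ ⟩
    neg ((w ⊕ (w · I)) · I) ≡⟨ cong neg (trans (vecMat-⊕ w (w · I) I) (cong ((w · I) ⊕_) wII)) ⟩
    neg ((w · I) ⊕ neg w) ≡⟨ ⊖-flip (w · I) w ⟨
    w ⊕ neg (w · I) ∎

  wRJ : w · R · J ≡ (w · R) ⊕ (w · R · I)
  wRJ = trans (sym (move {J} {R} {R} {J} JR w)) (trans (cong (_· R) wJ)
    (trans (vecMat-⊕ w (w · I) R) (cong ((w · R) ⊕_) wIR)))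

  wRIJ : w · R · I · J ≡ (w · R) ⊕ neg (w · R · I)
  wRIJ = begin
    w · R · I · J ≡⟨ cong (_· J) wIR ⟨
    w · I · R · J ≡⟨ move {J} {R} {R} {J} JR (w · I) ⟨
    w · I · J · R ≡⟨ cong (_· R) wIJ ⟩
    (w ⊕ neg (w · I)) · R ≡⟨ trans (vecMat-⊕ w (neg (w · I)) R) (cong ((w · R) ⊕_) (vecMat-scale 𝟚 (w · I) R)) ⟩
    (w · R) ⊕ neg (w · I · R) ≡⟨ cong (λ t → (w · R) ⊕ neg t) wIR ⟩
    (w · R) ⊕ neg (w · R · I) ∎

  int-f : Intertwines f₀ F
  int-f = on-basis f₀ F (trans c₁ (sym fixed)) (trans c₂ (sym fixed-I))
    (trans (neg-image {b₃} c₃) (sym wRF)) (trans (neg-image {b₄} c₄) (sym wRIF))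

  int-r : Intertwines r₀ R
  int-r = on-basis r₀ R c₃ (trans c₄ (sym wIR)) (trans (neg-image {b₁} c₁) (sym wRR))
    (trans (neg-image {b₂} c₂) (sym wRIR))

  int-i : Intertwines i₀ I
  int-i = on-basis i₀ I c₂ (trans (neg-image {b₁} c₁) (sym wII)) c₄ (trans (neg-image {b₃} c₃) (sym wRII))

  int-j : Intertwines j₀ J
  int-j = on-basis j₀ J (trans (sum-image {b₁} {b₂} c₁ c₂) (sym wJ))
    (trans (sum-image {b₁} {neg b₂} c₁ (neg-image {b₂} c₂)) (sym wIJ))
    (trans (sum-image {b₃} {b₄} c₃ c₄) (sym wRJ))
    (trans (sum-image {b₃} {neg b₄} c₃ (neg-image {b₄} c₄)) (sym wRIJ))

  int-I : ∀ {B} → B ≡ I₄ → Intertwines I₄ B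
  int-I refl = trans (⊗-identityˡ C⁻¹) (sym (⊗-identityʳ C⁻¹))

  int-rot : ∀ a → Intertwines (r₀^ a) (φ ((a , false) , eQ))
  int-rot r0 = int-I φ-1
  int-rot r1 = int-r
  int-rot r2 = subst (Intertwines (r₀ ⊗ r₀)) RR (intertwines-⊗ {r₀} {r₀} int-r int-r)
  int-rot r3 = subst (Intertwines (r₀ ⊗ (r₀ ⊗ r₀))) (sym (hom r eQ zD eQ))
    (intertwines-⊗ {r₀} {r₀ ⊗ r₀} int-r (int-rot r2))

  int-D : ∀ d → Intertwines (φD d) (φ (d , eQ))
  int-D (a , false) = int-rot a
  int-D (a , true) = subst (Intertwines (r₀^ a ⊗ f₀)) (trans (sym (hom (a , false) eQ f eQ))
    (cong (λ b → φ ((b , true) , eQ)) (+₄-r0 a))) (intertwines-⊗ {r₀^ a} {f₀} (int-rot a) int-f)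
    where
    +₄-r0 : ∀ a → a +₄ r0 ≡ a
    +₄-r0 r0 = refl
    +₄-r0 r1 = refl
    +₄-r0 r2 = refl
    +₄-r0 r3 = refl

  int-U : ∀ u → Intertwines (φU u) (φ (eD , (false , u)))
  int-U u1 = int-I φ-1
  int-U ui = int-i
  int-U uj = int-j
  int-U uk = subst (Intertwines k₀) (sym (hom eD i eD j)) (intertwines-⊗ {i₀} {j₀} int-i int-j)

  int-Q : ∀ q → Intertwines (φQ q) (φ (eD , q))
  int-Q (false , u) = int-U u
  int-Q (true , u) = subst₂ Intertwines (minus u) (trans (cong (_⊗ φ (eD , (false , u))) (sym zQ-Z))
    (trans (sym (hom eD zQ eD (false , u))) (cong (λ q → φ (eD , q)) (zQ-· u))))
    (intertwines-⊗ {r₀ ⊗ r₀} {φU u} (int-rot r2) (int-U u))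
    where
    minus : ∀ u → (r₀ ⊗ r₀) ⊗ φU u ≡ negM (φU u)
    minus u1 = refl
    minus ui = refl
    minus uj = refl
    minus uk = refl
    zQ-· : ∀ u → zQ ·Q (false , u) ≡ (true , u)
    zQ-· u1 = refl
    zQ-· ui = refl
    zQ-· uj = refl
    zQ-· uk = refl

  intertwines : ∀ p → Intertwines (φ₀ p) (φ p)
  intertwines (d , q) = subst (Intertwines (φ₀ (d , q))) (trans (sym (hom d eQ eD q)) (cong₂ (λ d q → φ (d , q)) (·D-e d) (e-·Q q)))
    (intertwines-⊗ {φD d} {φQ q} (int-D d) (int-Q q))
    where
    ·D-e : ∀ d → d ·D eD ≡ d
    ·D-e (r0 , false) = refl
    ·D-e (r1 , false) = refl
    ·D-e (r2 , false) = refl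
    ·D-e (r3 , false) = refl
    ·D-e (r0 , true) = refl
    ·D-e (r1 , true) = refl
    ·D-e (r2 , true) = refl
    ·D-e (r3 , true) = refl
    e-·Q : ∀ q → eQ ·Q q ≡ q
    e-·Q (false , u) = refl
    e-·Q (true , u) = refl

  normalises : ∀ {A A'} → Inverses A A' → (∀ B → InImage φ B → InImage φ ((A' ⊗ B) ⊗ A)) →
    Norm (C⁻¹ ⊗ (A ⊗ C))
  normalises {A} {A'} (AA' , _) h = Norm⁺ λ {X} X∈ → image (InR₀⇒φ₀ X∈)
    where
    image : ∀ {X} → (∃ λ p → X ≡ φ₀ p) → ∃ λ Y → InR₀ Y × X ⊗ (C⁻¹ ⊗ (A ⊗ C)) ≡ (C⁻¹ ⊗ (A ⊗ C)) ⊗ Y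
    image {X} (p , X≡) = φ₀ p′ , InR₀⁺ (φ₀∈R₀ (proj₁ (proj₁ p′)) (proj₂ (proj₁ p′)) (proj₁ (proj₂ p′)) (proj₂ (proj₂ p′))) , (begin
      X ⊗ (C⁻¹ ⊗ (A ⊗ C)) ≡⟨ cong (_⊗ (C⁻¹ ⊗ (A ⊗ C))) X≡ ⟩
      φ₀ p ⊗ (C⁻¹ ⊗ (A ⊗ C)) ≡⟨ ⊗-assoc (φ₀ p) C⁻¹ (A ⊗ C) ⟨
      (φ₀ p ⊗ C⁻¹) ⊗ (A ⊗ C) ≡⟨ cong (_⊗ (A ⊗ C)) (intertwines p) ⟩
      (C⁻¹ ⊗ φ p) ⊗ (A ⊗ C) ≡⟨ ⊗-assoc C⁻¹ (φ p) (A ⊗ C) ⟩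
      C⁻¹ ⊗ (φ p ⊗ (A ⊗ C)) ≡⟨ cong (C⁻¹ ⊗_) (trans (sym (⊗-assoc (φ p) A C)) (cong (_⊗ C) φpA)) ⟩
      C⁻¹ ⊗ ((A ⊗ φ p′) ⊗ C) ≡⟨ cong (C⁻¹ ⊗_) (⊗-assoc A (φ p′) C) ⟩
      C⁻¹ ⊗ (A ⊗ (φ p′ ⊗ C)) ≡⟨ cong (λ t → C⁻¹ ⊗ (A ⊗ t)) φp′C ⟩
      C⁻¹ ⊗ (A ⊗ (C ⊗ φ₀ p′)) ≡⟨ cong (C⁻¹ ⊗_) (⊗-assoc A C (φ₀ p′)) ⟨
      C⁻¹ ⊗ ((A ⊗ C) ⊗ φ₀ p′) ≡⟨ ⊗-assoc C⁻¹ (A ⊗ C) (φ₀ p′) ⟨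
      (C⁻¹ ⊗ (A ⊗ C)) ⊗ φ₀ p′ ∎)
      where
      found : InImage φ ((A' ⊗ φ p) ⊗ A)
      found = h (φ p) (p , refl)
      p′ : D8 × Q8
      p′ = proj₁ found
      φpA : φ p ⊗ A ≡ A ⊗ φ p′
      φpA = begin
        φ p ⊗ A ≡⟨ ⊗-cancelˡ {A} {A'} AA' (φ p ⊗ A) ⟨
        A ⊗ (A' ⊗ (φ p ⊗ A)) ≡⟨ cong (A ⊗_) (⊗-assoc A' (φ p) A) ⟨
        A ⊗ ((A' ⊗ φ p) ⊗ A) ≡⟨ cong (A ⊗_) (proj₂ found) ⟨
        A ⊗ φ p′ ∎
      φp′C : φ p′ ⊗ C ≡ C ⊗ φ₀ p′
      φp′C = begin
        φ p′ ⊗ C ≡⟨ ⊗-cancelˡ {C} {C⁻¹} (proj₁ C-inverses) (φ p′ ⊗ C) ⟨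
        C ⊗ (C⁻¹ ⊗ (φ p′ ⊗ C)) ≡⟨ cong (C ⊗_) (trans (sym (⊗-assoc C⁻¹ (φ p′) C)) (cong (_⊗ C) (sym (intertwines p′)))) ⟩
        C ⊗ ((φ₀ p′ ⊗ C⁻¹) ⊗ C) ≡⟨ cong (C ⊗_) (⊗-cancelʳ {C⁻¹} {C} (proj₂ C-inverses) (φ₀ p′)) ⟩
        C ⊗ φ₀ p′ ∎

-- From the flag-transitive group to Ĝ

aff-I : ∀ c x → aff I₄ c x ≡ x ⊕ c
aff-I c x = cong (_⊕ c) (·-I x)

aff-𝟎 : ∀ A x → aff A 𝟎 x ≡ x · A
aff-𝟎 A x = ⊕-identityʳ (x · A)

theorem4p2 : (D : Design 9 3) (G₀ : Mat → Set) →
    IsSubgroupGL G₀ → InNormalizerOfD8Q8 G₀ →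
    IsAutGroup D G₀ → FlagTransitive D G₀ →
    IsoToD₃ D
theorem4p2 D G₀ (invertible-G₀ , I∈ , _ , inverse∈) (φ , rep , normal) aut flag =
  finish (untransport {D} C-inverses (setup⇒iso D′ setup))
  where
  open Frame φ rep
  D′ : Design 9 3
  D′ = transport D C-inverses

  preserves : ∀ {A} → G₀ A → Preserves D A
  preserves {A} A∈ b = let (b' , h) = aut A 𝟎 A∈ b in b' , λ x → trans (cong (inc D b') (sym (aff-𝟎 A x))) (h x)

  isAut′ : ∀ {A} → G₀ A → IsAut D′ (C⁻¹ ⊗ (A ⊗ C))
  isAut′ {A} A∈ = build (invertible-G₀ A A∈)
    where
    build : (Σ Mat λ A' → (A ⊗ A' ≡ I₄) × (A' ⊗ A ≡ I₄)) → IsAut D′ (C⁻¹ ⊗ (A ⊗ C))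
    build (A' , AA' , A'A) = C⁻¹ ⊗ (A' ⊗ C) , conj-inverses {C} {C⁻¹} {A} {A'} C-inverses (AA' , A'A) ,
      ( normalises {A} {A'} (AA' , A'A) (λ B → proj₁ (normal A A' A∈ AA' B))
      , normalises {A'} {A} (A'A , AA') (λ B → proj₁ (normal A' A A'∈ A'A B)) ) ,
      preserves-transport D C-inverses {A} (preserves A∈) , preserves-transport D C-inverses {A'} (preserves A'∈)
      where
      A'∈ : G₀ A'
      A'∈ = inverse∈ A A' A∈ AA'

  setup : Setup D′
  setup = record
    { translate = translate-transport D C-inverses λ c b → let (b' , h) = aut I₄ c I∈ b in
        b' , λ x → trans (cong (inc D b') (sym (aff-I c x))) (h x)
    ; transitive = λ b b' b∋𝟎 b'∋𝟎 → through b b' (flag b b' 𝟎 𝟎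
        (trans (cong (inc D b) (sym (vecMat-𝟎 C⁻¹))) b∋𝟎) (trans (cong (inc D b') (sym (vecMat-𝟎 C⁻¹))) b'∋𝟎))
    }
    where
    through : ∀ b b' → (Σ Mat λ A → Σ V λ c → G₀ A × (aff A c 𝟎 ≡ 𝟎) × (∀ z → inc D b' (aff A c z) ≡ inc D b z)) →
      ∃ λ A → IsAut D′ A × (∀ x → inc D′ b' (x · A) ≡ inc D′ b x)
    through b b' (A , c , A∈ , e , h) = C⁻¹ ⊗ (A ⊗ C) , isAut′ A∈ , λ x → begin
      inc D b' (x · (C⁻¹ ⊗ (A ⊗ C)) · C⁻¹)
        ≡⟨ cong (inc D b') (trans (cong (_· C⁻¹) (sym (·-conj C-inverses A x)))
             (cancelʳ (proj₁ C-inverses) (x · C⁻¹ · A))) ⟩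
      inc D b' (x · C⁻¹ · A)
        ≡⟨ cong (inc D b') (trans (cong ((x · C⁻¹ · A) ⊕_) c≡𝟎) (⊕-identityʳ (x · C⁻¹ · A))) ⟨
      inc D b' (aff A c (x · C⁻¹))
        ≡⟨ h (x · C⁻¹) ⟩
      inc D b (x · C⁻¹) ∎
      where
      -- The affine map carries a flag at 0 to a flag at 0, so it is linear.
      c≡𝟎 : c ≡ 𝟎
      c≡𝟎 = trans (sym (trans (cong (_⊕ c) (vecMat-𝟎 A)) (⊕-identityˡ c))) e

  finish : LinearlyIsoToD₃ D → IsoToD₃ D
  finish (E , E' , (EE' , E'E) , blocks , onto) =
    mk↔ₛ′ (_· E) (_· E') (cancelʳ E'E) (cancelʳ EE') , blocks , onto
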